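{- Let $p$ be an odd prime, let $a\in\mathbb{Z}_p$, and let $\int_{\mathbb{Z}_p}f(x)\,d\mu_{ -1}(x)=\lim_{q\to-1}\int_{\mathbb{Z}_p}f(x)\,d\mu_q(x)$. Then $$\tan\frac a2=-\int_{\mathbb{Z}_p}\sin(ax)\,d\mu_{ -1}(x)=\sum_{n=0}^\infty\frac{(-1)^{n+1}a^{2n+1}}{(2n+1)!}E_{2n+1},$$ where $E_n$ are the $n$-th Euler numbers.
   Context: Here $\sin$ and $\cos$ are the $p$-adic functions given by their usual power series and $\tan=\sin/\cos$. For a strictly differentiable function $f$ on $\mathbb{Z}_p$ (i.e. $f\in C^{(1)}(\mathbb{Z}_p)$), the $p$-adic $q$-integral is $$\int_{\mathbb{Z}_p}f(x)\,d\mu_q(x)=\lim_{N\to\infty}\frac{1}{[p^N]_q}\sum_{0\le x<p^N}f(x)q^x,\qquad [x]_q=\frac{1-q^x}{1-q},$$ and its value at $q=-1$ (the fermionic $p$-adic integral) is $$\int_{\mathbb{Z}_p}f(x)\,d\mu_{ -1}(x)=\lim_{N\to\infty}\sum_{x=0}^{p^N-1}f(x)(-1)^x.$$ The Euler numbers $E_n$ are defined by $\frac{2}{e^t+1}=\sum_{n=0}^\infty E_n\frac{t^n}{n!}$.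
   Formalization: The formal theorem assumes in addition that the sine series converges at a (for odd p: that p divides a); for a unit a in Z_p, such as a = 1, sin(ax) is undefined at x = 1. The limit q → −1 is taken over q in Q_p. -}

module Defs where

open import Data.Nat as ℕ using (ℕ; zero; suc; _!)
import Data.Nat.Properties as ℕProps
import Data.Nat.Divisibility as ℕ∣
open import Data.Nat.Divisibility using (_∣_; _∣?_)
open import Data.Nat.Induction using (<-rec)
open import Data.Nat.Primality using (Prime; euclidsLemma; prime⇒nonZero; prime⇒nonTrivial)
open import Data.Integer as ℤ using (ℤ; +_; -1ℤ)
import Data.Integer.Properties as ℤProps
open import Data.Rational as ℚ using (ℚ; 0ℚ; 1ℚ; _/_; ↥_; ↧_; ↧ₙ_)
import Data.Rational.Properties as ℚProps
open import Data.Rational.Solver using (module +-*-Solver)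
import Data.Rational.Unnormalised as ℚᵘ
import Data.Rational.Unnormalised.Properties as ℚᵘProps
open import Data.List using (List; []; _∷_)
open import Data.Product using (Σ-syntax; ∃-syntax; _×_; _,_)
open import Data.Sum using (inj₁; inj₂)
open import Relation.Nullary using (¬_; Dec; yes; no)
open import Relation.Binary.PropositionalEquality
  using (_≡_; refl; sym; trans; cong; cong₂; subst; module ≡-Reasoning)

fromℤ : ℤ → ℚ
fromℤ i = i / 1

fromℕ : ℕ → ℚ
fromℕ n = fromℤ (+ n)

------------------------------------------------------------------------
-- Formal power series over ℚ and Euler numbers

PowerSeries : Set
PowerSeries = ℕ → ℚ

_⊕_ : PowerSeries → PowerSeries → PowerSeries
(f ⊕ g) n = f n ℚ.+ g n

const : ℚ → PowerSeries
const c zero    = c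
const c (suc _) = 0ℚ

-- f n , f (n − 1) , … , f 0
downFrom : PowerSeries → ℕ → List ℚ
downFrom f zero    = f 0 ∷ []
downFrom f (suc n) = f (suc n) ∷ downFrom f n

-- g 0 * x₀ + g 1 * x₁ + …
dot : PowerSeries → List ℚ → ℚ
dot g []       = 0ℚ
dot g (x ∷ xs) = g 0 ℚ.* x ℚ.+ dot (λ k → g (suc k)) xs

-- Cauchy product
_⊛_ : PowerSeries → PowerSeries → PowerSeries
(g ⊛ f) n = dot g (downFrom f n)

-- divide f g is the power series f / g, i.e. the solution of g ⊛ divide f g = f
-- (divide-correct), its n-th coefficient being found from those of index n − 1, …, 0,
-- which quotients f g n lists.
module _ (f g : PowerSeries) .{{_ : ℚ.NonZero (g 0)}} where

  mutual
    quotients : ℕ → List ℚ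
    quotients zero    = []
    quotients (suc n) = divide n ∷ quotients n

    divide : PowerSeries
    divide n = (f n ℚ.- dot (λ k → g (suc k)) (quotients n)) ℚ.÷ g 0

  quotients≡ : ∀ n → quotients (suc n) ≡ downFrom divide n
  quotients≡ zero    = refl
  quotients≡ (suc n) = cong (divide (suc n) ∷_) (quotients≡ n)

  cancel : ∀ x d c .{{_ : ℚ.NonZero c}} → c ℚ.* ((x ℚ.- d) ℚ.÷ c) ℚ.+ d ≡ x
  cancel x d c = begin
    c ℚ.* ((x ℚ.- d) ℚ.* ℚ.1/ c) ℚ.+ d    ≡⟨ solve 4 (λ x d c i →
        c :* ((x :- d) :* i) :+ d := (c :* i) :* (x :- d) :+ d) refl x d c (ℚ.1/ c) ⟩
    (c ℚ.* ℚ.1/ c) ℚ.* (x ℚ.- d) ℚ.+ d    ≡⟨ cong (λ u → u ℚ.* (x ℚ.- d) ℚ.+ d) (ℚProps.*-inverseʳ c) ⟩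
    1ℚ ℚ.* (x ℚ.- d) ℚ.+ d                ≡⟨ solve 2 (λ x d →
        con 1ℚ :* (x :- d) :+ d := x) refl x d ⟩
    x ∎
    where open ≡-Reasoning
          open +-*-Solver

  divide-correct : ∀ n → (g ⊛ divide) n ≡ f n
  divide-correct n =
    trans (cong (dot g) (sym (quotients≡ n)))
          (cancel (f n) (dot (λ k → g (suc k)) (quotients n)) (g 0))

1/_! : ℕ → ℚ
1/ n ! = (+ 1 / (n !)) {{ℕProps._!≢0 n}}

-- e^t
expSeries : PowerSeries
expSeries n = 1/ n !

-- E n is n! times the coefficient of tⁿ in 2 / (e^t + 1).
E : ℕ → ℚ
E n = fromℕ (n !) ℚ.* divide (const (fromℕ 2)) (expSeries ⊕ const 1ℚ) n

------------------------------------------------------------------------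
-- p-adic numbers

fromℤ-* : ∀ i j → fromℤ i ℚ.* fromℤ j ≡ fromℤ (i ℤ.* j)
fromℤ-* i j = ℚProps.toℚᵘ-injective (begin
  ℚ.toℚᵘ (fromℤ i ℚ.* fromℤ j)              ≈⟨ ℚProps.toℚᵘ-homo-* (fromℤ i) (fromℤ j) ⟩
  ℚ.toℚᵘ (fromℤ i) ℚᵘ.* ℚ.toℚᵘ (fromℤ j)
    ≈⟨ ℚᵘProps.*-cong (ℚProps.toℚᵘ-fromℚᵘ (ℚᵘ.mkℚᵘ i 0)) (ℚProps.toℚᵘ-fromℚᵘ (ℚᵘ.mkℚᵘ j 0)) ⟩
  ℚᵘ.mkℚᵘ (i ℤ.* j) 0                       ≈⟨ ℚᵘProps.≃-sym (ℚProps.toℚᵘ-fromℚᵘ (ℚᵘ.mkℚᵘ (i ℤ.* j) 0)) ⟩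
  ℚ.toℚᵘ (fromℤ (i ℤ.* j)) ∎)
  where open ℚᵘProps.≃-Reasoning

fromℤ-+ : ∀ i j → fromℤ i ℚ.+ fromℤ j ≡ fromℤ (i ℤ.+ j)
fromℤ-+ i j = ℚProps.toℚᵘ-injective (begin
  ℚ.toℚᵘ (fromℤ i ℚ.+ fromℤ j)              ≈⟨ ℚProps.toℚᵘ-homo-+ (fromℤ i) (fromℤ j) ⟩
  ℚ.toℚᵘ (fromℤ i) ℚᵘ.+ ℚ.toℚᵘ (fromℤ j)
    ≈⟨ ℚᵘProps.+-cong (ℚProps.toℚᵘ-fromℚᵘ (ℚᵘ.mkℚᵘ i 0)) (ℚProps.toℚᵘ-fromℚᵘ (ℚᵘ.mkℚᵘ j 0)) ⟩
  ℚᵘ.mkℚᵘ i 0 ℚᵘ.+ ℚᵘ.mkℚᵘ j 0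
    ≈⟨ ℚᵘ.*≡* (cong (ℤ._* + 1) (cong₂ ℤ._+_ (ℤProps.*-identityʳ i) (ℤProps.*-identityʳ j))) ⟩
  ℚᵘ.mkℚᵘ (i ℤ.+ j) 0                       ≈⟨ ℚᵘProps.≃-sym (ℚProps.toℚᵘ-fromℚᵘ (ℚᵘ.mkℚᵘ (i ℤ.+ j) 0)) ⟩
  ℚ.toℚᵘ (fromℤ (i ℤ.+ j)) ∎)
  where open ℚᵘProps.≃-Reasoning

fromℤ-neg : ∀ i → ℚ.- fromℤ i ≡ fromℤ (ℤ.- i)
fromℤ-neg i = ℚProps.toℚᵘ-injective (begin
  ℚ.toℚᵘ (ℚ.- fromℤ i)        ≈⟨ ℚProps.toℚᵘ-homo‿- (fromℤ i) ⟩
  ℚᵘ.- ℚ.toℚᵘ (fromℤ i)       ≈⟨ ℚᵘProps.-‿cong (ℚProps.toℚᵘ-fromℚᵘ (ℚᵘ.mkℚᵘ i 0)) ⟩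
  ℚᵘ.mkℚᵘ (ℤ.- i) 0           ≈⟨ ℚᵘProps.≃-sym (ℚProps.toℚᵘ-fromℚᵘ (ℚᵘ.mkℚᵘ (ℤ.- i) 0)) ⟩
  ℚ.toℚᵘ (fromℤ (ℤ.- i)) ∎)
  where open ℚᵘProps.≃-Reasoning

fromℕ-* : ∀ m n → fromℕ m ℚ.* fromℕ n ≡ fromℕ (m ℕ.* n)
fromℕ-* m n = trans (fromℤ-* (+ m) (+ n)) (cong fromℤ (sym (ℤProps.pos-* m n)))

fromℕ-inverse : ∀ n .{{_ : ℕ.NonZero n}} → (+ 1 / n) ℚ.* fromℕ n ≡ 1ℚ
fromℕ-inverse n@(suc n-1) = ℚProps.toℚᵘ-injective (begin
  ℚ.toℚᵘ ((+ 1 / n) ℚ.* fromℕ n)            ≈⟨ ℚProps.toℚᵘ-homo-* (+ 1 / n) (fromℕ n) ⟩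
  ℚ.toℚᵘ (+ 1 / n) ℚᵘ.* ℚ.toℚᵘ (fromℕ n)
    ≈⟨ ℚᵘProps.*-cong (ℚProps.toℚᵘ-fromℚᵘ (ℚᵘ.mkℚᵘ (+ 1) n-1))
                      (ℚProps.toℚᵘ-fromℚᵘ (ℚᵘ.mkℚᵘ (+ n) 0)) ⟩
  ℚᵘ.mkℚᵘ (+ 1) n-1 ℚᵘ.* ℚᵘ.mkℚᵘ (+ n) 0
    ≈⟨ ℚᵘ.*≡* (trans (ℤProps.*-identityʳ _) (trans (ℤProps.*-identityˡ (+ n))
         (sym (trans (ℤProps.*-identityˡ _) (cong +_ (ℕProps.*-identityʳ n)))))) ⟩
  ℚ.toℚᵘ 1ℚ ∎)
  where open ℚᵘProps.≃-Reasoning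

fromℕ-cancel : ∀ n .{{_ : ℕ.NonZero n}} {x y} → fromℕ n ℚ.* x ≡ fromℕ n ℚ.* y → x ≡ y
fromℕ-cancel n {x} {y} eq = begin
  x                                   ≡⟨ lemma x ⟨
  (+ 1 / n) ℚ.* (fromℕ n ℚ.* x)       ≡⟨ cong ((+ 1 / n) ℚ.*_) eq ⟩
  (+ 1 / n) ℚ.* (fromℕ n ℚ.* y)       ≡⟨ lemma y ⟩
  y                                   ∎
  where
  open ≡-Reasoning
  lemma : ∀ z → (+ 1 / n) ℚ.* (fromℕ n ℚ.* z) ≡ z
  lemma z = trans (sym (ℚProps.*-assoc (+ 1 / n) (fromℕ n) z))
    (trans (cong (ℚ._* z) (fromℕ-inverse n)) (ℚProps.*-identityˡ z))

*-denominator : ∀ r → r ℚ.* fromℕ (↧ₙ r) ≡ fromℤ (↥ r)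
*-denominator r = ℚProps.toℚᵘ-injective (begin
  ℚ.toℚᵘ (r ℚ.* fromℕ (↧ₙ r))              ≈⟨ ℚProps.toℚᵘ-homo-* r (fromℕ (↧ₙ r)) ⟩
  ℚ.toℚᵘ r ℚᵘ.* ℚ.toℚᵘ (fromℕ (↧ₙ r))
    ≈⟨ ℚᵘProps.*-cong (ℚᵘProps.≃-refl {ℚ.toℚᵘ r}) (ℚProps.toℚᵘ-fromℚᵘ (ℚᵘ.mkℚᵘ (↧ r) 0)) ⟩
  ℚ.toℚᵘ r ℚᵘ.* ℚᵘ.mkℚᵘ (↧ r) 0            ≈⟨ step r ⟩
  ℚᵘ.mkℚᵘ (↥ r) 0                          ≈⟨ ℚᵘProps.≃-sym (ℚProps.toℚᵘ-fromℚᵘ (ℚᵘ.mkℚᵘ (↥ r) 0)) ⟩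
  ℚ.toℚᵘ (fromℤ (↥ r)) ∎)
  where
  open ℚᵘProps.≃-Reasoning
  step : ∀ r → ℚ.toℚᵘ r ℚᵘ.* ℚᵘ.mkℚᵘ (↧ r) 0 ℚᵘ.≃ ℚᵘ.mkℚᵘ (↥ r) 0
  step (ℚ.mkℚ n d-1 _) = ℚᵘ.*≡* (trans (ℤProps.*-identityʳ _)
    (cong (λ d → n ℤ.* + d) (sym (ℕProps.*-identityʳ (suc d-1)))))

module Padic (p : ℕ) (p-prime : Prime p) where

  private
    instance
      p≢0 : ℕ.NonZero p
      p≢0 = prime⇒nonZero p-prime

  -- |r|ₚ ≤ p⁻ᵏ: r is pᵏ times a fraction whose denominator is prime to p.
  record ∣_∣≤p^-_ (r : ℚ) (k : ℕ) : Set where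
    constructor fraction
    field
      num    : ℤ
      den    : ℕ
      p∤den  : ¬ (p ∣ den)
      r≡     : r ℚ.* fromℕ den ≡ fromℤ num ℚ.* fromℕ (p ℕ.^ k)

  p∤* : ∀ {m n} → ¬ (p ∣ m) → ¬ (p ∣ n) → ¬ (p ∣ m ℕ.* n)
  p∤* {m} {n} p∤m p∤n p∣mn with euclidsLemma m n p-prime p∣mn
  ... | inj₁ p∣m = p∤m p∣m
  ... | inj₂ p∣n = p∤n p∣n

  p∤1 : ¬ (p ∣ 1)
  p∤1 p∣1 with refl ← ℕ∣.∣1⇒≡1 p∣1 = ℕ.nonTrivial⇒≢1 {{prime⇒nonTrivial p-prime}} refl

  open +-*-Solver
  open ≡-Reasoning

  -- |r|ₚ ≤ pᵇ
  Bound : ℕ → ℚ → Set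
  Bound b r = ∣ fromℕ (p ℕ.^ b) ℚ.* r ∣≤p^- 0

  PPart : ℕ → Set
  PPart n = ∃[ b ] ∃[ w ] n ≡ p ℕ.^ b ℕ.* w × ¬ (p ∣ w)

  abstract
    zero-≤ : ∀ k → ∣ 0ℚ ∣≤p^- k
    zero-≤ k = fraction (+ 0) 1 p∤1
      (trans (ℚProps.*-zeroˡ (fromℕ 1)) (sym (ℚProps.*-zeroˡ (fromℕ (p ℕ.^ k)))))

    +-≤ : ∀ {r s k} → ∣ r ∣≤p^- k → ∣ s ∣≤p^- k → ∣ r ℚ.+ s ∣≤p^- k
    +-≤ {r} {s} {k} (fraction u d p∤d r≡) (fraction v e p∤e s≡) =
      fraction (u ℤ.* + e ℤ.+ v ℤ.* + d) (d ℕ.* e) (p∤* p∤d p∤e) (begin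
        (r ℚ.+ s) ℚ.* fromℕ (d ℕ.* e)
          ≡⟨ cong ((r ℚ.+ s) ℚ.*_) (sym (fromℕ-* d e)) ⟩
        (r ℚ.+ s) ℚ.* (fromℕ d ℚ.* fromℕ e)
          ≡⟨ solve 4 (λ r s d e → (r :+ s) :* (d :* e) := (r :* d) :* e :+ (s :* e) :* d)
               refl r s (fromℕ d) (fromℕ e) ⟩
        (r ℚ.* fromℕ d) ℚ.* fromℕ e ℚ.+ (s ℚ.* fromℕ e) ℚ.* fromℕ d
          ≡⟨ cong₂ (λ x y → x ℚ.* fromℕ e ℚ.+ y ℚ.* fromℕ d) r≡ s≡ ⟩
        (fromℤ u ℚ.* P) ℚ.* fromℕ e ℚ.+ (fromℤ v ℚ.* P) ℚ.* fromℕ d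
          ≡⟨ solve 5 (λ u v d e P → (u :* P) :* e :+ (v :* P) :* d := (u :* e :+ v :* d) :* P)
               refl (fromℤ u) (fromℤ v) (fromℕ d) (fromℕ e) P ⟩
        (fromℤ u ℚ.* fromℕ e ℚ.+ fromℤ v ℚ.* fromℕ d) ℚ.* P
          ≡⟨ cong (ℚ._* P) (cong₂ ℚ._+_ (fromℤ-* u (+ e)) (fromℤ-* v (+ d))) ⟩
        (fromℤ (u ℤ.* + e) ℚ.+ fromℤ (v ℤ.* + d)) ℚ.* P
          ≡⟨ cong (ℚ._* P) (fromℤ-+ (u ℤ.* + e) (v ℤ.* + d)) ⟩
        fromℤ (u ℤ.* + e ℤ.+ v ℤ.* + d) ℚ.* P ∎)
      where P : ℚ
            P = fromℕ (p ℕ.^ k)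

    neg-≤ : ∀ {r k} → ∣ r ∣≤p^- k → ∣ ℚ.- r ∣≤p^- k
    neg-≤ {r} {k} (fraction u d p∤d r≡) = fraction (ℤ.- u) d p∤d (begin
      ℚ.- r ℚ.* fromℕ d           ≡⟨ sym (ℚProps.neg-distribˡ-* r (fromℕ d)) ⟩
      ℚ.- (r ℚ.* fromℕ d)         ≡⟨ cong ℚ.-_ r≡ ⟩
      ℚ.- (fromℤ u ℚ.* P)         ≡⟨ ℚProps.neg-distribˡ-* (fromℤ u) P ⟩
      ℚ.- fromℤ u ℚ.* P           ≡⟨ cong (ℚ._* P) (fromℤ-neg u) ⟩
      fromℤ (ℤ.- u) ℚ.* P         ∎)
      where P : ℚ
            P = fromℕ (p ℕ.^ k)

    *-≤ : ∀ {r s k l} → ∣ r ∣≤p^- k → ∣ s ∣≤p^- l → ∣ r ℚ.* s ∣≤p^- (k ℕ.+ l)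
    *-≤ {r} {s} {k} {l} (fraction u d p∤d r≡) (fraction v e p∤e s≡) =
      fraction (u ℤ.* v) (d ℕ.* e) (p∤* p∤d p∤e) (begin
        (r ℚ.* s) ℚ.* fromℕ (d ℕ.* e)
          ≡⟨ cong ((r ℚ.* s) ℚ.*_) (sym (fromℕ-* d e)) ⟩
        (r ℚ.* s) ℚ.* (fromℕ d ℚ.* fromℕ e)
          ≡⟨ solve 4 (λ r s d e → (r :* s) :* (d :* e) := (r :* d) :* (s :* e))
               refl r s (fromℕ d) (fromℕ e) ⟩
        (r ℚ.* fromℕ d) ℚ.* (s ℚ.* fromℕ e)
          ≡⟨ cong₂ ℚ._*_ r≡ s≡ ⟩
        (fromℤ u ℚ.* P) ℚ.* (fromℤ v ℚ.* Q)
          ≡⟨ solve 4 (λ u v P Q → (u :* P) :* (v :* Q) := (u :* v) :* (P :* Q))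
               refl (fromℤ u) (fromℤ v) P Q ⟩
        (fromℤ u ℚ.* fromℤ v) ℚ.* (P ℚ.* Q)
          ≡⟨ cong₂ ℚ._*_ (fromℤ-* u v) (fromℕ-* (p ℕ.^ k) (p ℕ.^ l)) ⟩
        fromℤ (u ℤ.* v) ℚ.* fromℕ (p ℕ.^ k ℕ.* p ℕ.^ l)
          ≡⟨ cong (λ n → fromℤ (u ℤ.* v) ℚ.* fromℕ n) (sym (ℕProps.^-distribˡ-+-* p k l)) ⟩
        fromℤ (u ℤ.* v) ℚ.* fromℕ (p ℕ.^ (k ℕ.+ l)) ∎)
      where P : ℚ
            P = fromℕ (p ℕ.^ k)
            Q : ℚ
            Q = fromℕ (p ℕ.^ l)

    shift-≤ : ∀ b k {r} → ∣ fromℕ (p ℕ.^ b) ℚ.* r ∣≤p^- (b ℕ.+ k) → ∣ r ∣≤p^- k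
    shift-≤ b k {r} (fraction u d p∤d eq) = fraction u d p∤d
      (fromℕ-cancel (p ℕ.^ b) {{ℕProps.m^n≢0 p b}} (begin
        P ℚ.* (r ℚ.* fromℕ d)                   ≡⟨ ℚProps.*-assoc P r (fromℕ d) ⟨
        (P ℚ.* r) ℚ.* fromℕ d                   ≡⟨ eq ⟩
        fromℤ u ℚ.* fromℕ (p ℕ.^ (b ℕ.+ k))
          ≡⟨ cong (λ n → fromℤ u ℚ.* fromℕ n) (ℕProps.^-distribˡ-+-* p b k) ⟩
        fromℤ u ℚ.* fromℕ (p ℕ.^ b ℕ.* p ℕ.^ k)
          ≡⟨ cong (fromℤ u ℚ.*_) (sym (fromℕ-* (p ℕ.^ b) (p ℕ.^ k))) ⟩
        fromℤ u ℚ.* (P ℚ.* Q)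
          ≡⟨ solve 3 (λ u P Q → u :* (P :* Q) := P :* (u :* Q)) refl (fromℤ u) P Q ⟩
        P ℚ.* (fromℤ u ℚ.* Q) ∎))
      where P : ℚ
            P = fromℕ (p ℕ.^ b)
            Q : ℚ
            Q = fromℕ (p ℕ.^ k)

    *-Bound : ∀ b {r s k} → Bound b r → ∣ s ∣≤p^- (b ℕ.+ k) → ∣ r ℚ.* s ∣≤p^- k
    *-Bound b {r} {s} {k} Br s≤ = shift-≤ b k
      (subst (∣_∣≤p^- (b ℕ.+ k)) (ℚProps.*-assoc (fromℕ (p ℕ.^ b)) r s) (*-≤ Br s≤))

    p-part : ∀ n → ℕ.NonZero n → PPart n
    p-part = <-rec (λ n → ℕ.NonZero n → PPart n) λ n rec n≢0 → split n rec n≢0 (p ∣? n)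
      where
      split : ∀ n → (∀ {m} → m ℕ.< n → ℕ.NonZero m → PPart m) → ℕ.NonZero n →
              Dec (p ∣ n) → PPart n
      split n rec n≢0 (no p∤n) = 0 , n , sym (ℕProps.*-identityˡ n) , p∤n
      split _ rec n≢0 (yes (ℕ∣.divides m refl)) =
        let m≢0 = ℕProps.m*n≢0⇒m≢0 m {{n≢0}}
            b , w , m≡ , p∤w = rec (ℕProps.m<m*n m p {{m≢0}}
              (ℕ.nonTrivial⇒n>1 p {{prime⇒nonTrivial p-prime}})) m≢0
        in suc b , w , trans (ℕProps.*-comm m p)
             (trans (cong (p ℕ.*_) m≡) (sym (ℕProps.*-assoc p (p ℕ.^ b) w))) , p∤w

    bound : ∀ r → ∃[ b ] Bound b r
    bound r with p-part (↧ₙ r) (ℕ.nonZero)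
    ... | b , w , eq , p∤w = b , fraction (↥ r) w p∤w (begin
      (P ℚ.* r) ℚ.* fromℕ w
        ≡⟨ solve 3 (λ P r w → (P :* r) :* w := r :* (P :* w)) refl P r (fromℕ w) ⟩
      r ℚ.* (P ℚ.* fromℕ w)               ≡⟨ cong (r ℚ.*_) (fromℕ-* (p ℕ.^ b) w) ⟩
      r ℚ.* fromℕ (p ℕ.^ b ℕ.* w)         ≡⟨ cong (λ n → r ℚ.* fromℕ n) eq ⟨
      r ℚ.* fromℕ (↧ₙ r)                  ≡⟨ *-denominator r ⟩
      fromℤ (↥ r)                         ≡⟨ ℚProps.*-identityʳ (fromℤ (↥ r)) ⟨
      fromℤ (↥ r) ℚ.* fromℕ (p ℕ.^ 0)     ∎)
      where P : ℚ
            P = fromℕ (p ℕ.^ b)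

    fromℕ-≤ : ∀ n → ∣ fromℕ n ∣≤p^- 0
    fromℕ-≤ n = fraction (+ n) 1 p∤1 refl

  Cauchy : (ℕ → ℚ) → Set
  Cauchy s = ∀ k → ∃[ N ] ∀ m n → N ℕ.≤ m → N ℕ.≤ n → ∣ s m ℚ.- s n ∣≤p^- k

  abstract
    const-cauchy : ∀ r → Cauchy (λ _ → r)
    const-cauchy r k = 0 , λ _ _ _ _ →
      subst (∣_∣≤p^- k) (sym (ℚProps.+-inverseʳ r)) (zero-≤ k)

    +-cauchy : ∀ s t → Cauchy s → Cauchy t → Cauchy (λ n → s n ℚ.+ t n)
    +-cauchy s t s-cauchy t-cauchy k =
      let M , cs = s-cauchy k
          N , ct = t-cauchy k
      in M ℕ.⊔ N , λ m n m≥ n≥ →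
        subst (∣_∣≤p^- k)
          (solve 4 (λ a b c d → (a :- b) :+ (c :- d) := (a :+ c) :- (b :+ d)) refl
            (s m) (s n) (t m) (t n))
          (+-≤ (cs m n (ℕProps.m⊔n≤o⇒m≤o M N m≥) (ℕProps.m⊔n≤o⇒m≤o M N n≥))
               (ct m n (ℕProps.m⊔n≤o⇒n≤o M N m≥) (ℕProps.m⊔n≤o⇒n≤o M N n≥)))

    neg-cauchy : ∀ s → Cauchy s → Cauchy (λ n → ℚ.- s n)
    neg-cauchy s s-cauchy k =
      let N , cs = s-cauchy k
      in N , λ m n m≥ n≥ →
        subst (∣_∣≤p^- k)
          (solve 2 (λ a b → :- (a :- b) := (:- a) :- (:- b)) refl (s m) (s n))
          (neg-≤ (cs m n m≥ n≥))

    eventual-bound : ∀ s → Cauchy s → ∃[ b ] ∃[ N ] ∀ n → N ℕ.≤ n → Bound b (s n)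
    eventual-bound s s-cauchy =
      let N , cs = s-cauchy 0
          b , Bb = bound (s N)
      in b , N , λ n n≥ →
        subst (∣_∣≤p^- 0)
          (solve 3 (λ P u v → P :* u :+ P :* (v :- u) := P :* v) refl
            (fromℕ (p ℕ.^ b)) (s N) (s n))
          (+-≤ Bb (*-≤ (fromℕ-≤ (p ℕ.^ b)) (cs n N n≥ ℕProps.≤-refl)))

    *-cauchy : ∀ s t → Cauchy s → Cauchy t → Cauchy (λ n → s n ℚ.* t n)
    *-cauchy s t s-cauchy t-cauchy k =
      let b , K , Bs = eventual-bound s s-cauchy
          c , L , Bt = eventual-bound t t-cauchy
          M , cs = s-cauchy (c ℕ.+ k)
          N , ct = t-cauchy (b ℕ.+ k)
          R   = (K ℕ.⊔ L) ℕ.⊔ (M ℕ.⊔ N)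
          ≥KL = λ {n} (R≤n : R ℕ.≤ n) → ℕProps.m⊔n≤o⇒m≤o (K ℕ.⊔ L) (M ℕ.⊔ N) R≤n
          ≥MN = λ {n} (R≤n : R ℕ.≤ n) → ℕProps.m⊔n≤o⇒n≤o (K ℕ.⊔ L) (M ℕ.⊔ N) R≤n
      in R , λ m n m≥ n≥ →
        subst (∣_∣≤p^- k)
          (solve 4 (λ a b c d → a :* (c :- d) :+ d :* (a :- b) := a :* c :- b :* d) refl
            (s m) (s n) (t m) (t n))
          (+-≤ (*-Bound b (Bs m (ℕProps.m⊔n≤o⇒m≤o K L (≥KL m≥)))
                 (ct m n (ℕProps.m⊔n≤o⇒n≤o M N (≥MN m≥)) (ℕProps.m⊔n≤o⇒n≤o M N (≥MN n≥))))
               (*-Bound c (Bt n (ℕProps.m⊔n≤o⇒n≤o K L (≥KL n≥)))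
                 (cs m n (ℕProps.m⊔n≤o⇒m≤o M N (≥MN m≥)) (ℕProps.m⊔n≤o⇒m≤o M N (≥MN n≥)))))

  -- The completion of ℚ; equality of its elements is _≈_.
  record ℚₚ : Set where
    constructor mkℚₚ
    field
      seq    : ℕ → ℚ
      cauchy : Cauchy seq
  open ℚₚ public

  infix 4 _≈_ _≈_÷_
  infixl 6 _+_ _-_
  infixl 7 _*_
  infix  8 -_
  infixr 9 _^_

  -- |x|ₚ ≤ p⁻ᵏ; balls are open and closed, so the late terms of x decide this.
  ∥_∥≤p^-_ : ℚₚ → ℕ → Set
  ∥ x ∥≤p^- k = ∃[ N ] ∀ n → N ℕ.≤ n → ∣ seq x n ∣≤p^- k

  ι : ℚ → ℚₚ
  ι r = mkℚₚ (λ _ → r) (const-cauchy r)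

  _+_ : ℚₚ → ℚₚ → ℚₚ
  x + y = mkℚₚ (λ n → seq x n ℚ.+ seq y n) (+-cauchy (seq x) (seq y) (cauchy x) (cauchy y))

  -_ : ℚₚ → ℚₚ
  - x = mkℚₚ (λ n → ℚ.- seq x n) (neg-cauchy (seq x) (cauchy x))

  _-_ : ℚₚ → ℚₚ → ℚₚ
  x - y = x + - y

  _*_ : ℚₚ → ℚₚ → ℚₚ
  x * y = mkℚₚ (λ n → seq x n ℚ.* seq y n) (*-cauchy (seq x) (seq y) (cauchy x) (cauchy y))

  _^_ : ℚₚ → ℕ → ℚₚ
  x ^ zero  = ι 1ℚ
  x ^ suc n = x * x ^ n

  _≈_ : ℚₚ → ℚₚ → Set
  x ≈ y = ∀ k → ∥ x - y ∥≤p^- k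

  -- z = x / y; in particular y is invertible.
  _≈_÷_ : ℚₚ → ℚₚ → ℚₚ → Set
  z ≈ x ÷ y = ∃[ y⁻¹ ] y * y⁻¹ ≈ ι 1ℚ × z ≈ x * y⁻¹

  record ℤₚ : Set where
    constructor mkℤₚ
    field
      val      : ℚₚ
      integral : ∥ val ∥≤p^- 0
  open ℤₚ public

  ℕ→ℤₚ : ℕ → ℤₚ
  ℕ→ℤₚ n = mkℤₚ (ι (fromℕ n)) (0 , λ _ _ → fromℕ-≤ n)

  infix 4 _⟶_

  _⟶_ : (ℕ → ℚₚ) → ℚₚ → Set
  s ⟶ l = ∀ k → ∃[ N ] ∀ n → N ℕ.≤ n → ∥ s n - l ∥≤p^- k

  -- Σ_{0 ≤ i < n} s i
  sum : (ℕ → ℚₚ) → ℕ → ℚₚ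
  sum s zero    = ι 0ℚ
  sum s (suc n) = sum s n + s n

  HasSum : (ℕ → ℚₚ) → ℚₚ → Set
  HasSum s l = sum s ⟶ l

  Summable : (ℕ → ℚₚ) → Set
  Summable s = ∃[ l ] HasSum s l

  sinTerms : ℚₚ → ℕ → ℚₚ
  sinTerms x n = ι (fromℤ (-1ℤ ℤ.^ n) ℚ.* 1/ (1 ℕ.+ 2 ℕ.* n) !) * x ^ (1 ℕ.+ 2 ℕ.* n)

  cosTerms : ℚₚ → ℕ → ℚₚ
  cosTerms x n = ι (fromℤ (-1ℤ ℤ.^ n) ℚ.* 1/ (2 ℕ.* n) !) * x ^ (2 ℕ.* n)

  -- sin, cos and tan are partial functions, so they are given by their graphs.
  IsSin : ℚₚ → ℚₚ → Set
  IsSin x s = HasSum (sinTerms x) s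

  IsCos : ℚₚ → ℚₚ → Set
  IsCos x c = HasSum (cosTerms x) c

  IsTan : ℚₚ → ℚₚ → Set
  IsTan x t = ∃[ s ] ∃[ c ] IsSin x s × IsCos x c × t ≈ s ÷ c

  -- b = [n]_q
  IsBracket : ℚₚ → ℕ → ℚₚ → Set
  IsBracket q n b = b ≈ (ι 1ℚ - q ^ n) ÷ (ι 1ℚ - q)

  -- Σ_{0 ≤ x < p^N} f(x) q^x
  weightedSum : ℚₚ → (ℤₚ → ℚₚ) → ℕ → ℚₚ
  weightedSum q f N = sum (λ x → f (ℕ→ℤₚ x) * q ^ x) (p ℕ.^ N)

  -- ∫ f dμ_q = l
  IsIntegral : ℚₚ → (ℤₚ → ℚₚ) → ℚₚ → Set
  IsIntegral q f l = Σ[ b ∈ (ℕ → ℚₚ) ] Σ[ s ∈ (ℕ → ℚₚ) ]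
    (∀ N → IsBracket q (p ℕ.^ N) (b N)) ×
    (∀ N → s N ≈ weightedSum q f N ÷ b N) ×
    s ⟶ l

  -- lim_{q → -1} ∫ f dμ_q = l, with q ∈ ℚₚ; the integrals near -1 are part of the claim.
  IsLimitOfIntegrals : (ℤₚ → ℚₚ) → ℚₚ → Set
  IsLimitOfIntegrals f l = ∀ k → ∃[ j ] ∀ q →
    ∥ q - ι (ℚ.- 1ℚ) ∥≤p^- j → ¬ (q ≈ ι (ℚ.- 1ℚ)) →
    ∃[ i ] IsIntegral q f i × ∥ i - l ∥≤p^- k

  -- The fermionic integral: the limit as q → -1 and the value at q = -1,
  -- where [p^N]_q = 1 as p is odd.
  IsFermionicIntegral : (ℤₚ → ℚₚ) → ℚₚ → Set
  IsFermionicIntegral f l = IsLimitOfIntegrals f l × weightedSum (ι (ℚ.- 1ℚ)) f ⟶ l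

  eulerTerms : ℚₚ → ℕ → ℚₚ
  eulerTerms a n =
    ι (fromℤ (-1ℤ ℤ.^ (n ℕ.+ 1)) ℚ.* 1/ (1 ℕ.+ 2 ℕ.* n) ! ℚ.* E (1 ℕ.+ 2 ℕ.* n))
      * a ^ (1 ℕ.+ 2 ℕ.* n)

module Submission where

-- Summability forces |a| ≤ p⁻¹, and then all series converge because |1/n!| ≤ p^⌊n/2⌋.
-- With S = sin a and C = cos a, the recurrence sin a(x+1) + sin a(x−1) = 2 C sin ax gives, for M = p^N,
--   (1 − 2qC + q²) Σ_{x<M} q^x sin ax = qS − q^M sin aM + q^{M+1} sin a(M−1).
-- As aM → 0, dividing by [M]_q and letting N → ∞ gives
--   ∫ sin ax dμ_q = q (1 − q) S / (1 − 2qC + q²),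
-- whose value at q = −1 is −S / (1 + C) = −tan (a/2); if t (1 + C) = S, then this integral plus t is
-- t (1 + q) (1 − qC) / (1 − 2qC + q²), which tends to 0 with 1 + q. Finally, the generating function
-- (e^u + 1) Σ Eₙ uⁿ/n! = 2 at u = ia, split into its real and imaginary parts and combined with
-- S² + C² = 1, shows that the Euler series t satisfies t (1 + C) = S.

open import Defs
open import Data.Nat as ℕ using (ℕ; zero; suc; _!; ⌊_/2⌋; ⌈_/2⌉; s≤s; z≤n)
import Data.Nat.Properties as ℕProps
import Data.Nat.DivMod as DivMod
open import Data.Nat.Divisibility as ℕ∣ using (_∣_)
open import Data.Nat.Induction using (<-rec)
open import Data.Nat.Combinatorics using (k![n∸k]!∣n!)
open import Data.Nat.Primality
  using (Prime; euclidsLemma; prime⇒nonZero; prime⇒nonTrivial; prime⇒irreducible)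
open import Data.Nat.Solver using () renaming (module +-*-Solver to ℕSolver)
open import Data.Integer as ℤ using (ℤ; +_; -1ℤ)
import Data.Integer.Properties as ℤProps
import Data.Integer.Divisibility.Signed as ℤ∣
open import Data.Rational as ℚ using (ℚ; 0ℚ; 1ℚ; ½)
import Data.Rational.Properties as ℚProps
import Data.Rational.Unnormalised as ℚᵘ
import Data.Rational.Unnormalised.Properties as ℚᵘProps
open import Data.Rational.Solver using (module +-*-Solver)
open import Data.Product using (Σ-syntax; ∃-syntax; _×_; _,_; proj₁; proj₂)
open import Data.Sum as Sum using (_⊎_; inj₁; inj₂)
open import Data.Empty using (⊥-elim)
open import Relation.Nullary using (¬_)
open import Function using (_∘_; id)
open import Relation.Binary.PropositionalEquality
  using (_≡_; _≢_; refl; sym; trans; cong; cong₂; subst; module ≡-Reasoning)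

open +-*-Solver
open ≡-Reasoning

-- Finite sums and Cauchy products

-- An element of `ℚₚ` is a Cauchy sequence of rationals, so an equation `x ≈ y` says that a rational
-- sequence is null. Such equations are proved by certificates: the error of the goal is written,
-- index by index, as a combination of errors already known to be null, with p-adic multipliers. The
-- combination is a polynomial identity over ℚ, and an inverse y⁻¹ enters it as a further variable
-- together with the error y y⁻¹ - 1. A power series is evaluated diagonally: term n is the n-th
-- partial sum at the n-th approximation of the argument. Functional equations then split into
-- identities between rational coefficients and tails of Cauchy products. Since -1 need not be a
-- square in `ℚₚ`, e^(ia) is never formed; i is present only through the real and imaginary parts of
-- its powers, `cosᶜ` and `sinᶜ`. That p is odd enters through the factorial estimate (3 ≤ p), the
-- denominators of the Euler numbers (powers of 2), the units 2 and 4 near which the denominators of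
-- the integrals lie, and the oddness of p^N.

infixr 9 _^^_

_^^_ : ℚ → ℕ → ℚ
x ^^ zero  = 1ℚ
x ^^ suc n = x ℚ.* x ^^ n

∑ : ℕ → PowerSeries → ℚ
∑ zero    f = 0ℚ
∑ (suc n) f = f 0 ℚ.+ ∑ n (f ∘ suc)

∑-cong : ∀ n {f g} → (∀ i → f i ≡ g i) → ∑ n f ≡ ∑ n g
∑-cong zero    f≡g = refl
∑-cong (suc n) f≡g = cong₂ ℚ._+_ (f≡g 0) (∑-cong n (f≡g ∘ suc))

∑-0 : ∀ n → ∑ n (λ _ → 0ℚ) ≡ 0ℚ
∑-0 zero    = refl
∑-0 (suc n) = trans (ℚProps.+-identityˡ _) (∑-0 n)

∑-last : ∀ n f → ∑ (suc n) f ≡ ∑ n f ℚ.+ f n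
∑-last zero    f = ℚProps.+-comm (f 0) 0ℚ
∑-last (suc n) f = trans (cong (f 0 ℚ.+_) (∑-last n (f ∘ suc)))
                         (sym (ℚProps.+-assoc (f 0) (∑ n (f ∘ suc)) (f (suc n))))

∑-split : ∀ m n f → ∑ (m ℕ.+ n) f ≡ ∑ m f ℚ.+ ∑ n (λ i → f (m ℕ.+ i))
∑-split zero    n f = sym (ℚProps.+-identityˡ _)
∑-split (suc m) n f = trans (cong (f 0 ℚ.+_) (∑-split m n (f ∘ suc)))
                            (sym (ℚProps.+-assoc (f 0) (∑ m (f ∘ suc)) _))

∑-+ : ∀ n f g → ∑ n f ℚ.+ ∑ n g ≡ ∑ n (f ⊕ g)
∑-+ zero    f g = refl
∑-+ (suc n) f g =
  trans (solve 4 (λ f F g G → (f :+ F) :+ (g :+ G) := (f :+ g) :+ (F :+ G))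
           refl (f 0) (∑ n (f ∘ suc)) (g 0) (∑ n (g ∘ suc)))
        (cong ((f ⊕ g) 0 ℚ.+_) (∑-+ n (f ∘ suc) (g ∘ suc)))

∑-- : ∀ n f g → ∑ n f ℚ.- ∑ n g ≡ ∑ n (λ i → f i ℚ.- g i)
∑-- zero    f g = refl
∑-- (suc n) f g =
  trans (solve 4 (λ f F g G → (f :+ F) :- (g :+ G) := (f :- g) :+ (F :- G))
           refl (f 0) (∑ n (f ∘ suc)) (g 0) (∑ n (g ∘ suc)))
        (cong (f 0 ℚ.- g 0 ℚ.+_) (∑-- n (f ∘ suc) (g ∘ suc)))

∑-*ˡ : ∀ n x f → x ℚ.* ∑ n f ≡ ∑ n (λ i → x ℚ.* f i)
∑-*ˡ zero    x f = ℚProps.*-zeroʳ x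
∑-*ˡ (suc n) x f = trans (ℚProps.*-distribˡ-+ x (f 0) (∑ n (f ∘ suc)))
                         (cong (x ℚ.* f 0 ℚ.+_) (∑-*ˡ n x (f ∘ suc)))

⊛-cong : ∀ n {f f′ g g′} → (∀ i → f i ≡ f′ i) → (∀ i → g i ≡ g′ i) → (f ⊛ g) n ≡ (f′ ⊛ g′) n
⊛-cong zero    f≡ g≡ = cong₂ (λ x y → x ℚ.* y ℚ.+ 0ℚ) (f≡ 0) (g≡ 0)
⊛-cong (suc n) f≡ g≡ = cong₂ ℚ._+_ (cong₂ ℚ._*_ (f≡ 0) (g≡ (suc n))) (⊛-cong n (f≡ ∘ suc) g≡)

⊛-⊕ : ∀ n f g h → ((f ⊕ g) ⊛ h) n ≡ (f ⊛ h) n ℚ.+ (g ⊛ h) n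
⊛-⊕ zero    f g h = solve 3 (λ f g h → (f :+ g) :* h :+ con 0ℚ :=
                      (f :* h :+ con 0ℚ) :+ (g :* h :+ con 0ℚ)) refl (f 0) (g 0) (h 0)
⊛-⊕ (suc n) f g h = trans
  (cong ((f 0 ℚ.+ g 0) ℚ.* h (suc n) ℚ.+_) (⊛-⊕ n (f ∘ suc) (g ∘ suc) h))
  (solve 5 (λ f g h F G → (f :+ g) :* h :+ (F :+ G) := (f :* h :+ F) :+ (g :* h :+ G))
     refl (f 0) (g 0) (h (suc n)) (((f ∘ suc) ⊛ h) n) (((g ∘ suc) ⊛ h) n))

⊛-*ˡ : ∀ n x f g → x ℚ.* (f ⊛ g) n ≡ ((λ i → x ℚ.* f i) ⊛ g) n
⊛-*ˡ zero    x f g = solve 3 (λ x f g → x :* (f :* g :+ con 0ℚ) := (x :* f) :* g :+ con 0ℚ)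
                       refl x (f 0) (g 0)
⊛-*ˡ (suc n) x f g = trans
  (solve 4 (λ x f g F → x :* (f :* g :+ F) := (x :* f) :* g :+ x :* F)
     refl x (f 0) (g (suc n)) (((f ∘ suc) ⊛ g) n))
  (cong (x ℚ.* f 0 ℚ.* g (suc n) ℚ.+_) (⊛-*ˡ n x (f ∘ suc) g))

⊛-*ʳ : ∀ n x f g → x ℚ.* (f ⊛ g) n ≡ (f ⊛ (λ i → x ℚ.* g i)) n
⊛-*ʳ zero    x f g = solve 3 (λ x f g → x :* (f :* g :+ con 0ℚ) := f :* (x :* g) :+ con 0ℚ)
                       refl x (f 0) (g 0)
⊛-*ʳ (suc n) x f g = trans
  (solve 4 (λ x f g F → x :* (f :* g :+ F) := f :* (x :* g) :+ x :* F)
     refl x (f 0) (g (suc n)) (((f ∘ suc) ⊛ g) n))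
  (cong (f 0 ℚ.* (x ℚ.* g (suc n)) ℚ.+_) (⊛-*ʳ n x (f ∘ suc) g))

-- Substituting xt for t is multiplicative on power series.
⊛-^ : ∀ n x f g → x ^^ n ℚ.* (f ⊛ g) n ≡ ((λ i → f i ℚ.* x ^^ i) ⊛ (λ i → g i ℚ.* x ^^ i)) n
⊛-^ zero    x f g = solve 2 (λ f g → con 1ℚ :* (f :* g :+ con 0ℚ) :=
                      (f :* con 1ℚ) :* (g :* con 1ℚ) :+ con 0ℚ) refl (f 0) (g 0)
⊛-^ (suc n) x f g = begin
  x ℚ.* x ^^ n ℚ.* (f 0 ℚ.* g (suc n) ℚ.+ ((f ∘ suc) ⊛ g) n)
    ≡⟨ solve 5 (λ x y f g F → x :* y :* (f :* g :+ F) := (f :* con 1ℚ) :* (g :* (x :* y)) :+ x :* (y :* F))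
         refl x (x ^^ n) (f 0) (g (suc n)) (((f ∘ suc) ⊛ g) n) ⟩
  f 0 ℚ.* 1ℚ ℚ.* (g (suc n) ℚ.* (x ℚ.* x ^^ n)) ℚ.+ x ℚ.* (x ^^ n ℚ.* ((f ∘ suc) ⊛ g) n)
    ≡⟨ cong (λ u → f 0 ℚ.* 1ℚ ℚ.* (g (suc n) ℚ.* (x ℚ.* x ^^ n)) ℚ.+ x ℚ.* u) (⊛-^ n x (f ∘ suc) g) ⟩
  f 0 ℚ.* 1ℚ ℚ.* (g (suc n) ℚ.* (x ℚ.* x ^^ n)) ℚ.+
    x ℚ.* ((λ i → f (suc i) ℚ.* x ^^ i) ⊛ (λ i → g i ℚ.* x ^^ i)) n
    ≡⟨ cong (f 0 ℚ.* 1ℚ ℚ.* (g (suc n) ℚ.* (x ℚ.* x ^^ n)) ℚ.+_) (trans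
         (⊛-*ˡ n x (λ i → f (suc i) ℚ.* x ^^ i) (λ i → g i ℚ.* x ^^ i))
         (⊛-cong n (λ i → solve 3 (λ x f y → x :* (f :* y) := f :* (x :* y)) refl x (f (suc i)) (x ^^ i))
                   (λ i → refl))) ⟩
  ((λ i → f i ℚ.* x ^^ i) ⊛ (λ i → g i ℚ.* x ^^ i)) (suc n) ∎

-- The Euler operator t d/dt is a derivation; the offset m keeps the statement closed
-- under dropping the leading coefficient of f.
⊛-derivation : ∀ n m f g → fromℕ (m ℕ.+ n) ℚ.* (f ⊛ g) n ≡
  ((λ i → fromℕ (m ℕ.+ i) ℚ.* f i) ⊛ g) n ℚ.+ (f ⊛ (λ i → fromℕ i ℚ.* g i)) n
⊛-derivation zero m f g = solve 3 (λ k f g → k :* (f :* g :+ con 0ℚ) :=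
  ((k :* f) :* g :+ con 0ℚ) :+ (f :* (con 0ℚ :* g) :+ con 0ℚ)) refl (fromℕ (m ℕ.+ 0)) (f 0) (g 0)
⊛-derivation (suc n) m f g = begin
  K ℚ.* (f 0 ℚ.* g (suc n) ℚ.+ ((f ∘ suc) ⊛ g) n)
    ≡⟨ ℚProps.*-distribˡ-+ K (f 0 ℚ.* g (suc n)) (((f ∘ suc) ⊛ g) n) ⟩
  K ℚ.* (f 0 ℚ.* g (suc n)) ℚ.+ K ℚ.* ((f ∘ suc) ⊛ g) n
    ≡⟨ cong₂ ℚ._+_ (cong (ℚ._* (f 0 ℚ.* g (suc n))) K≡)
         (trans (cong (λ k → fromℕ k ℚ.* ((f ∘ suc) ⊛ g) n) (ℕProps.+-suc m n))
                (⊛-derivation n (suc m) (f ∘ suc) g)) ⟩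
  (fromℕ (m ℕ.+ 0) ℚ.+ fromℕ (suc n)) ℚ.* (f 0 ℚ.* g (suc n)) ℚ.+
    (((λ i → fromℕ (suc m ℕ.+ i) ℚ.* f (suc i)) ⊛ g) n ℚ.+ G)
    ≡⟨ cong (λ u → (fromℕ (m ℕ.+ 0) ℚ.+ fromℕ (suc n)) ℚ.* (f 0 ℚ.* g (suc n)) ℚ.+ (u ℚ.+ G))
         (⊛-cong n (λ i → cong (λ k → fromℕ k ℚ.* f (suc i)) (sym (ℕProps.+-suc m i))) (λ _ → refl)) ⟩
  (fromℕ (m ℕ.+ 0) ℚ.+ fromℕ (suc n)) ℚ.* (f 0 ℚ.* g (suc n)) ℚ.+ (F ℚ.+ G)
    ≡⟨ solve 6 (λ k l f g F G → (k :+ l) :* (f :* g) :+ (F :+ G) :=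
         ((k :* f) :* g :+ F) :+ (f :* (l :* g) :+ G))
         refl (fromℕ (m ℕ.+ 0)) (fromℕ (suc n)) (f 0) (g (suc n)) F G ⟩
  ((λ i → fromℕ (m ℕ.+ i) ℚ.* f i) ⊛ g) (suc n) ℚ.+ (f ⊛ (λ i → fromℕ i ℚ.* g i)) (suc n) ∎
  where
  K F G : ℚ
  K = fromℕ (m ℕ.+ suc n)
  F = ((λ i → fromℕ (m ℕ.+ suc i) ℚ.* f (suc i)) ⊛ g) n
  G = ((f ∘ suc) ⊛ (λ i → fromℕ i ℚ.* g i)) n
  K≡ : K ≡ fromℕ (m ℕ.+ 0) ℚ.+ fromℕ (suc n)
  K≡ = trans (cong (λ k → fromℕ (k ℕ.+ suc n)) (sym (ℕProps.+-identityʳ m)))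
             (sym (fromℤ-+ (+ (m ℕ.+ 0)) (+ suc n)))

-- Factorials, divided powers and the powers of i

factorial-inverse : ∀ n → 1/ n ! ℚ.* fromℕ (n !) ≡ 1ℚ
factorial-inverse n = fromℕ-inverse (n !) {{ℕProps._!≢0 n}}

suc-*-1/! : ∀ n → fromℕ (suc n) ℚ.* 1/ suc n ! ≡ 1/ n !
suc-*-1/! n = fromℕ-cancel (n !) {{ℕProps._!≢0 n}} (begin
  fromℕ (n !) ℚ.* (fromℕ (suc n) ℚ.* 1/ suc n !)
    ≡⟨ solve 3 (λ a b c → a :* (b :* c) := c :* (b :* a)) refl (fromℕ (n !)) (fromℕ (suc n)) (1/ suc n !) ⟩
  1/ suc n ! ℚ.* (fromℕ (suc n) ℚ.* fromℕ (n !))  ≡⟨ cong (1/ suc n ! ℚ.*_) (fromℕ-* (suc n) (n !)) ⟩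
  1/ suc n ! ℚ.* fromℕ (suc n !)                  ≡⟨ factorial-inverse (suc n) ⟩
  1ℚ                                              ≡⟨ factorial-inverse n ⟨
  1/ n ! ℚ.* fromℕ (n !)                          ≡⟨ ℚProps.*-comm (1/ n !) (fromℕ (n !)) ⟩
  fromℕ (n !) ℚ.* 1/ n ! ∎)

-- The divided powers of x, which are the coefficients of e^(xt).
dpow : ℚ → PowerSeries
dpow x n = 1/ n ! ℚ.* x ^^ n

suc-*-dpow : ∀ x n → fromℕ (suc n) ℚ.* dpow x (suc n) ≡ x ℚ.* dpow x n
suc-*-dpow x n = begin
  fromℕ (suc n) ℚ.* (1/ suc n ! ℚ.* (x ℚ.* x ^^ n))
    ≡⟨ solve 4 (λ k i x y → k :* (i :* (x :* y)) := x :* ((k :* i) :* y)) refl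
         (fromℕ (suc n)) (1/ suc n !) x (x ^^ n) ⟩
  x ℚ.* (fromℕ (suc n) ℚ.* 1/ suc n ! ℚ.* x ^^ n)
    ≡⟨ cong (λ u → x ℚ.* (u ℚ.* x ^^ n)) (suc-*-1/! n) ⟩
  x ℚ.* dpow x n ∎

-- This is e^(xt) e^(yt) = e^((x+y)t). By the derivation rule both sides satisfy (n + 1) u (n + 1) =
-- (x + y) u n, so no binomial expansion is required.
dpow-+ : ∀ x y n → (dpow x ⊛ dpow y) n ≡ dpow (x ℚ.+ y) n
dpow-+ x y zero    = refl
dpow-+ x y (suc n) = fromℕ-cancel (suc n) (begin
  fromℕ (suc n) ℚ.* (dpow x ⊛ dpow y) (suc n)
    ≡⟨ ⊛-derivation (suc n) 0 (dpow x) (dpow y) ⟩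
  ((λ i → fromℕ i ℚ.* dpow x i) ⊛ dpow y) (suc n) ℚ.+ (dpow x ⊛ (λ i → fromℕ i ℚ.* dpow y i)) (suc n)
    ≡⟨ cong₂ ℚ._+_ left (right n (dpow x)) ⟩
  x ℚ.* (dpow x ⊛ dpow y) n ℚ.+ y ℚ.* (dpow x ⊛ dpow y) n
    ≡⟨ ℚProps.*-distribʳ-+ ((dpow x ⊛ dpow y) n) x y ⟨
  (x ℚ.+ y) ℚ.* (dpow x ⊛ dpow y) n
    ≡⟨ cong ((x ℚ.+ y) ℚ.*_) (dpow-+ x y n) ⟩
  (x ℚ.+ y) ℚ.* dpow (x ℚ.+ y) n
    ≡⟨ suc-*-dpow (x ℚ.+ y) n ⟨
  fromℕ (suc n) ℚ.* dpow (x ℚ.+ y) (suc n) ∎)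
  where
  left : ((λ i → fromℕ i ℚ.* dpow x i) ⊛ dpow y) (suc n) ≡ x ℚ.* (dpow x ⊛ dpow y) n
  left = begin
    0ℚ ℚ.* dpow x 0 ℚ.* dpow y (suc n) ℚ.+ ((λ i → fromℕ (suc i) ℚ.* dpow x (suc i)) ⊛ dpow y) n
      ≡⟨ solve 3 (λ a b c → (con 0ℚ :* a) :* b :+ c := c) refl (dpow x 0) (dpow y (suc n)) _ ⟩
    ((λ i → fromℕ (suc i) ℚ.* dpow x (suc i)) ⊛ dpow y) n
      ≡⟨ ⊛-cong n (suc-*-dpow x) (λ _ → refl) ⟩
    ((λ i → x ℚ.* dpow x i) ⊛ dpow y) n  ≡⟨ ⊛-*ˡ n x (dpow x) (dpow y) ⟨
    x ℚ.* (dpow x ⊛ dpow y) n ∎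
  -- The vanishing term of index 0 of the right factor stands at the far end of the convolution, so
  -- an induction over shifts of an arbitrary `f` has to reach it.
  right : ∀ n f → (f ⊛ (λ i → fromℕ i ℚ.* dpow y i)) (suc n) ≡ y ℚ.* (f ⊛ dpow y) n
  right zero f = trans
    (cong (λ u → f 0 ℚ.* u ℚ.+ (f 1 ℚ.* (0ℚ ℚ.* dpow y 0) ℚ.+ 0ℚ)) (suc-*-dpow y 0))
    (solve 4 (λ f f′ d y → f :* (y :* d) :+ (f′ :* (con 0ℚ :* d) :+ con 0ℚ) := y :* (f :* d :+ con 0ℚ))
      refl (f 0) (f 1) (dpow y 0) y)
  right (suc n) f = trans
    (cong₂ (λ u v → f 0 ℚ.* u ℚ.+ v) (suc-*-dpow y (suc n)) (right n (f ∘ suc)))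
    (solve 4 (λ f y d F → f :* (y :* d) :+ y :* F := y :* (f :* d :+ F))
      refl (f 0) y (dpow y (suc n)) (((f ∘ suc) ⊛ dpow y) n))

-- sinᶜ n and cosᶜ n are n! times the coefficients of tⁿ in sin t and cos t.
mutual
  sinᶜ : PowerSeries
  sinᶜ zero    = 0ℚ
  sinᶜ (suc n) = cosᶜ n

  cosᶜ : PowerSeries
  cosᶜ zero    = 1ℚ
  cosᶜ (suc n) = ℚ.- sinᶜ n

-- `cosᶜ k` and `sinᶜ k` are the real and imaginary parts of iᵏ; the two formulas together say that
-- i^(k+n) = iᵏ iⁿ.
cosᶜ-+ : ∀ k n → cosᶜ (k ℕ.+ n) ≡ cosᶜ k ℚ.* cosᶜ n ℚ.- sinᶜ k ℚ.* sinᶜ n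
sinᶜ-+ : ∀ k n → sinᶜ (k ℕ.+ n) ≡ sinᶜ k ℚ.* cosᶜ n ℚ.+ cosᶜ k ℚ.* sinᶜ n
cosᶜ-+ zero    n = solve 2 (λ c s → c := con 1ℚ :* c :- con 0ℚ :* s) refl (cosᶜ n) (sinᶜ n)
cosᶜ-+ (suc k) n = trans (cong ℚ.-_ (sinᶜ-+ k n))
  (solve 4 (λ c s c′ s′ → :- (s :* c′ :+ c :* s′) := :- s :* c′ :- c :* s′)
    refl (cosᶜ k) (sinᶜ k) (cosᶜ n) (sinᶜ n))
sinᶜ-+ zero    n = solve 2 (λ c s → s := con 0ℚ :* c :+ con 1ℚ :* s) refl (cosᶜ n) (sinᶜ n)
sinᶜ-+ (suc k) n = trans (cosᶜ-+ k n)
  (solve 4 (λ c s c′ s′ → c :* c′ :- s :* s′ := c :* c′ :+ :- s :* s′)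
    refl (cosᶜ k) (sinᶜ k) (cosᶜ n) (sinᶜ n))

-- Real part of iᵏ f(it) g(it) = iᵏ (fg)(it), compared at tⁿ. The offset `k` absorbs the power of i
-- released when the leading coefficient of f is dropped. `sinᶜ-⊛` is the imaginary part.
cosᶜ-⊛ : ∀ n k f g →
  ((λ i → cosᶜ (k ℕ.+ i) ℚ.* f i) ⊛ (λ i → cosᶜ i ℚ.* g i)) n ℚ.-
  ((λ i → sinᶜ (k ℕ.+ i) ℚ.* f i) ⊛ (λ i → sinᶜ i ℚ.* g i)) n ≡
  cosᶜ (k ℕ.+ n) ℚ.* (f ⊛ g) n
cosᶜ-⊛ zero k f g = trans
  (solve 6 (λ c s c′ s′ f g →
      ((c :* f) :* (c′ :* g) :+ con 0ℚ) :- ((s :* f) :* (s′ :* g) :+ con 0ℚ) :=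
      (c :* c′ :- s :* s′) :* (f :* g :+ con 0ℚ))
    refl (cosᶜ (k ℕ.+ 0)) (sinᶜ (k ℕ.+ 0)) (cosᶜ 0) (sinᶜ 0) (f 0) (g 0))
  (cong (ℚ._* (f 0 ℚ.* g 0 ℚ.+ 0ℚ))
    (trans (sym (cosᶜ-+ (k ℕ.+ 0) 0)) (cong cosᶜ (ℕProps.+-identityʳ (k ℕ.+ 0)))))
cosᶜ-⊛ (suc n) k f g = begin
  _ ≡⟨ solve 8 (λ c s c′ s′ f g F G →
         ((c :* f) :* (c′ :* g) :+ F) :- ((s :* f) :* (s′ :* g) :+ G) :=
         (c :* c′ :- s :* s′) :* (f :* g) :+ (F :- G))
       refl (cosᶜ (k ℕ.+ 0)) (sinᶜ (k ℕ.+ 0)) (cosᶜ (suc n)) (sinᶜ (suc n)) (f 0) (g (suc n)) _ _ ⟩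
  _ ≡⟨ cong₂ (λ u v → u ℚ.* (f 0 ℚ.* g (suc n)) ℚ.+ v)
         (trans (sym (cosᶜ-+ (k ℕ.+ 0) (suc n)))
                (cong (λ l → cosᶜ (l ℕ.+ suc n)) (ℕProps.+-identityʳ k)))
         (trans (cong₂ ℚ._-_
                  (⊛-cong n (λ i → cong (λ l → cosᶜ l ℚ.* f (suc i)) (ℕProps.+-suc k i)) (λ _ → refl))
                  (⊛-cong n (λ i → cong (λ l → sinᶜ l ℚ.* f (suc i)) (ℕProps.+-suc k i)) (λ _ → refl)))
           (trans (cosᶜ-⊛ n (suc k) (f ∘ suc) g)
                  (cong (λ l → cosᶜ l ℚ.* ((f ∘ suc) ⊛ g) n) (sym (ℕProps.+-suc k n))))) ⟩
  _ ≡⟨ ℚProps.*-distribˡ-+ (cosᶜ (k ℕ.+ suc n)) (f 0 ℚ.* g (suc n)) (((f ∘ suc) ⊛ g) n) ⟨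
  _ ∎

sinᶜ-⊛ : ∀ n k f g →
  ((λ i → sinᶜ (k ℕ.+ i) ℚ.* f i) ⊛ (λ i → cosᶜ i ℚ.* g i)) n ℚ.+
  ((λ i → cosᶜ (k ℕ.+ i) ℚ.* f i) ⊛ (λ i → sinᶜ i ℚ.* g i)) n ≡
  sinᶜ (k ℕ.+ n) ℚ.* (f ⊛ g) n
sinᶜ-⊛ zero k f g = trans
  (solve 6 (λ c s c′ s′ f g →
      ((s :* f) :* (c′ :* g) :+ con 0ℚ) :+ ((c :* f) :* (s′ :* g) :+ con 0ℚ) :=
      (s :* c′ :+ c :* s′) :* (f :* g :+ con 0ℚ))
    refl (cosᶜ (k ℕ.+ 0)) (sinᶜ (k ℕ.+ 0)) (cosᶜ 0) (sinᶜ 0) (f 0) (g 0))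
  (cong (ℚ._* (f 0 ℚ.* g 0 ℚ.+ 0ℚ))
    (trans (sym (sinᶜ-+ (k ℕ.+ 0) 0)) (cong sinᶜ (ℕProps.+-identityʳ (k ℕ.+ 0)))))
sinᶜ-⊛ (suc n) k f g = begin
  _ ≡⟨ solve 8 (λ c s c′ s′ f g F G →
         ((s :* f) :* (c′ :* g) :+ F) :+ ((c :* f) :* (s′ :* g) :+ G) :=
         (s :* c′ :+ c :* s′) :* (f :* g) :+ (F :+ G))
       refl (cosᶜ (k ℕ.+ 0)) (sinᶜ (k ℕ.+ 0)) (cosᶜ (suc n)) (sinᶜ (suc n)) (f 0) (g (suc n)) _ _ ⟩
  _ ≡⟨ cong₂ (λ u v → u ℚ.* (f 0 ℚ.* g (suc n)) ℚ.+ v)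
         (trans (sym (sinᶜ-+ (k ℕ.+ 0) (suc n)))
                (cong (λ l → sinᶜ (l ℕ.+ suc n)) (ℕProps.+-identityʳ k)))
         (trans (cong₂ ℚ._+_
                  (⊛-cong n (λ i → cong (λ l → sinᶜ l ℚ.* f (suc i)) (ℕProps.+-suc k i)) (λ _ → refl))
                  (⊛-cong n (λ i → cong (λ l → cosᶜ l ℚ.* f (suc i)) (ℕProps.+-suc k i)) (λ _ → refl)))
           (trans (sinᶜ-⊛ n (suc k) (f ∘ suc) g)
                  (cong (λ l → sinᶜ l ℚ.* ((f ∘ suc) ⊛ g) n) (sym (ℕProps.+-suc k n))))) ⟩
  _ ≡⟨ ℚProps.*-distribˡ-+ (sinᶜ (k ℕ.+ suc n)) (f 0 ℚ.* g (suc n)) (((f ∘ suc) ⊛ g) n) ⟨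
  _ ∎

fromℤ-injective : ∀ {i j} → fromℤ i ≡ fromℤ j → i ≡ j
fromℤ-injective {i} {j} eq with
  ℚᵘProps.≃-trans (ℚᵘProps.≃-sym (ℚProps.toℚᵘ-fromℚᵘ (ℚᵘ.mkℚᵘ i 0)))
    (ℚᵘProps.≃-trans (ℚᵘProps.≃-reflexive (cong ℚ.toℚᵘ eq)) (ℚProps.toℚᵘ-fromℚᵘ (ℚᵘ.mkℚᵘ j 0)))
... | ℚᵘ.*≡* i*1≡j*1 = trans (sym (ℤProps.*-identityʳ i)) (trans i*1≡j*1 (ℤProps.*-identityʳ j))

fromℤ--1^suc : ∀ n → fromℤ (-1ℤ ℤ.^ suc n) ≡ ℚ.- fromℤ (-1ℤ ℤ.^ n)
fromℤ--1^suc n = trans (cong fromℤ (ℤProps.-1*i≡-i (-1ℤ ℤ.^ n))) (sym (fromℤ-neg (-1ℤ ℤ.^ n)))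

2*suc : ∀ n → 2 ℕ.* suc n ≡ suc (suc (2 ℕ.* n))
2*suc n = ℕProps.*-distribˡ-+ 2 1 n

cosᶜ-even : ∀ n → cosᶜ (2 ℕ.* n) ≡ fromℤ (-1ℤ ℤ.^ n)
cosᶜ-even zero    = refl
cosᶜ-even (suc n) = trans (cong cosᶜ (2*suc n))
  (trans (cong ℚ.-_ (cosᶜ-even n)) (sym (fromℤ--1^suc n)))

sinᶜ-even : ∀ n → sinᶜ (2 ℕ.* n) ≡ 0ℚ
sinᶜ-even zero    = refl
sinᶜ-even (suc n) = trans (cong sinᶜ (2*suc n)) (cong ℚ.-_ (sinᶜ-even n))

-- Euler numbers and their generating function

eulerᶜ : PowerSeries
eulerᶜ n = 1/ n ! ℚ.* E n

E-generating : ∀ n → ((expSeries ⊕ const 1ℚ) ⊛ eulerᶜ) n ≡ const (fromℕ 2) n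
E-generating n = trans (⊛-cong n (λ _ → refl) λ i → begin
    1/ i ! ℚ.* (fromℕ (i !) ℚ.* Q i)   ≡⟨ ℚProps.*-assoc (1/ i !) (fromℕ (i !)) (Q i) ⟨
    1/ i ! ℚ.* fromℕ (i !) ℚ.* Q i     ≡⟨ cong (ℚ._* Q i) (factorial-inverse i) ⟩
    1ℚ ℚ.* Q i                         ≡⟨ ℚProps.*-identityˡ (Q i) ⟩
    Q i ∎)
  (divide-correct (const (fromℕ 2)) (expSeries ⊕ const 1ℚ) n)
  where Q = divide (const (fromℕ 2)) (expSeries ⊕ const 1ℚ)

-- The constant term of e^t + 1 is 2, so comparing coefficients at t^(n+1) determines E (n + 1) from
-- earlier values at the cost of a factor ½ only. This form is made for `E-integral`.
E-recurrence : ∀ n → E (suc n) ≡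
  ℚ.- ½ ℚ.* (fromℕ (suc n !) ℚ.* ((λ i → expSeries (suc i)) ⊛ eulerᶜ) n)
E-recurrence n = begin
  E (suc n)
    -- The product of (n + 1)! and its inverse is inserted together with the compensating error 1 -
    -- i d, which the next step turns into 1 - 1.
    ≡⟨ solve 3 (λ e i d → e := i :* d :* e :+ (con 1ℚ :- i :* d) :* e) refl (E (suc n)) (1/ suc n !) (fromℕ (suc n !)) ⟩
  1/ suc n ! ℚ.* fromℕ (suc n !) ℚ.* E (suc n) ℚ.+ (1ℚ ℚ.- 1/ suc n ! ℚ.* fromℕ (suc n !)) ℚ.* E (suc n)
    ≡⟨ cong (λ u → 1/ suc n ! ℚ.* fromℕ (suc n !) ℚ.* E (suc n) ℚ.+ (1ℚ ℚ.- u) ℚ.* E (suc n)) (factorial-inverse (suc n)) ⟩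
  1/ suc n ! ℚ.* fromℕ (suc n !) ℚ.* E (suc n) ℚ.+ (1ℚ ℚ.- 1ℚ) ℚ.* E (suc n)
    ≡⟨ solve 4 (λ e i d G → i :* d :* e :+ (con 1ℚ :- con 1ℚ) :* e :=
         con ½ :* d :* (con (fromℕ 2) :* (i :* e) :+ G) :+ :- con ½ :* (d :* G))
         refl (E (suc n)) (1/ suc n !) (fromℕ (suc n !)) G ⟩
  ½ ℚ.* fromℕ (suc n !) ℚ.* (fromℕ 2 ℚ.* eulerᶜ (suc n) ℚ.+ G) ℚ.+ ℚ.- ½ ℚ.* (fromℕ (suc n !) ℚ.* G)
    ≡⟨ cong (λ u → ½ ℚ.* fromℕ (suc n !) ℚ.* (fromℕ 2 ℚ.* eulerᶜ (suc n) ℚ.+ u) ℚ.+ ℚ.- ½ ℚ.* (fromℕ (suc n !) ℚ.* G))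
         (⊛-cong n (λ i → sym (ℚProps.+-identityʳ (expSeries (suc i)))) (λ _ → refl)) ⟩
  ½ ℚ.* fromℕ (suc n !) ℚ.* ((expSeries ⊕ const 1ℚ) ⊛ eulerᶜ) (suc n) ℚ.+ ℚ.- ½ ℚ.* (fromℕ (suc n !) ℚ.* G)
    ≡⟨ cong (λ u → ½ ℚ.* fromℕ (suc n !) ℚ.* u ℚ.+ ℚ.- ½ ℚ.* (fromℕ (suc n !) ℚ.* G)) (E-generating (suc n)) ⟩
  ½ ℚ.* fromℕ (suc n !) ℚ.* 0ℚ ℚ.+ ℚ.- ½ ℚ.* (fromℕ (suc n !) ℚ.* G)
    ≡⟨ solve 2 (λ d g → con ½ :* d :* con 0ℚ :+ g := g) refl (fromℕ (suc n !)) (ℚ.- ½ ℚ.* (fromℕ (suc n !) ℚ.* G)) ⟩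
  ℚ.- ½ ℚ.* (fromℕ (suc n !) ℚ.* G) ∎
  where G = ((λ i → expSeries (suc i)) ⊛ eulerᶜ) n

const-⊛ : ∀ n c f → (const c ⊛ f) n ≡ c ℚ.* f n
const-⊛ zero    c f = ℚProps.+-identityʳ (c ℚ.* f 0)
const-⊛ (suc n) c f = trans (cong (c ℚ.* f (suc n) ℚ.+_) (zero-⊛ n))
                            (ℚProps.+-identityʳ (c ℚ.* f (suc n)))
  where
  zero-⊛ : ∀ n → ((λ _ → 0ℚ) ⊛ f) n ≡ 0ℚ
  zero-⊛ zero    = trans (ℚProps.+-identityʳ (0ℚ ℚ.* f 0)) (ℚProps.*-zeroˡ (f 0))
  zero-⊛ (suc n) = trans (cong₂ ℚ._+_ (ℚProps.*-zeroˡ (f (suc n))) (zero-⊛ n)) refl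

-- The sign reconciles (-1)^(n+1) in the Euler series with the imaginary part (-1)ⁿ of i^(2n+1).
-eulerᶜ : PowerSeries
-eulerᶜ n = ℚ.- 1ℚ ℚ.* eulerᶜ n

-eulerᶜ-generating : ∀ n → -eulerᶜ n ℚ.+ (expSeries ⊛ -eulerᶜ) n ≡ ℚ.- const (fromℕ 2) n
-eulerᶜ-generating n = begin
  ℚ.- 1ℚ ℚ.* eulerᶜ n ℚ.+ (expSeries ⊛ -eulerᶜ) n
    ≡⟨ cong (ℚ.- 1ℚ ℚ.* eulerᶜ n ℚ.+_) (⊛-*ʳ n (ℚ.- 1ℚ) expSeries eulerᶜ) ⟨
  ℚ.- 1ℚ ℚ.* eulerᶜ n ℚ.+ ℚ.- 1ℚ ℚ.* (expSeries ⊛ eulerᶜ) n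
    ≡⟨ solve 2 (λ e s → con (ℚ.- 1ℚ) :* e :+ con (ℚ.- 1ℚ) :* s := :- (s :+ con 1ℚ :* e)) refl
         (eulerᶜ n) ((expSeries ⊛ eulerᶜ) n) ⟩
  ℚ.- ((expSeries ⊛ eulerᶜ) n ℚ.+ 1ℚ ℚ.* eulerᶜ n)
    ≡⟨ cong (λ u → ℚ.- ((expSeries ⊛ eulerᶜ) n ℚ.+ u)) (const-⊛ n 1ℚ eulerᶜ) ⟨
  ℚ.- ((expSeries ⊛ eulerᶜ) n ℚ.+ (const 1ℚ ⊛ eulerᶜ) n)
    ≡⟨ cong ℚ.-_ (trans (sym (⊛-⊕ n expSeries (const 1ℚ) eulerᶜ)) (E-generating n)) ⟩
  ℚ.- const (fromℕ 2) n ∎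

-- Coefficients of sin t and cos t, and of the imaginary and real parts of -2 / (e^(it) + 1).
sinᵇ cosᵇ eulerSinᵇ eulerCosᵇ : PowerSeries
sinᵇ i = sinᶜ i ℚ.* 1/ i !
cosᵇ i = cosᶜ i ℚ.* 1/ i !
eulerSinᵇ i = sinᶜ i ℚ.* -eulerᶜ i
eulerCosᵇ i = cosᶜ i ℚ.* -eulerᶜ i

-- Odd numbers

Odd : ℕ → Set
Odd n = ∃[ m ] n ≡ 1 ℕ.+ m ℕ.* 2

odd-* : ∀ {m n} → Odd m → Odd n → Odd (m ℕ.* n)
odd-* (a , refl) (b , refl) = a ℕ.+ b ℕ.+ a ℕ.* b ℕ.* 2 , ℕSolver.solve 2 (λ a b →
  (ℕSolver.con 1 ℕSolver.:+ a ℕSolver.:* ℕSolver.con 2) ℕSolver.:* (ℕSolver.con 1 ℕSolver.:+ b ℕSolver.:* ℕSolver.con 2)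
  ℕSolver.:= ℕSolver.con 1 ℕSolver.:+ (a ℕSolver.:+ b ℕSolver.:+ a ℕSolver.:* b ℕSolver.:* ℕSolver.con 2) ℕSolver.:* ℕSolver.con 2)
  refl a b

odd-^ : ∀ {m} → Odd m → ∀ n → Odd (m ℕ.^ n)
odd-^ m-odd zero    = 0 , refl
odd-^ m-odd (suc n) = odd-* m-odd (odd-^ m-odd n)

prime-odd : ∀ {p} → Prime p → p ≢ 2 → Odd p
prime-odd {p} p-prime p≢2 = go (p DivMod.% 2) (DivMod.m%n<n p 2) (DivMod.m≡m%n+[m/n]*n p 2)
  where
  go : ∀ r → r ℕ.< 2 → p ≡ r ℕ.+ (p DivMod./ 2) ℕ.* 2 → Odd p
  go zero          r<2 eq = ⊥-elim (even (prime⇒irreducible p-prime (ℕ∣.divides (p DivMod./ 2) eq)))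
    where
    even : ¬ (2 ≡ 1 ⊎ 2 ≡ p)
    even (inj₂ 2≡p) = p≢2 (sym 2≡p)
  go (suc zero)    r<2 eq = p DivMod./ 2 , eq
  go (suc (suc r)) (s≤s (s≤s ())) eq

fromℕ-suc : ∀ n → fromℕ (suc n) ≡ fromℕ n ℚ.+ 1ℚ
fromℕ-suc n = trans (cong fromℕ (ℕProps.+-comm 1 n)) (sym (fromℤ-+ (+ n) (+ 1)))

-- Convergent power series

module Analysis (p : ℕ) (p-prime : Prime p) where
  open Padic p p-prime

  ∣∣-mono : ∀ {r k l} → k ℕ.≤ l → ∣ r ∣≤p^- l → ∣ r ∣≤p^- k
  ∣∣-mono {r} {k} {l} k≤l r≤ = shift-≤ (l ℕ.∸ k) k
    (*-≤ (fromℕ-≤ (p ℕ.^ (l ℕ.∸ k))) (subst (∣ r ∣≤p^-_) (sym (ℕProps.m∸n+n≡m k≤l)) r≤))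

  Bound-mono : ∀ {b c r} → b ℕ.≤ c → Bound b r → Bound c r
  Bound-mono {b} {c} {r} b≤c Br = subst (∣_∣≤p^- 0)
    (trans (sym (ℚProps.*-assoc (fromℕ (p ℕ.^ (c ℕ.∸ b))) (fromℕ (p ℕ.^ b)) r)) (cong (ℚ._* r)
      (trans (fromℕ-* (p ℕ.^ (c ℕ.∸ b)) (p ℕ.^ b)) (cong fromℕ
        (trans (sym (ℕProps.^-distribˡ-+-* p (c ℕ.∸ b) b)) (cong (p ℕ.^_) (ℕProps.m∸n+n≡m b≤c)))))))
    (*-≤ {s = fromℕ (p ℕ.^ b) ℚ.* r} (fromℕ-≤ (p ℕ.^ (c ℕ.∸ b))) Br)

  integral⇒Bound : ∀ b {r} → ∣ r ∣≤p^- 0 → Bound b r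
  integral⇒Bound b r≤ = *-≤ (fromℕ-≤ (p ℕ.^ b)) r≤

  -- Tame b makes Σ bᵢ xⁱ converge for |x| ≤ p⁻¹.
  Tame : PowerSeries → Set
  Tame b = ∀ i → Bound ⌊ i /2⌋ (b i)

  tame-*ˡ : ∀ {a b : PowerSeries} → (∀ i → ∣ a i ∣≤p^- 0) → Tame b → Tame (λ i → a i ℚ.* b i)
  tame-*ˡ {a} {b} a≤ tame i = subst (∣_∣≤p^- 0)
    (solve 3 (λ P a b → a :* (P :* b) := P :* (a :* b)) refl (fromℕ (p ℕ.^ ⌊ i /2⌋)) (a i) (b i))
    (*-≤ {r = a i} {s = fromℕ (p ℕ.^ ⌊ i /2⌋) ℚ.* b i} (a≤ i) (tame i))

  ^^-≤ : ∀ {x} → ∣ x ∣≤p^- 1 → ∀ i → ∣ x ^^ i ∣≤p^- i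
  ^^-≤ x≤ zero    = fromℕ-≤ 1
  ^^-≤ x≤ (suc i) = *-≤ x≤ (^^-≤ x≤ i)

  -- Each further factor x or y contributes a power of p; the resulting gain of `i` pays for the
  -- growth of tame coefficients in `partial-lipschitz`.
  ^^-lipschitz : ∀ {x y k} → ∣ x ∣≤p^- 1 → ∣ y ∣≤p^- 1 → ∣ x ℚ.- y ∣≤p^- k →
                 ∀ i → ∣ x ^^ suc i ℚ.- y ^^ suc i ∣≤p^- (k ℕ.+ i)
  ^^-lipschitz {x} {y} {k} x≤ y≤ x-y≤ zero = subst (λ l → ∣ x ^^ 1 ℚ.- y ^^ 1 ∣≤p^- l)
    (sym (ℕProps.+-identityʳ k)) (subst (∣_∣≤p^- k)
      (solve 2 (λ x y → x :- y := x :* con 1ℚ :- y :* con 1ℚ) refl x y) x-y≤)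
  ^^-lipschitz {x} {y} {k} x≤ y≤ x-y≤ (suc i) = subst (∣_∣≤p^- (k ℕ.+ suc i))
    (solve 4 (λ x y X Y → x :* (X :- Y) :+ (x :- y) :* Y := x :* X :- y :* Y) refl
      x y (x ^^ suc i) (y ^^ suc i))
    (+-≤ (subst (∣ x ℚ.* (x ^^ suc i ℚ.- y ^^ suc i) ∣≤p^-_) (sym (ℕProps.+-suc k i))
            (*-≤ x≤ (^^-lipschitz x≤ y≤ x-y≤ i)))
         (*-≤ x-y≤ (^^-≤ y≤ (suc i))))

  term : PowerSeries → ℚ → PowerSeries
  term b x i = b i ℚ.* x ^^ i

  partial : PowerSeries → ℕ → ℚ → ℚ
  partial b n x = ∑ n (term b x)

  term-≤ : ∀ {b x} → Tame b → ∣ x ∣≤p^- 1 → ∀ i → ∣ term b x i ∣≤p^- ⌈ i /2⌉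
  term-≤ {b} {x} tame x≤ i = *-Bound ⌊ i /2⌋ (tame i)
    (subst (∣ x ^^ i ∣≤p^-_) (sym (ℕProps.⌊n/2⌋+⌈n/2⌉≡n i)) (^^-≤ x≤ i))

  term-small : ∀ {b x} → Tame b → ∣ x ∣≤p^- 1 → ∀ {k i} → k ℕ.+ k ℕ.≤ i → ∣ term b x i ∣≤p^- k
  term-small tame x≤ {k} {i} 2k≤i =
    ∣∣-mono (subst (ℕ._≤ ⌈ i /2⌉) (sym (ℕProps.n≡⌈n+n/2⌉ k)) (ℕProps.⌈n/2⌉-mono 2k≤i))
            (term-≤ tame x≤ i)

  ∑-≤ : ∀ n {f k} → (∀ i → ∣ f i ∣≤p^- k) → ∣ ∑ n f ∣≤p^- k
  ∑-≤ zero    f≤ = zero-≤ _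
  ∑-≤ (suc n) f≤ = +-≤ (f≤ 0) (∑-≤ n (f≤ ∘ suc))

  ∑-lipschitz : ∀ n {f g k} → (∀ i → ∣ f i ℚ.- g i ∣≤p^- k) → ∣ ∑ n f ℚ.- ∑ n g ∣≤p^- k
  ∑-lipschitz zero    f-g≤ = zero-≤ _
  ∑-lipschitz (suc n) {f} {g} {k} f-g≤ = subst (∣_∣≤p^- k)
    (solve 4 (λ a b c d → (a :- b) :+ (c :- d) := (a :+ c) :- (b :+ d)) refl
      (f 0) (g 0) (∑ n (f ∘ suc)) (∑ n (g ∘ suc)))
    (+-≤ (f-g≤ 0) (∑-lipschitz n (f-g≤ ∘ suc)))

  ∑-tail : ∀ {m n f k} → m ℕ.≤ n → (∀ i → m ℕ.≤ i → ∣ f i ∣≤p^- k) → ∣ ∑ n f ℚ.- ∑ m f ∣≤p^- k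
  ∑-tail {m} {n} {f} {k} m≤n f≤ = subst (∣_∣≤p^- k)
    (begin
      T                     ≡⟨ solve 2 (λ s t → t := (s :+ t) :- s) refl (∑ m f) T ⟩
      (∑ m f ℚ.+ T) ℚ.- ∑ m f  ≡⟨ cong (ℚ._- ∑ m f) (∑-split m (n ℕ.∸ m) f) ⟨
      ∑ (m ℕ.+ (n ℕ.∸ m)) f ℚ.- ∑ m f
        ≡⟨ cong (λ l → ∑ l f ℚ.- ∑ m f) (ℕProps.m+[n∸m]≡n m≤n) ⟩
      ∑ n f ℚ.- ∑ m f ∎)
    (∑-≤ (n ℕ.∸ m) (λ i → f≤ (m ℕ.+ i) (ℕProps.m≤m+n m i)))
    where T = ∑ (n ℕ.∸ m) (λ i → f (m ℕ.+ i))

  partial-tail : ∀ {b x} → Tame b → ∣ x ∣≤p^- 1 → ∀ {k m n} → k ℕ.+ k ℕ.≤ m → m ℕ.≤ n →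
                 ∣ partial b n x ℚ.- partial b m x ∣≤p^- k
  partial-tail tame x≤ 2k≤m m≤n =
    ∑-tail m≤n (λ i m≤i → term-small tame x≤ (ℕProps.≤-trans 2k≤m m≤i))

  -- The estimate is uniform in the length `n`, which is what permits the diagonal evaluation in
  -- `eval`.
  partial-lipschitz : ∀ {b x y k} n → Tame b → ∣ x ∣≤p^- 1 → ∣ y ∣≤p^- 1 → ∣ x ℚ.- y ∣≤p^- k →
                      ∣ partial b n x ℚ.- partial b n y ∣≤p^- k
  partial-lipschitz {b} {x} {y} {k} n tame x≤ y≤ x-y≤ = ∑-lipschitz n step
    where
    step : ∀ i → ∣ term b x i ℚ.- term b y i ∣≤p^- k
    step zero    = subst (∣_∣≤p^- k) (sym (ℚProps.+-inverseʳ (b 0 ℚ.* 1ℚ))) (zero-≤ k)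
    step (suc i) = subst (∣_∣≤p^- k)
      (solve 3 (λ b X Y → b :* (X :- Y) := b :* X :- b :* Y) refl (b (suc i)) (x ^^ suc i) (y ^^ suc i))
      -- ⌊(i + 1)/2⌋ ≤ i, so the gain in `^^-lipschitz` covers the size of the coefficient.
      (*-Bound ⌊ suc i /2⌋ (tame (suc i)) (∣∣-mono
        (ℕProps.≤-trans (ℕProps.+-monoˡ-≤ k (ℕ.s≤s⁻¹ (ℕProps.⌊n/2⌋<n i))) (ℕProps.≤-reflexive (ℕProps.+-comm i k)))
        (^^-lipschitz x≤ y≤ x-y≤ i)))

  -- The difference consists of products u i · v j with i + j ≥ n. The lengths are separate because
  -- the induction peels off one row u 0 · v at a time: `n` decreases while `L` stays, and each row
  -- contributes a tail of v.
  cauchy-product : ∀ n L {u v k} → n ℕ.≤ L → (∀ i j → n ℕ.≤ i ℕ.+ j → ∣ u i ℚ.* v j ∣≤p^- k) →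
                   ∣ ∑ n u ℚ.* ∑ L v ℚ.- ∑ n (u ⊛ v) ∣≤p^- k
  cauchy-product zero L {u} {v} {k} n≤L uv≤ = subst (∣_∣≤p^- k)
    (solve 1 (λ V → con 0ℚ := con 0ℚ :* V :- con 0ℚ) refl (∑ L v)) (zero-≤ k)
  cauchy-product (suc n) L {u} {v} {k} n≤L uv≤ = subst (∣_∣≤p^- k) (begin
      (∑ L (λ j → u 0 ℚ.* v j) ℚ.- ∑ (suc n) (λ j → u 0 ℚ.* v j)) ℚ.+ (U ℚ.* ∑ L v ℚ.- W)
        ≡⟨ cong₂ (λ s t → (s ℚ.- t) ℚ.+ (U ℚ.* ∑ L v ℚ.- W)) (∑-*ˡ L (u 0) v) (∑-*ˡ (suc n) (u 0) v) ⟨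
      (u 0 ℚ.* ∑ L v ℚ.- u 0 ℚ.* (v 0 ℚ.+ V)) ℚ.+ (U ℚ.* ∑ L v ℚ.- W)
        ≡⟨ solve 6 (λ u U V′ v V W → (u :* V′ :- u :* (v :+ V)) :+ (U :* V′ :- W) :=
                                  (u :+ U) :* V′ :- ((u :* v :+ con 0ℚ) :+ (u :* V :+ W)))
             refl (u 0) U (∑ L v) (v 0) V W ⟩
      (u 0 ℚ.+ U) ℚ.* ∑ L v ℚ.- ((u 0 ℚ.* v 0 ℚ.+ 0ℚ) ℚ.+ (u 0 ℚ.* V ℚ.+ W))
        ≡⟨ cong (λ s → (u 0 ℚ.+ U) ℚ.* ∑ L v ℚ.- ((u 0 ℚ.* v 0 ℚ.+ 0ℚ) ℚ.+ s))
             (trans (cong (ℚ._+ W) (∑-*ˡ n (u 0) (v ∘ suc)))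
                    (∑-+ n (λ j → u 0 ℚ.* v (suc j)) ((u ∘ suc) ⊛ v))) ⟩
      ∑ (suc n) u ℚ.* ∑ L v ℚ.- ∑ (suc n) (u ⊛ v) ∎)
    (+-≤ (∑-tail n≤L (uv≤ 0))
         (cauchy-product n L (ℕProps.<⇒≤ n≤L) (λ i j n≤i+j → uv≤ (suc i) j (s≤s n≤i+j))))
    where
    U V W : ℚ
    U = ∑ n (u ∘ suc)
    V = ∑ n (v ∘ suc)
    W = ∑ n ((u ∘ suc) ⊛ v)

  partial-product : ∀ {b d x y} → Tame b → Tame d → ∣ x ∣≤p^- 1 → ∣ y ∣≤p^- 1 →
    ∀ {k n} → k ℕ.+ k ℕ.≤ n →
    ∣ partial b n x ℚ.* partial d n y ℚ.- ∑ n (term b x ⊛ term d y) ∣≤p^- k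
  partial-product tame-b tame-d x≤ y≤ {k} {n} 2k≤n = cauchy-product n n ℕProps.≤-refl λ i j n≤i+j →
    ∣∣-mono (half i j (ℕProps.≤-trans 2k≤n n≤i+j)) (*-≤ (term-≤ tame-b x≤ i) (term-≤ tame-d y≤ j))
    where
    i≤2⌈i/2⌉ : ∀ i → i ℕ.≤ ⌈ i /2⌉ ℕ.+ ⌈ i /2⌉
    i≤2⌈i/2⌉ i = ℕProps.≤-trans (ℕProps.≤-reflexive (sym (ℕProps.⌊n/2⌋+⌈n/2⌉≡n i)))
                   (ℕProps.+-monoˡ-≤ ⌈ i /2⌉ (ℕProps.⌊n/2⌋≤⌈n/2⌉ i))
    half : ∀ i j → k ℕ.+ k ℕ.≤ i ℕ.+ j → k ℕ.≤ ⌈ i /2⌉ ℕ.+ ⌈ j /2⌉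
    half i j 2k≤ = subst (ℕ._≤ c) (sym (ℕProps.n≡⌊n+n/2⌋ k))
      (subst (⌊ k ℕ.+ k /2⌋ ℕ.≤_) (sym (ℕProps.n≡⌊n+n/2⌋ c)) (ℕProps.⌊n/2⌋-mono
        (ℕProps.≤-trans 2k≤ (ℕProps.≤-trans (ℕProps.+-mono-≤ (i≤2⌈i/2⌉ i) (i≤2⌈i/2⌉ j))
          (ℕProps.≤-reflexive (interchange ⌈ i /2⌉ ⌈ j /2⌉))))))
      where
      c : ℕ
      c = ⌈ i /2⌉ ℕ.+ ⌈ j /2⌉
      interchange : ∀ a b → (a ℕ.+ a) ℕ.+ (b ℕ.+ b) ≡ (a ℕ.+ b) ℕ.+ (a ℕ.+ b)
      interchange = ℕSolver.solve 2 (λ a b → (a ℕSolver.:+ a) ℕSolver.:+ (b ℕSolver.:+ b)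
        ℕSolver.:= (a ℕSolver.:+ b) ℕSolver.:+ (a ℕSolver.:+ b)) refl

  -- ∥ x ∥≤p^- k is, definitionally, Eventually≤ k (seq x).
  Eventually≤ : ℕ → (ℕ → ℚ) → Set
  Eventually≤ k s = ∃[ N ] ∀ n → N ℕ.≤ n → ∣ s n ∣≤p^- k

  -- x ≈ y is, definitionally, Null (seq (x - y)).
  Null : (ℕ → ℚ) → Set
  Null s = ∀ k → Eventually≤ k s

  ev-resp : ∀ {s t k} → (∀ n → s n ≡ t n) → Eventually≤ k s → Eventually≤ k t
  ev-resp {k = k} s≡t (N , s≤) = N , λ n N≤n → subst (∣_∣≤p^- k) (s≡t n) (s≤ n N≤n)

  ev-+ : ∀ {s t k} → Eventually≤ k s → Eventually≤ k t → Eventually≤ k (λ n → s n ℚ.+ t n)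
  ev-+ (M , s≤) (N , t≤) = M ℕ.⊔ N , λ n M⊔N≤n →
    +-≤ (s≤ n (ℕProps.m⊔n≤o⇒m≤o M N M⊔N≤n)) (t≤ n (ℕProps.m⊔n≤o⇒n≤o M N M⊔N≤n))

  ev-neg : ∀ {s k} → Eventually≤ k s → Eventually≤ k (λ n → ℚ.- s n)
  ev-neg (N , s≤) = N , λ n N≤n → neg-≤ (s≤ n N≤n)

  ev-* : ∀ {s t k l} → Eventually≤ k s → Eventually≤ l t → Eventually≤ (k ℕ.+ l) (λ n → s n ℚ.* t n)
  ev-* (M , s≤) (N , t≤) = M ℕ.⊔ N , λ n M⊔N≤n →
    *-≤ (s≤ n (ℕProps.m⊔n≤o⇒m≤o M N M⊔N≤n)) (t≤ n (ℕProps.m⊔n≤o⇒n≤o M N M⊔N≤n))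

  ev-mono : ∀ {s k l} → k ℕ.≤ l → Eventually≤ l s → Eventually≤ k s
  ev-mono k≤l (N , s≤) = N , λ n N≤n → ∣∣-mono k≤l (s≤ n N≤n)

  null-resp : ∀ {s t} → (∀ n → s n ≡ t n) → Null s → Null t
  null-resp s≡t s-null k = ev-resp s≡t (s-null k)

  null-+ : ∀ {s t} → Null s → Null t → Null (λ n → s n ℚ.+ t n)
  null-+ s-null t-null k = ev-+ (s-null k) (t-null k)

  null-neg : ∀ {s} → Null s → Null (λ n → ℚ.- s n)
  null-neg s-null k = ev-neg (s-null k)

  -- A Cauchy sequence is eventually bounded by some pᵇ, so it suffices to ask for s at precision b
  -- + k. This supplies the multipliers in the certificates.
  null-* : ∀ x {s} → Null s → Null (λ n → seq x n ℚ.* s n)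
  null-* x s-null k =
    let b , M , Bx = eventual-bound (seq x) (cauchy x)
        N , s≤     = s-null (b ℕ.+ k)
    in M ℕ.⊔ N , λ n M⊔N≤n →
      *-Bound b (Bx n (ℕProps.m⊔n≤o⇒m≤o M N M⊔N≤n)) (s≤ n (ℕProps.m⊔n≤o⇒n≤o M N M⊔N≤n))

  null-zero : ∀ {s} → (∀ n → s n ≡ 0ℚ) → Null s
  null-zero s≡0 k = 0 , λ n _ → subst (∣_∣≤p^- k) (sym (s≡0 n)) (zero-≤ k)

  -- Terms m and n differ both in length and in argument. They are compared through sums of the
  -- common length N: the tails are small because N ≥ 2k, and at fixed length the argument is
  -- changed by the Lipschitz estimate.
  eval-cauchy : ∀ b → Tame b → (x : ℚₚ) → ∥ x ∥≤p^- 1 → Cauchy (λ n → partial b n (seq x n))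
  eval-cauchy b tame x (M , x≤) k =
    let K , cx = cauchy x k
        N      = (K ℕ.⊔ M) ℕ.⊔ (k ℕ.+ k)
        K≤     = λ {n} (N≤n : N ℕ.≤ n) → ℕProps.m⊔n≤o⇒m≤o K M (ℕProps.m⊔n≤o⇒m≤o (K ℕ.⊔ M) (k ℕ.+ k) N≤n)
        M≤     = λ {n} (N≤n : N ℕ.≤ n) → ℕProps.m⊔n≤o⇒n≤o K M (ℕProps.m⊔n≤o⇒m≤o (K ℕ.⊔ M) (k ℕ.+ k) N≤n)
        2k≤N   = ℕProps.m≤n⊔m (K ℕ.⊔ M) (k ℕ.+ k)
    in N , λ m n N≤m N≤n → subst (∣_∣≤p^- k)
      (solve 4 (λ a b c d → (a :- b) :+ ((b :- c) :+ :- (d :- c)) := a :- d) refl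
        (partial b m (seq x m)) (partial b N (seq x m)) (partial b N (seq x n)) (partial b n (seq x n)))
      (+-≤ (partial-tail tame (x≤ m (M≤ N≤m)) 2k≤N N≤m)
        (+-≤ (partial-lipschitz N tame (x≤ m (M≤ N≤m)) (x≤ n (M≤ N≤n)) (cx m n (K≤ N≤m) (K≤ N≤n)))
          (neg-≤ (partial-tail tame (x≤ n (M≤ N≤n)) 2k≤N N≤n))))

  eval : ∀ b → Tame b → (x : ℚₚ) → ∥ x ∥≤p^- 1 → ℚₚ
  eval b tame x x≤ = mkℚₚ (λ n → partial b n (seq x n)) (eval-cauchy b tame x x≤)

  eval-integral : ∀ {b} (tame : Tame b) x (x≤ : ∥ x ∥≤p^- 1) → ∥ eval b tame x x≤ ∥≤p^- 0
  eval-integral tame x (N , x≤) = N , λ n N≤n → ∑-≤ n λ i → ∣∣-mono z≤n (term-≤ tame (x≤ n N≤n) i)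

  -- The convolution is left as a sum of rational terms; each use identifies these, coefficient by
  -- coefficient, with the terms of the series it expects.
  eval-product : ∀ {b d} → Tame b → Tame d → ∀ x y → ∥ x ∥≤p^- 1 → ∥ y ∥≤p^- 1 →
    Null (λ n → partial b n (seq x n) ℚ.* partial d n (seq y n)
                  ℚ.- ∑ n (term b (seq x n) ⊛ term d (seq y n)))
  eval-product tame-b tame-d x y (K , x≤) (L , y≤) k = (K ℕ.⊔ L) ℕ.⊔ (k ℕ.+ k) , λ n N≤n →
    let KL≤ = ℕProps.m⊔n≤o⇒m≤o (K ℕ.⊔ L) (k ℕ.+ k) N≤n
    in partial-product tame-b tame-d (x≤ n (ℕProps.m⊔n≤o⇒m≤o K L KL≤)) (y≤ n (ℕProps.m⊔n≤o⇒n≤o K L KL≤))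
         (ℕProps.m⊔n≤o⇒n≤o (K ℕ.⊔ L) (k ℕ.+ k) N≤n)

-- Integrality for an odd prime: factorials, Euler numbers, sums of series, inverses

module Arithmetic (p : ℕ) (p-prime : Prime p) (p≢2 : p ≢ 2) where
  open Padic p p-prime
  open Analysis p p-prime

  private
    instance
      p≢0 : ℕ.NonZero p
      p≢0 = prime⇒nonZero p-prime

  1<p : 1 ℕ.< p
  1<p = ℕ.nonTrivial⇒n>1 p {{prime⇒nonTrivial p-prime}}

  2<p : 2 ℕ.< p
  2<p = ℕProps.≤∧≢⇒< 1<p (p≢2 ∘ sym)

  -- None of pm + 1, ..., pm + r is divisible by p when r < p.
  factorial-remainder : ∀ m r → r ℕ.< p → ∃[ w ] (p ℕ.* m ℕ.+ r) ! ≡ (p ℕ.* m) ! ℕ.* w × ¬ (p ∣ w)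
  factorial-remainder m zero    r<p = 1 ,
    trans (cong _! (ℕProps.+-identityʳ (p ℕ.* m))) (sym (ℕProps.*-identityʳ _)) , p∤1
  factorial-remainder m (suc r) r<p =
    let w , eq , p∤w = factorial-remainder m r (ℕProps.<⇒≤ r<p)
    in (p ℕ.* m ℕ.+ suc r) ℕ.* w ,
       trans (cong _! (ℕProps.+-suc (p ℕ.* m) r))
         (trans (cong₂ ℕ._*_ (sym (ℕProps.+-suc (p ℕ.* m) r)) eq)
           (ℕSolver.solve 3 (λ a b c → a ℕSolver.:* (b ℕSolver.:* c) ℕSolver.:= b ℕSolver.:* (a ℕSolver.:* c)) refl
             (p ℕ.* m ℕ.+ suc r) ((p ℕ.* m) !) w)) ,
       p∤* (λ p∣ → ℕ∣.>⇒∤ r<p (ℕ∣.∣m+n∣m⇒∣n p∣ (ℕ∣.m∣m*n m))) p∤w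

  -- The multiples of p among 1, ..., pm have product p^m m!; all other factors are prime to p.
  factorial-multiple : ∀ m → ∃[ u ] (p ℕ.* m) ! ≡ p ℕ.^ m ℕ.* m ! ℕ.* u × ¬ (p ∣ u)
  factorial-multiple zero    = 1 , cong _! (ℕProps.*-zeroʳ p) , p∤1
  factorial-multiple (suc m) =
    let u , eq , p∤u   = factorial-multiple m
        w , eq′ , p∤w = factorial-remainder m (ℕ.pred p) (ℕProps.≤-reflexive (ℕProps.suc-pred p))
    in u ℕ.* w , (begin
         (p ℕ.* suc m) !                                    ≡⟨ cong _! step ⟩
         suc (p ℕ.* m ℕ.+ ℕ.pred p) !
           ≡⟨ cong₂ ℕ._*_ (sym step) (trans eq′ (cong (ℕ._* w) eq)) ⟩
         p ℕ.* suc m ℕ.* (p ℕ.^ m ℕ.* m ! ℕ.* u ℕ.* w)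
           ≡⟨ ℕSolver.solve 6 (λ p s q f u w →
                p ℕSolver.:* s ℕSolver.:* (q ℕSolver.:* f ℕSolver.:* u ℕSolver.:* w) ℕSolver.:=
                p ℕSolver.:* q ℕSolver.:* (s ℕSolver.:* f) ℕSolver.:* (u ℕSolver.:* w)) refl
                p (suc m) (p ℕ.^ m) (m !) u w ⟩
         p ℕ.^ suc m ℕ.* suc m ! ℕ.* (u ℕ.* w) ∎) , p∤* p∤u p∤w
    where
    step : p ℕ.* suc m ≡ suc (p ℕ.* m ℕ.+ ℕ.pred p)
    step = begin
      p ℕ.* suc m                     ≡⟨ ℕProps.*-suc p m ⟩
      p ℕ.+ p ℕ.* m                   ≡⟨ ℕProps.+-comm p (p ℕ.* m) ⟩
      p ℕ.* m ℕ.+ p                   ≡⟨ cong (p ℕ.* m ℕ.+_) (sym (ℕProps.suc-pred p)) ⟩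
      p ℕ.* m ℕ.+ suc (ℕ.pred p)      ≡⟨ ℕProps.+-suc (p ℕ.* m) (ℕ.pred p) ⟩
      suc (p ℕ.* m ℕ.+ ℕ.pred p) ∎

  FactorialValuation : ℕ → Set
  FactorialValuation n = ∃[ v ] ∃[ w ] n ! ≡ p ℕ.^ v ℕ.* w × ¬ (p ∣ w) × v ℕ.≤ ⌊ n /2⌋

  -- Legendre's recursion: with m = ⌊n/p⌋, the exponent of p in n! is m plus the exponent of p in
  -- m!.
  factorial-valuation : ∀ n → FactorialValuation n
  factorial-valuation = <-rec FactorialValuation go
    where
    go : ∀ n → (∀ {m} → m ℕ.< n → FactorialValuation m) → FactorialValuation n
    go zero      rec = 0 , 1 , refl , p∤1 , z≤n
    go n@(suc _) rec =
      let m = n DivMod./ p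
          r = n DivMod.% p
          v , w₁ , eq₁ , p∤w₁ , v≤ = rec (DivMod.m/n<m n p 1<p)
          w₂ , eq₂ , p∤w₂ = factorial-multiple m
          w₃ , eq₃ , p∤w₃ = factorial-remainder m r (DivMod.m%n<n n p)
          n≡ = trans (DivMod.m≡m%n+[m/n]*n n p)
                 (trans (ℕProps.+-comm r (m ℕ.* p)) (cong (ℕ._+ r) (ℕProps.*-comm m p)))
      in m ℕ.+ v , w₁ ℕ.* w₂ ℕ.* w₃ , (begin
           n !                                               ≡⟨ cong _! n≡ ⟩
           (p ℕ.* m ℕ.+ r) !                                 ≡⟨ eq₃ ⟩
           (p ℕ.* m) ! ℕ.* w₃                                ≡⟨ cong (ℕ._* w₃) eq₂ ⟩
           p ℕ.^ m ℕ.* m ! ℕ.* w₂ ℕ.* w₃                     ≡⟨ cong (λ f → p ℕ.^ m ℕ.* f ℕ.* w₂ ℕ.* w₃) eq₁ ⟩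
           p ℕ.^ m ℕ.* (p ℕ.^ v ℕ.* w₁) ℕ.* w₂ ℕ.* w₃
             ≡⟨ ℕSolver.solve 5 (λ P Q a b c →
                  P ℕSolver.:* (Q ℕSolver.:* a) ℕSolver.:* b ℕSolver.:* c ℕSolver.:=
                  P ℕSolver.:* Q ℕSolver.:* (a ℕSolver.:* b ℕSolver.:* c)) refl (p ℕ.^ m) (p ℕ.^ v) w₁ w₂ w₃ ⟩
           p ℕ.^ m ℕ.* p ℕ.^ v ℕ.* (w₁ ℕ.* w₂ ℕ.* w₃)
             ≡⟨ cong (ℕ._* (w₁ ℕ.* w₂ ℕ.* w₃)) (sym (ℕProps.^-distribˡ-+-* p m v)) ⟩
           p ℕ.^ (m ℕ.+ v) ℕ.* (w₁ ℕ.* w₂ ℕ.* w₃) ∎) ,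
         p∤* (p∤* p∤w₁ p∤w₂) p∤w₃ ,
         subst (ℕ._≤ ⌊ n /2⌋) (sym (ℕProps.n≡⌊n+n/2⌋ (m ℕ.+ v))) (ℕProps.⌊n/2⌋-mono
           (estimate m v v≤ (subst (p ℕ.* m ℕ.≤_) (sym n≡) (ℕProps.m≤m+n (p ℕ.* m) r))))
      where
      -- 2(m + v) ≤ 2m + m = 3m ≤ pm ≤ n; here p ≥ 3 is used.
      estimate : ∀ m v → v ℕ.≤ ⌊ m /2⌋ → p ℕ.* m ℕ.≤ n → (m ℕ.+ v) ℕ.+ (m ℕ.+ v) ℕ.≤ n
      estimate m v v≤ pm≤n = ℕProps.≤-trans (ℕProps.≤-reflexive
          (ℕSolver.solve 2 (λ m v → (m ℕSolver.:+ v) ℕSolver.:+ (m ℕSolver.:+ v) ℕSolver.:=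
             m ℕSolver.:+ (m ℕSolver.:+ (v ℕSolver.:+ v))) refl m v))
        (ℕProps.≤-trans (ℕProps.+-monoʳ-≤ m (ℕProps.+-monoʳ-≤ m 2v≤m))
          (ℕProps.≤-trans (ℕProps.*-monoˡ-≤ m 2<p) pm≤n))
        where
        2v≤m : v ℕ.+ v ℕ.≤ m ℕ.+ 0
        2v≤m = subst (v ℕ.+ v ℕ.≤_) (trans (ℕProps.⌊n/2⌋+⌈n/2⌉≡n m) (sym (ℕProps.+-identityʳ m)))
          (ℕProps.+-mono-≤ v≤ (ℕProps.≤-trans v≤ (ℕProps.⌊n/2⌋≤⌈n/2⌉ m)))

  1/!-tame : Tame (λ i → 1/ i !)
  1/!-tame n = let v , w , eq , p∤w , v≤ = factorial-valuation n in
    Bound-mono v≤ (fraction (+ 1) w p∤w (begin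
      fromℕ (p ℕ.^ v) ℚ.* 1/ n ! ℚ.* fromℕ w
        ≡⟨ solve 3 (λ P i w → P :* i :* w := i :* (P :* w)) refl (fromℕ (p ℕ.^ v)) (1/ n !) (fromℕ w) ⟩
      1/ n ! ℚ.* (fromℕ (p ℕ.^ v) ℚ.* fromℕ w)  ≡⟨ cong (1/ n ! ℚ.*_) (fromℕ-* (p ℕ.^ v) w) ⟩
      1/ n ! ℚ.* fromℕ (p ℕ.^ v ℕ.* w)          ≡⟨ cong (λ m → 1/ n ! ℚ.* fromℕ m) eq ⟨
      1/ n ! ℚ.* fromℕ (n !)                    ≡⟨ factorial-inverse n ⟩
      1ℚ ∎))

  mutual
    sinᶜ-integral : ∀ n → ∣ sinᶜ n ∣≤p^- 0
    sinᶜ-integral zero    = zero-≤ 0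
    sinᶜ-integral (suc n) = cosᶜ-integral n

    cosᶜ-integral : ∀ n → ∣ cosᶜ n ∣≤p^- 0
    cosᶜ-integral zero    = fromℕ-≤ 1
    cosᶜ-integral (suc n) = neg-≤ (sinᶜ-integral n)

  ½-integral : ∣ ½ ∣≤p^- 0
  ½-integral = fraction (+ 1) 2 (ℕ∣.>⇒∤ 2<p) refl

  -- The scalar `x` stays inside the hypothesis because single products need not be integral: in
  -- `E-integral` only (n + 1)! times such a product is.
  ⊛-≤ : ∀ n {x f g k} → (∀ i j → i ℕ.+ j ≡ n → ∣ x ℚ.* (f i ℚ.* g j) ∣≤p^- k) →
        ∣ x ℚ.* (f ⊛ g) n ∣≤p^- k
  ⊛-≤ zero    {x} {f} {g} {k} fg≤ = subst (∣_∣≤p^- k)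
    (cong (x ℚ.*_) (sym (ℚProps.+-identityʳ (f 0 ℚ.* g 0)))) (fg≤ 0 0 refl)
  ⊛-≤ (suc n) {x} {f} {g} {k} fg≤ = subst (∣_∣≤p^- k)
    (sym (ℚProps.*-distribˡ-+ x (f 0 ℚ.* g (suc n)) (((f ∘ suc) ⊛ g) n)))
    (+-≤ (fg≤ 0 (suc n) refl) (⊛-≤ n {x} {f ∘ suc} (λ i j eq → fg≤ (suc i) j (cong suc eq))))

  -- The recurrence reads E (n + 1) = -½ Σ binom(n + 1, i + 1) E j over i + j = n, so the only
  -- denominators are powers of 2, which are prime to p.
  E-integral : ∀ n → ∣ E n ∣≤p^- 0
  E-integral = <-rec (λ n → ∣ E n ∣≤p^- 0) go
    where
    go : ∀ n → (∀ {m} → m ℕ.< n → ∣ E m ∣≤p^- 0) → ∣ E n ∣≤p^- 0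
    go zero    rec = fromℕ-≤ 1
    go (suc n) rec = subst (∣_∣≤p^- 0) (sym (E-recurrence n)) (*-≤ (neg-≤ ½-integral)
      (⊛-≤ n {fromℕ (suc n !)} {λ i → expSeries (suc i)} {eulerᶜ} λ i j i+j≡n → binomial i j i+j≡n
        (k![n∸k]!∣n! {suc n} {suc i} (s≤s (subst (i ℕ.≤_) i+j≡n (ℕProps.m≤m+n i j))))))
      where
      binomial : ∀ i j → i ℕ.+ j ≡ n → suc i ! ℕ.* (suc n ℕ.∸ suc i) ! ∣ suc n ! →
                 ∣ fromℕ (suc n !) ℚ.* (1/ suc i ! ℚ.* eulerᶜ j) ∣≤p^- 0
      -- The quotient `c` of the divisibility is the binomial coefficient binom(n + 1, i + 1).
      binomial i j i+j≡n (ℕ∣.divides c eq) = subst (∣_∣≤p^- 0) (begin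
          fromℕ c ℚ.* E j
            ≡⟨ solve 2 (λ c e → c :* e := c :* (con 1ℚ :* con 1ℚ) :* e) refl (fromℕ c) (E j) ⟩
          fromℕ c ℚ.* (1ℚ ℚ.* 1ℚ) ℚ.* E j
            ≡⟨ cong₂ (λ u v → fromℕ c ℚ.* (u ℚ.* v) ℚ.* E j) (factorial-inverse (suc i)) (factorial-inverse j) ⟨
          fromℕ c ℚ.* (1/ suc i ! ℚ.* fromℕ (suc i !) ℚ.* (1/ j ! ℚ.* fromℕ (j !))) ℚ.* E j
            ≡⟨ solve 6 (λ c a A b B e → c :* (a :* A :* (b :* B)) :* e := c :* (A :* B) :* (a :* (b :* e))) refl
                 (fromℕ c) (1/ suc i !) (fromℕ (suc i !)) (1/ j !) (fromℕ (j !)) (E j) ⟩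
          fromℕ c ℚ.* (fromℕ (suc i !) ℚ.* fromℕ (j !)) ℚ.* (1/ suc i ! ℚ.* eulerᶜ j)
            ≡⟨ cong (ℚ._* (1/ suc i ! ℚ.* eulerᶜ j)) (begin
                 fromℕ c ℚ.* (fromℕ (suc i !) ℚ.* fromℕ (j !))
                   ≡⟨ cong (fromℕ c ℚ.*_) (fromℕ-* (suc i !) (j !)) ⟩
                 fromℕ c ℚ.* fromℕ (suc i ! ℕ.* j !)
                   ≡⟨ fromℕ-* c (suc i ! ℕ.* j !) ⟩
                 fromℕ (c ℕ.* (suc i ! ℕ.* j !))
                   ≡⟨ cong (λ l → fromℕ (c ℕ.* (suc i ! ℕ.* l !)))
                        (trans (sym (ℕProps.m+n∸m≡n i j)) (cong (ℕ._∸ i) i+j≡n)) ⟩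
                 fromℕ (c ℕ.* (suc i ! ℕ.* (n ℕ.∸ i) !))
                   ≡⟨ cong fromℕ eq ⟨
                 fromℕ (suc n !) ∎) ⟩
          fromℕ (suc n !) ℚ.* (1/ suc i ! ℚ.* eulerᶜ j) ∎)
        (*-≤ (fromℕ-≤ c) (rec (s≤s (subst (j ℕ.≤_) i+j≡n (ℕProps.m≤n+m j i)))))

  divisible⇒∣∣≤1 : ∀ {r u d} → ¬ (p ∣ d) → r ℚ.* fromℕ d ≡ fromℤ u ℚ.* fromℕ (p ℕ.^ 0) → p ∣ ℤ.∣ u ∣ → ∣ r ∣≤p^- 1
  divisible⇒∣∣≤1 {r} {u} {d} p∤d r≡ p∣u with ℤ∣.∣ᵤ⇒∣ {+ p} {u} p∣u
  ... | ℤ∣.divides q u≡ = fraction q d p∤d (begin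
    r ℚ.* fromℕ d                   ≡⟨ trans r≡ (ℚProps.*-identityʳ (fromℤ u)) ⟩
    fromℤ u                         ≡⟨ cong fromℤ u≡ ⟩
    fromℤ (q ℤ.* + p)               ≡⟨ fromℤ-* q (+ p) ⟨
    fromℤ q ℚ.* fromℕ p             ≡⟨ cong (λ n → fromℤ q ℚ.* fromℕ n) (ℕProps.*-identityʳ p) ⟨
    fromℤ q ℚ.* fromℕ (p ℕ.^ 1) ∎)

  -- Clearing denominators gives u v f = w d e p with f prime to p, so p divides u v and Euclid's
  -- lemma applies to the numerators: p generates a prime ideal.
  ball-prime : ∀ {r s} → ∣ r ∣≤p^- 0 → ∣ s ∣≤p^- 0 → ∣ r ℚ.* s ∣≤p^- 1 → ∣ r ∣≤p^- 1 ⊎ ∣ s ∣≤p^- 1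
  ball-prime {r} {s} (fraction u d p∤d r≡) (fraction v e p∤e s≡) (fraction w f p∤f rs≡) =
    Sum.map (divisible⇒∣∣≤1 {u = u} p∤d r≡) (divisible⇒∣∣≤1 {u = v} p∤e s≡) (euclidsLemma ℤ.∣ u ∣ ℤ.∣ v ∣ p-prime p∣uv)
    where
    numerators : u ℤ.* v ℤ.* + f ≡ w ℤ.* + (d ℕ.* e) ℤ.* + p
    numerators = fromℤ-injective {u ℤ.* v ℤ.* + f} {w ℤ.* + (d ℕ.* e) ℤ.* + p} (begin
      fromℤ (u ℤ.* v ℤ.* + f)
        ≡⟨ trans (cong (ℚ._* fromℕ f) (fromℤ-* u v)) (fromℤ-* (u ℤ.* v) (+ f)) ⟨
      fromℤ u ℚ.* fromℤ v ℚ.* fromℕ f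
        ≡⟨ solve 3 (λ u v f → u :* v :* f := u :* con 1ℚ :* (v :* con 1ℚ) :* f) refl (fromℤ u) (fromℤ v) (fromℕ f) ⟩
      fromℤ u ℚ.* 1ℚ ℚ.* (fromℤ v ℚ.* 1ℚ) ℚ.* fromℕ f
        ≡⟨ cong₂ (λ a b → a ℚ.* b ℚ.* fromℕ f) r≡ s≡ ⟨
      r ℚ.* fromℕ d ℚ.* (s ℚ.* fromℕ e) ℚ.* fromℕ f
        ≡⟨ solve 5 (λ r d s e f → r :* d :* (s :* e) :* f := r :* s :* f :* (d :* e)) refl
             r (fromℕ d) s (fromℕ e) (fromℕ f) ⟩
      r ℚ.* s ℚ.* fromℕ f ℚ.* (fromℕ d ℚ.* fromℕ e)
        ≡⟨ cong₂ ℚ._*_ rs≡ (fromℕ-* d e) ⟩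
      fromℤ w ℚ.* fromℕ (p ℕ.^ 1) ℚ.* fromℕ (d ℕ.* e)
        ≡⟨ cong (λ q → fromℤ w ℚ.* fromℕ q ℚ.* fromℕ (d ℕ.* e)) (ℕProps.*-identityʳ p) ⟩
      fromℤ w ℚ.* fromℕ p ℚ.* fromℕ (d ℕ.* e)
        ≡⟨ solve 3 (λ w p d → w :* p :* d := w :* d :* p) refl (fromℤ w) (fromℕ p) (fromℕ (d ℕ.* e)) ⟩
      fromℤ w ℚ.* fromℕ (d ℕ.* e) ℚ.* fromℕ p
        ≡⟨ trans (cong (ℚ._* fromℕ p) (fromℤ-* w (+ (d ℕ.* e)))) (fromℤ-* (w ℤ.* + (d ℕ.* e)) (+ p)) ⟩
      fromℤ (w ℤ.* + (d ℕ.* e) ℤ.* + p) ∎)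
    p∣ : p ∣ ℤ.∣ u ∣ ℕ.* ℤ.∣ v ∣ ℕ.* f
    p∣ = subst (p ∣_) (trans (ℤProps.abs-* (u ℤ.* v) (+ f)) (cong (ℕ._* f) (ℤProps.abs-* u v)))
           (ℤ∣.∣⇒∣ᵤ (ℤ∣.divides (w ℤ.* + (d ℕ.* e)) numerators))
    p∣uv : p ∣ ℤ.∣ u ∣ ℕ.* ℤ.∣ v ∣
    p∣uv = Sum.[ id , (λ p∣f → ⊥-elim (p∤f p∣f)) ] (euclidsLemma (ℤ.∣ u ∣ ℕ.* ℤ.∣ v ∣) f p-prime p∣)

  ¬∣1∣≤p^-1 : ¬ (∣ 1ℚ ∣≤p^- 1)
  ¬∣1∣≤p^-1 (fraction u d p∤d 1≡) = p∤d (subst (λ n → p ∣ n) refl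
    (ℤ∣.∣⇒∣ᵤ (ℤ∣.divides u (fromℤ-injective {+ d} {u ℤ.* + p} (begin
      fromℕ d                         ≡⟨ ℚProps.*-identityˡ (fromℕ d) ⟨
      1ℚ ℚ.* fromℕ d                  ≡⟨ 1≡ ⟩
      fromℤ u ℚ.* fromℕ (p ℕ.^ 1)     ≡⟨ cong (λ q → fromℤ u ℚ.* fromℕ q) (ℕProps.*-identityʳ p) ⟩
      fromℤ u ℚ.* fromℕ p             ≡⟨ fromℤ-* u (+ p) ⟩
      fromℤ (u ℤ.* + p) ∎)))))

  ^^-integral : ∀ {r} → ∣ r ∣≤p^- 0 → ∀ n → ∣ r ^^ n ∣≤p^- 0
  ^^-integral r≤ zero    = fromℕ-≤ 1
  ^^-integral r≤ (suc n) = *-≤ r≤ (^^-integral r≤ n)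

  root-≤ : ∀ {r} → ∣ r ∣≤p^- 0 → ∀ n → ∣ r ^^ n ∣≤p^- 1 → ∣ r ∣≤p^- 1
  root-≤ r≤ zero    rⁿ≤ = ⊥-elim (¬∣1∣≤p^-1 rⁿ≤)
  root-≤ r≤ (suc n) rⁿ≤ = Sum.[ id , root-≤ r≤ n ] (ball-prime r≤ (^^-integral r≤ n) rⁿ≤)

  seq-^ : ∀ x m n → seq (x ^ m) n ≡ seq x n ^^ m
  seq-^ x zero    n = refl
  seq-^ x (suc m) n = cong (seq x n ℚ.*_) (seq-^ x m n)

  sum-last-≤ : ∀ s {l k n} → ∥ sum s n - l ∥≤p^- k → ∥ sum s (suc n) - l ∥≤p^- k → ∥ s n ∥≤p^- k
  sum-last-≤ s {l} {k} {n} (K , sₙ≤) (L , sₙ₊₁≤) = K ℕ.⊔ L , λ m N≤m → subst (∣_∣≤p^- k)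
    (solve 3 (λ a t l → ((a :+ t) :- l) :+ :- (a :- l) := t) refl (seq (sum s n) m) (seq (s n) m) (seq l m))
    (+-≤ (sₙ₊₁≤ m (ℕProps.m⊔n≤o⇒n≤o K L N≤m)) (neg-≤ (sₙ≤ m (ℕProps.m⊔n≤o⇒m≤o K L N≤m))))

  -- The terms of the sine series of a unit do not tend to 0.
  summable⇒small : ∀ (a : ℤₚ) → Summable (sinTerms (val a)) → ∥ val a ∥≤p^- 1
  summable⇒small a (l , converges) =
    let K , close = converges 1
        L , tₖ≤   = sum-last-≤ (sinTerms (val a)) {l} {n = K} (close K ℕProps.≤-refl) (close (suc K) (ℕProps.n≤1+n K))
        M , a≤    = integral a
        e         = 1 ℕ.+ 2 ℕ.* K
    -- A single term with absolute value at most p⁻¹ suffices. Multiplying it by the integer ± e!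
    -- leaves aᵉ, hence |aᵉ| ≤ p⁻¹, and an integral root of such a power is itself small.
    in L ℕ.⊔ M , λ n N≤n → root-≤ (a≤ n (ℕProps.m⊔n≤o⇒n≤o L M N≤n)) e (subst (∣_∣≤p^- 1)
      (begin
        c K ℚ.* fromℕ (e !) ℚ.* (c K ℚ.* 1/ e ! ℚ.* seq (val a ^ e) n)
          ≡⟨ solve 4 (λ c d i r → c :* d :* (c :* i :* r) := (c :* c) :* (i :* d) :* r) refl
               (c K) (fromℕ (e !)) (1/ e !) (seq (val a ^ e) n) ⟩
        (c K ℚ.* c K) ℚ.* (1/ e ! ℚ.* fromℕ (e !)) ℚ.* seq (val a ^ e) n
          ≡⟨ cong₂ (λ u v → u ℚ.* v ℚ.* seq (val a ^ e) n) (c² K) (factorial-inverse e) ⟩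
        1ℚ ℚ.* 1ℚ ℚ.* seq (val a ^ e) n  ≡⟨ solve 1 (λ r → con 1ℚ :* con 1ℚ :* r := r) refl (seq (val a ^ e) n) ⟩
        seq (val a ^ e) n                ≡⟨ seq-^ (val a) e n ⟩
        seq (val a) n ^^ e ∎)
      (*-≤ (*-≤ {c K} {k = 0} (subst (∣_∣≤p^- 0) (cosᶜ-even K) (cosᶜ-integral (2 ℕ.* K))) (fromℕ-≤ (e !)))
           (tₖ≤ n (ℕProps.m⊔n≤o⇒m≤o L M N≤n))))
    where
    c : ℕ → ℚ
    c n = fromℤ (-1ℤ ℤ.^ n)
    c² : ∀ n → c n ℚ.* c n ≡ 1ℚ
    c² zero    = refl
    c² (suc n) = trans (cong₂ ℚ._*_ (fromℤ--1^suc n) (fromℤ--1^suc n))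
      (trans (solve 1 (λ x → :- x :* :- x := x :* x) refl (c n)) (c² n))

  -- The series for sin, cos and the Euler numbers list only odd or only even exponents, whereas
  -- `eval` runs through all of them. Pairing exponents 2i and 2i + 1, one of which contributes
  -- zero, makes i terms of `s` match 2i terms of the power series.
  paired-hasSum : ∀ {b} (tame : Tame b) x (x≤ : ∥ x ∥≤p^- 1) s →
    (∀ i n → seq (s i) n ≡ term b (seq x n) (2 ℕ.* i) ℚ.+ term b (seq x n) (1 ℕ.+ 2 ℕ.* i)) →
    HasSum s (eval b tame x x≤)
  -- The index n is kept at least 2i, so that the n-th partial sum in `eval` extends the one of
  -- length 2i, and i ≥ k makes the tail beyond 2i at most p⁻ᵏ.
  paired-hasSum {b} tame x (M , x≤) s s≡ k = k , λ i k≤i → M ℕ.⊔ (2 ℕ.* i) , λ n N≤n →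
    subst (∣_∣≤p^- k)
      (begin
        ℚ.- (partial b n (seq x n) ℚ.- partial b (2 ℕ.* i) (seq x n))
          ≡⟨ solve 2 (λ a b → :- (a :- b) := b :- a) refl (partial b n (seq x n)) (partial b (2 ℕ.* i) (seq x n)) ⟩
        partial b (2 ℕ.* i) (seq x n) ℚ.- partial b n (seq x n)
          ≡⟨ cong (ℚ._- partial b n (seq x n)) (sum≡ n i) ⟨
        seq (sum s i) n ℚ.- partial b n (seq x n) ∎)
      (neg-≤ (partial-tail tame (x≤ n (ℕProps.m⊔n≤o⇒m≤o M (2 ℕ.* i) N≤n)) {k} {2 ℕ.* i}
        (ℕProps.≤-trans (ℕProps.+-mono-≤ k≤i k≤i) (ℕProps.≤-reflexive (cong (i ℕ.+_) (sym (ℕProps.+-identityʳ i)))))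
        (ℕProps.m⊔n≤o⇒n≤o M (2 ℕ.* i) N≤n)))
    where
    sum≡ : ∀ n i → seq (sum s i) n ≡ partial b (2 ℕ.* i) (seq x n)
    sum≡ n zero    = refl
    sum≡ n (suc i) = begin
      seq (sum s i) n ℚ.+ seq (s i) n  ≡⟨ cong₂ ℚ._+_ (sum≡ n i) (s≡ i n) ⟩
      partial b (2 ℕ.* i) (seq x n) ℚ.+ (t (2 ℕ.* i) ℚ.+ t (1 ℕ.+ 2 ℕ.* i))
        ≡⟨ ℚProps.+-assoc (partial b (2 ℕ.* i) (seq x n)) (t (2 ℕ.* i)) (t (1 ℕ.+ 2 ℕ.* i)) ⟨
      partial b (2 ℕ.* i) (seq x n) ℚ.+ t (2 ℕ.* i) ℚ.+ t (1 ℕ.+ 2 ℕ.* i)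
        ≡⟨ cong (ℚ._+ t (1 ℕ.+ 2 ℕ.* i)) (∑-last (2 ℕ.* i) t) ⟨
      partial b (1 ℕ.+ 2 ℕ.* i) (seq x n) ℚ.+ t (1 ℕ.+ 2 ℕ.* i)
        ≡⟨ ∑-last (1 ℕ.+ 2 ℕ.* i) t ⟨
      partial b (2 ℕ.+ 2 ℕ.* i) (seq x n)
        ≡⟨ cong (λ m → partial b m (seq x n)) (2*suc i) ⟨
      partial b (2 ℕ.* suc i) (seq x n) ∎
      where t = term b (seq x n)

  eulerᶜ-tame : Tame eulerᶜ
  eulerᶜ-tame i = subst (Bound ⌊ i /2⌋) (ℚProps.*-comm (E i) (1/ i !)) (tame-*ˡ E-integral 1/!-tame i)

  -eulerᶜ-tame : Tame -eulerᶜ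
  -eulerᶜ-tame = tame-*ˡ (λ _ → neg-≤ (fromℕ-≤ 1)) eulerᶜ-tame

  sinᵇ-tame : Tame sinᵇ
  sinᵇ-tame = tame-*ˡ sinᶜ-integral 1/!-tame

  cosᵇ-tame : Tame cosᵇ
  cosᵇ-tame = tame-*ˡ cosᶜ-integral 1/!-tame

  eulerSinᵇ-tame : Tame eulerSinᵇ
  eulerSinᵇ-tame = tame-*ˡ sinᶜ-integral -eulerᶜ-tame

  eulerCosᵇ-tame : Tame eulerCosᵇ
  eulerCosᵇ-tame = tame-*ˡ cosᶜ-integral -eulerᶜ-tame

  sin-hasSum : ∀ x x≤ → IsSin x (eval sinᵇ sinᵇ-tame x x≤)
  sin-hasSum x x≤ = paired-hasSum sinᵇ-tame x x≤ (sinTerms x) λ i n → begin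
    fromℤ (-1ℤ ℤ.^ i) ℚ.* 1/ (1 ℕ.+ 2 ℕ.* i) ! ℚ.* seq (x ^ (1 ℕ.+ 2 ℕ.* i)) n
      ≡⟨ cong₂ (λ c y → c ℚ.* 1/ (1 ℕ.+ 2 ℕ.* i) ! ℚ.* y) (sym (cosᶜ-even i)) (seq-^ x (1 ℕ.+ 2 ℕ.* i) n) ⟩
    t n (1 ℕ.+ 2 ℕ.* i)
      ≡⟨ solve 3 (λ s f y → y := con 0ℚ :* s :* f :+ y) refl (1/ (2 ℕ.* i) !) (seq x n ^^ (2 ℕ.* i)) (t n (1 ℕ.+ 2 ℕ.* i)) ⟩
    0ℚ ℚ.* 1/ (2 ℕ.* i) ! ℚ.* seq x n ^^ (2 ℕ.* i) ℚ.+ t n (1 ℕ.+ 2 ℕ.* i)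
      ≡⟨ cong (λ s → s ℚ.* 1/ (2 ℕ.* i) ! ℚ.* seq x n ^^ (2 ℕ.* i) ℚ.+ t n (1 ℕ.+ 2 ℕ.* i)) (sinᶜ-even i) ⟨
    t n (2 ℕ.* i) ℚ.+ t n (1 ℕ.+ 2 ℕ.* i) ∎
    where t = λ n → term sinᵇ (seq x n)

  cos-hasSum : ∀ x x≤ → IsCos x (eval cosᵇ cosᵇ-tame x x≤)
  cos-hasSum x x≤ = paired-hasSum cosᵇ-tame x x≤ (cosTerms x) λ i n → begin
    fromℤ (-1ℤ ℤ.^ i) ℚ.* 1/ (2 ℕ.* i) ! ℚ.* seq (x ^ (2 ℕ.* i)) n
      ≡⟨ cong₂ (λ c y → c ℚ.* 1/ (2 ℕ.* i) ! ℚ.* y) (sym (cosᶜ-even i)) (seq-^ x (2 ℕ.* i) n) ⟩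
    t n (2 ℕ.* i)
      ≡⟨ solve 3 (λ s f y → y := y :+ :- con 0ℚ :* s :* f) refl
           (1/ (1 ℕ.+ 2 ℕ.* i) !) (seq x n ^^ (1 ℕ.+ 2 ℕ.* i)) (t n (2 ℕ.* i)) ⟩
    t n (2 ℕ.* i) ℚ.+ ℚ.- 0ℚ ℚ.* 1/ (1 ℕ.+ 2 ℕ.* i) ! ℚ.* seq x n ^^ (1 ℕ.+ 2 ℕ.* i)
      ≡⟨ cong (λ s → t n (2 ℕ.* i) ℚ.+ ℚ.- s ℚ.* 1/ (1 ℕ.+ 2 ℕ.* i) ! ℚ.* seq x n ^^ (1 ℕ.+ 2 ℕ.* i)) (sinᶜ-even i) ⟨
    t n (2 ℕ.* i) ℚ.+ t n (1 ℕ.+ 2 ℕ.* i) ∎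
    where t = λ n → term cosᵇ (seq x n)

  euler-hasSum : ∀ x x≤ → HasSum (eulerTerms x) (eval eulerSinᵇ eulerSinᵇ-tame x x≤)
  euler-hasSum x x≤ = paired-hasSum eulerSinᵇ-tame x x≤ (eulerTerms x) λ i n → let e = 1 ℕ.+ 2 ℕ.* i in begin
    fromℤ (-1ℤ ℤ.^ (i ℕ.+ 1)) ℚ.* 1/ e ! ℚ.* E e ℚ.* seq (x ^ e) n
      ≡⟨ cong₂ (λ c y → c ℚ.* 1/ e ! ℚ.* E e ℚ.* y)
           (trans (cong (λ m → fromℤ (-1ℤ ℤ.^ m)) (ℕProps.+-comm i 1))
             (trans (fromℤ--1^suc i) (cong ℚ.-_ (sym (cosᶜ-even i)))))
           (seq-^ x e n) ⟩
    ℚ.- sinᶜ e ℚ.* 1/ e ! ℚ.* E e ℚ.* seq x n ^^ e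
      ≡⟨ solve 6 (λ s f e y b d → :- s :* f :* e :* y := con 0ℚ :* b :* d :+ s :* (con (ℚ.- 1ℚ) :* (f :* e)) :* y) refl
           (sinᶜ e) (1/ e !) (E e) (seq x n ^^ e) (-eulerᶜ (2 ℕ.* i)) (seq x n ^^ (2 ℕ.* i)) ⟩
    0ℚ ℚ.* -eulerᶜ (2 ℕ.* i) ℚ.* seq x n ^^ (2 ℕ.* i) ℚ.+ term eulerSinᵇ (seq x n) e
      ≡⟨ cong (λ s → s ℚ.* -eulerᶜ (2 ℕ.* i) ℚ.* seq x n ^^ (2 ℕ.* i) ℚ.+ term eulerSinᵇ (seq x n) e) (sinᶜ-even i) ⟨
    term eulerSinᵇ (seq x n) (2 ℕ.* i) ℚ.+ term eulerSinᵇ (seq x n) e ∎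

  geometric-tame : Tame (λ _ → 1ℚ)
  geometric-tame i = integral⇒Bound ⌊ i /2⌋ (fromℕ-≤ 1)

  geometric : ∀ n h → (1ℚ ℚ.- h) ℚ.* partial (λ _ → 1ℚ) n h ≡ 1ℚ ℚ.- h ^^ n
  geometric zero    h = solve 1 (λ h → (con 1ℚ :- h) :* con 0ℚ := con 1ℚ :- con 1ℚ) refl h
  geometric (suc n) h = begin
    (1ℚ ℚ.- h) ℚ.* partial (λ _ → 1ℚ) (suc n) h
      ≡⟨ cong ((1ℚ ℚ.- h) ℚ.*_) (∑-last n (term (λ _ → 1ℚ) h)) ⟩
    (1ℚ ℚ.- h) ℚ.* (partial (λ _ → 1ℚ) n h ℚ.+ 1ℚ ℚ.* h ^^ n)
      ≡⟨ solve 3 (λ h s y → (con 1ℚ :- h) :* (s :+ con 1ℚ :* y) := (con 1ℚ :- h) :* s :+ (con 1ℚ :- h) :* y) refl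
           h (partial (λ _ → 1ℚ) n h) (h ^^ n) ⟩
    (1ℚ ℚ.- h) ℚ.* partial (λ _ → 1ℚ) n h ℚ.+ (1ℚ ℚ.- h) ℚ.* h ^^ n
      ≡⟨ cong (ℚ._+ (1ℚ ℚ.- h) ℚ.* h ^^ n) (geometric n h) ⟩
    1ℚ ℚ.- h ^^ n ℚ.+ (1ℚ ℚ.- h) ℚ.* h ^^ n
      ≡⟨ solve 2 (λ h y → con 1ℚ :- y :+ (con 1ℚ :- h) :* y := con 1ℚ :- h :* y) refl h (h ^^ n) ⟩
    1ℚ ℚ.- h ^^ suc n ∎

  -- Integrality of the inverse is recorded because the error estimates for the integrals multiply
  -- by inverses without losing precision.
  Invertible : ℚₚ → Set
  Invertible y = ∃[ y⁻¹ ] y * y⁻¹ ≈ ι 1ℚ × ∥ y⁻¹ ∥≤p^- 0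

  -- 1 / y is u⁻¹ times the geometric series in 1 − u⁻¹ y.
  near-unit : ∀ u u⁻¹ → u ℚ.* u⁻¹ ≡ 1ℚ → ∣ u⁻¹ ∣≤p^- 0 → ∀ y → ∥ y - ι u ∥≤p^- 1 → Invertible y
  near-unit u u⁻¹ uu⁻¹≡1 u⁻¹≤ y y-u≤ = ι u⁻¹ * z , null-resp
      -- At index n the geometric sum has n terms, so y y⁻¹ - 1 equals -hⁿ there exactly, and |h| ≤
      -- p⁻¹ makes this null.
      (λ n → begin
        ℚ.- (seq h n ^^ n)
          ≡⟨ solve 1 (λ x → :- x := (con 1ℚ :- x) :- con 1ℚ) refl (seq h n ^^ n) ⟩
        (1ℚ ℚ.- seq h n ^^ n) ℚ.- 1ℚ
          ≡⟨ cong (ℚ._- 1ℚ) (geometric n (seq h n)) ⟨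
        (1ℚ ℚ.- seq h n) ℚ.* seq z n ℚ.- 1ℚ
          ≡⟨ solve 4 (λ u v y z → (con 1ℚ :- (v :* (u :- y))) :* z :- con 1ℚ :=
               (con 1ℚ :- u :* v) :* z :+ (y :* (v :* z) :- con 1ℚ)) refl u u⁻¹ (seq y n) (seq z n) ⟩
        (1ℚ ℚ.- u ℚ.* u⁻¹) ℚ.* seq z n ℚ.+ (seq y n ℚ.* (u⁻¹ ℚ.* seq z n) ℚ.- 1ℚ)
          ≡⟨ cong (λ w → (1ℚ ℚ.- w) ℚ.* seq z n ℚ.+ (seq y n ℚ.* (u⁻¹ ℚ.* seq z n) ℚ.- 1ℚ)) uu⁻¹≡1 ⟩
        (1ℚ ℚ.- 1ℚ) ℚ.* seq z n ℚ.+ (seq y n ℚ.* (u⁻¹ ℚ.* seq z n) ℚ.- 1ℚ)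
          ≡⟨ solve 2 (λ z w → (con 1ℚ :- con 1ℚ) :* z :+ w := w) refl (seq z n) (seq y n ℚ.* (u⁻¹ ℚ.* seq z n) ℚ.- 1ℚ) ⟩
        seq y n ℚ.* (u⁻¹ ℚ.* seq z n) ℚ.- 1ℚ ∎)
      powers ,
    ev-* {k = 0} (0 , λ _ _ → u⁻¹≤) (eval-integral geometric-tame h h≤)
    where
    h : ℚₚ
    h = ι u⁻¹ * (ι u - y)
    h≤ : ∥ h ∥≤p^- 1
    h≤ = let N , y-u≤ₙ = y-u≤ in N , λ n N≤n → *-≤ u⁻¹≤ (subst (∣_∣≤p^- 1)
      (solve 2 (λ y u → :- (y :- u) := u :- y) refl (seq y n) u) (neg-≤ (y-u≤ₙ n N≤n)))
    z : ℚₚ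
    z = eval (λ _ → 1ℚ) geometric-tame h h≤
    powers : Null (λ n → ℚ.- (seq h n ^^ n))
    powers k = let N , h≤ₙ = h≤ in N ℕ.⊔ k , λ n M≤n →
      neg-≤ (∣∣-mono (ℕProps.m⊔n≤o⇒n≤o N k M≤n) (^^-≤ (h≤ₙ n (ℕProps.m⊔n≤o⇒m≤o N k M≤n)) n))

-- Sine, cosine and the generating function of the Euler numbers

module Trigonometry (p : ℕ) (p-prime : Prime p) (p≢2 : p ≢ 2) where
  open Padic p p-prime
  open Analysis p p-prime
  open Arithmetic p p-prime p≢2

  Small : ℚₚ → Set
  Small x = ∥ x ∥≤p^- 1

  sinₚ cosₚ : ∀ x → Small x → ℚₚ
  sinₚ = eval sinᵇ sinᵇ-tame
  cosₚ = eval cosᵇ cosᵇ-tame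

  eval-≡ : ∀ {b} (tame : Tame b) x y {x≤ y≤} → (∀ n → seq x n ≡ seq y n) →
           eval b tame x x≤ ≈ eval b tame y y≤
  eval-≡ {b} tame x y x≡y = null-zero λ n →
    trans (cong (λ r → partial b n r ℚ.- partial b n (seq y n)) (x≡y n)) (ℚProps.+-inverseʳ (partial b n (seq y n)))

  partial-0 : ∀ b n → partial b (suc n) 0ℚ ≡ b 0
  partial-0 b n = trans
    (cong₂ ℚ._+_ (ℚProps.*-identityʳ (b 0))
      (trans (∑-cong n λ i → trans (cong (b (suc i) ℚ.*_) (ℚProps.*-zeroˡ (0ℚ ^^ i))) (ℚProps.*-zeroʳ (b (suc i)))) (∑-0 n)))
    (ℚProps.+-identityʳ (b 0))

  -- The Lipschitz estimate between x and 0. It yields C ≡ 1 modulo p, and sin aM → 0 and cos aM → 1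
  -- for M = p^N.
  eval-near-0 : ∀ {b k} (tame : Tame b) x (x≤ : Small x) → ∥ x ∥≤p^- k →
                ∥ eval b tame x x≤ - ι (b 0) ∥≤p^- k
  -- Indices start at 1: the empty partial sum at index 0 does not contain `b 0`.
  eval-near-0 {b} {k} tame x (M , x≤) (N , x≤k) = suc (M ℕ.⊔ N) , λ
    { (suc n) (s≤s N≤n) → subst (λ c → ∣ partial b (suc n) (seq x (suc n)) ℚ.- c ∣≤p^- k) (partial-0 b n)
        (partial-lipschitz (suc n) tame
          (x≤ (suc n) (ℕProps.m≤n⇒m≤1+n (ℕProps.m⊔n≤o⇒m≤o M N N≤n))) (zero-≤ 1)
          (subst (∣_∣≤p^- k) (sym (ℚProps.+-identityʳ (seq x (suc n))))
            (x≤k (suc n) (ℕProps.m≤n⇒m≤1+n (ℕProps.m⊔n≤o⇒n≤o M N N≤n))))) }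

  -- The convolutions of the two products add up to the imaginary part of the coefficients of e^(ix)
  -- e^(iy), by `sinᶜ-⊛` and `dpow-+`. This is exact at every degree, so only the tails of two
  -- Cauchy products remain.
  sin-+ : ∀ x y {x≤ y≤ x+y≤} → sinₚ (x + y) x+y≤ ≈ sinₚ x x≤ * cosₚ y y≤ + cosₚ x x≤ * sinₚ y y≤
  sin-+ x y {x≤} {y≤} = null-resp
    (λ n → begin
      ℚ.- (products (seq x n) (seq y n) n ℚ.+ products′ (seq x n) (seq y n) n)
        ≡⟨ solve 4 (λ u v A B → :- ((u :- A) :+ (v :- B)) := (A :+ B) :- (u :+ v)) refl
             (sin n (seq x n) ℚ.* cos n (seq y n)) (cos n (seq x n) ℚ.* sin n (seq y n)) (∑ n (A (seq x n) (seq y n))) (∑ n (B (seq x n) (seq y n))) ⟩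
      (∑ n (A (seq x n) (seq y n)) ℚ.+ ∑ n (B (seq x n) (seq y n))) ℚ.- value n
        ≡⟨ cong (ℚ._- value n) (trans (∑-+ n (A (seq x n) (seq y n)) (B (seq x n) (seq y n))) (∑-cong n (coefficient (seq x n) (seq y n)))) ⟩
      sin n (seq x n ℚ.+ seq y n) ℚ.- value n ∎)
    (null-neg (null-+ (eval-product sinᵇ-tame cosᵇ-tame x y x≤ y≤) (eval-product cosᵇ-tame sinᵇ-tame x y x≤ y≤)))
    where
    sin cos : ℕ → ℚ → ℚ
    sin = partial sinᵇ
    cos = partial cosᵇ
    A B : ℚ → ℚ → PowerSeries
    A r s = term sinᵇ r ⊛ term cosᵇ s
    B r s = term cosᵇ r ⊛ term sinᵇ s
    products products′ : ℚ → ℚ → ℕ → ℚ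
    products  r s n = sin n r ℚ.* cos n s ℚ.- ∑ n (A r s)
    products′ r s n = cos n r ℚ.* sin n s ℚ.- ∑ n (B r s)
    value : ℕ → ℚ
    value n = sin n (seq x n) ℚ.* cos n (seq y n) ℚ.+ cos n (seq x n) ℚ.* sin n (seq y n)
    coefficient : ∀ r s m → A r s m ℚ.+ B r s m ≡ term sinᵇ (r ℚ.+ s) m
    coefficient r s m = begin
      A r s m ℚ.+ B r s m
        ≡⟨ cong₂ ℚ._+_
             (⊛-cong m (λ i → ℚProps.*-assoc (sinᶜ i) (1/ i !) (r ^^ i)) (λ i → ℚProps.*-assoc (cosᶜ i) (1/ i !) (s ^^ i)))
             (⊛-cong m (λ i → ℚProps.*-assoc (cosᶜ i) (1/ i !) (r ^^ i)) (λ i → ℚProps.*-assoc (sinᶜ i) (1/ i !) (s ^^ i))) ⟩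
      _ ≡⟨ sinᶜ-⊛ m 0 (dpow r) (dpow s) ⟩
      sinᶜ m ℚ.* (dpow r ⊛ dpow s) m     ≡⟨ cong (sinᶜ m ℚ.*_) (dpow-+ r s m) ⟩
      sinᶜ m ℚ.* dpow (r ℚ.+ s) m        ≡⟨ ℚProps.*-assoc (sinᶜ m) (1/ m !) ((r ℚ.+ s) ^^ m) ⟨
      term sinᵇ (r ℚ.+ s) m ∎

  cos-+ : ∀ x y {x≤ y≤ x+y≤} → cosₚ (x + y) x+y≤ ≈ cosₚ x x≤ * cosₚ y y≤ - sinₚ x x≤ * sinₚ y y≤
  cos-+ x y {x≤} {y≤} = null-resp
    (λ n → begin
      ℚ.- (products (seq x n) (seq y n) n ℚ.+ ℚ.- products′ (seq x n) (seq y n) n)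
        ≡⟨ solve 4 (λ u v A B → :- ((u :- A) :+ :- (v :- B)) := (A :- B) :- (u :- v)) refl
             (cos n (seq x n) ℚ.* cos n (seq y n)) (sin n (seq x n) ℚ.* sin n (seq y n)) (∑ n (A (seq x n) (seq y n))) (∑ n (B (seq x n) (seq y n))) ⟩
      (∑ n (A (seq x n) (seq y n)) ℚ.- ∑ n (B (seq x n) (seq y n))) ℚ.- value n
        ≡⟨ cong (ℚ._- value n) (trans (∑-- n (A (seq x n) (seq y n)) (B (seq x n) (seq y n))) (∑-cong n (coefficient (seq x n) (seq y n)))) ⟩
      cos n (seq x n ℚ.+ seq y n) ℚ.- value n ∎)
    (null-neg (null-+ (eval-product cosᵇ-tame cosᵇ-tame x y x≤ y≤) (null-neg (eval-product sinᵇ-tame sinᵇ-tame x y x≤ y≤))))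
    where
    sin cos : ℕ → ℚ → ℚ
    sin = partial sinᵇ
    cos = partial cosᵇ
    A B : ℚ → ℚ → PowerSeries
    A r s = term cosᵇ r ⊛ term cosᵇ s
    B r s = term sinᵇ r ⊛ term sinᵇ s
    products products′ : ℚ → ℚ → ℕ → ℚ
    products  r s n = cos n r ℚ.* cos n s ℚ.- ∑ n (A r s)
    products′ r s n = sin n r ℚ.* sin n s ℚ.- ∑ n (B r s)
    value : ℕ → ℚ
    value n = cos n (seq x n) ℚ.* cos n (seq y n) ℚ.- sin n (seq x n) ℚ.* sin n (seq y n)
    coefficient : ∀ r s m → A r s m ℚ.- B r s m ≡ term cosᵇ (r ℚ.+ s) m
    coefficient r s m = begin
      A r s m ℚ.- B r s m
        ≡⟨ cong₂ ℚ._-_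
             (⊛-cong m (λ i → ℚProps.*-assoc (cosᶜ i) (1/ i !) (r ^^ i)) (λ i → ℚProps.*-assoc (cosᶜ i) (1/ i !) (s ^^ i)))
             (⊛-cong m (λ i → ℚProps.*-assoc (sinᶜ i) (1/ i !) (r ^^ i)) (λ i → ℚProps.*-assoc (sinᶜ i) (1/ i !) (s ^^ i))) ⟩
      _ ≡⟨ cosᶜ-⊛ m 0 (dpow r) (dpow s) ⟩
      cosᶜ m ℚ.* (dpow r ⊛ dpow s) m     ≡⟨ cong (cosᶜ m ℚ.*_) (dpow-+ r s m) ⟩
      cosᶜ m ℚ.* dpow (r ℚ.+ s) m        ≡⟨ ℚProps.*-assoc (cosᶜ m) (1/ m !) ((r ℚ.+ s) ^^ m) ⟨
      term cosᵇ (r ℚ.+ s) m ∎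

  -- Parity and the Pythagorean identity

  mutual
    sinᶜ-odd : ∀ x i → sinᶜ i ℚ.* (ℚ.- x) ^^ i ≡ ℚ.- (sinᶜ i ℚ.* x ^^ i)
    sinᶜ-odd x zero    = refl
    sinᶜ-odd x (suc i) = begin
      cosᶜ i ℚ.* (ℚ.- x ℚ.* (ℚ.- x) ^^ i)
        ≡⟨ solve 3 (λ c x y → c :* (:- x :* y) := :- (x :* (c :* y))) refl (cosᶜ i) x ((ℚ.- x) ^^ i) ⟩
      ℚ.- (x ℚ.* (cosᶜ i ℚ.* (ℚ.- x) ^^ i))
        ≡⟨ cong (λ u → ℚ.- (x ℚ.* u)) (cosᶜ-even-power x i) ⟩
      ℚ.- (x ℚ.* (cosᶜ i ℚ.* x ^^ i))
        ≡⟨ solve 3 (λ c x y → :- (x :* (c :* y)) := :- (c :* (x :* y))) refl (cosᶜ i) x (x ^^ i) ⟩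
      ℚ.- (cosᶜ i ℚ.* (x ℚ.* x ^^ i)) ∎

    cosᶜ-even-power : ∀ x i → cosᶜ i ℚ.* (ℚ.- x) ^^ i ≡ cosᶜ i ℚ.* x ^^ i
    cosᶜ-even-power x zero    = refl
    cosᶜ-even-power x (suc i) = begin
      ℚ.- sinᶜ i ℚ.* (ℚ.- x ℚ.* (ℚ.- x) ^^ i)
        ≡⟨ solve 3 (λ s x y → :- s :* (:- x :* y) := x :* (s :* y)) refl (sinᶜ i) x ((ℚ.- x) ^^ i) ⟩
      x ℚ.* (sinᶜ i ℚ.* (ℚ.- x) ^^ i)
        ≡⟨ cong (x ℚ.*_) (sinᶜ-odd x i) ⟩
      x ℚ.* ℚ.- (sinᶜ i ℚ.* x ^^ i)
        ≡⟨ solve 3 (λ s x y → x :* :- (s :* y) := :- s :* (x :* y)) refl (sinᶜ i) x (x ^^ i) ⟩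
      ℚ.- sinᶜ i ℚ.* (x ℚ.* x ^^ i) ∎

  sin-neg : ∀ x n → partial sinᵇ n (ℚ.- x) ≡ ℚ.- partial sinᵇ n x
  sin-neg x n = begin
    partial sinᵇ n (ℚ.- x)
      ≡⟨ ∑-cong n (λ i → begin
           sinᶜ i ℚ.* 1/ i ! ℚ.* (ℚ.- x) ^^ i
             ≡⟨ solve 3 (λ s f y → s :* f :* y := f :* (s :* y)) refl (sinᶜ i) (1/ i !) ((ℚ.- x) ^^ i) ⟩
           1/ i ! ℚ.* (sinᶜ i ℚ.* (ℚ.- x) ^^ i)  ≡⟨ cong (1/ i ! ℚ.*_) (sinᶜ-odd x i) ⟩
           1/ i ! ℚ.* ℚ.- (sinᶜ i ℚ.* x ^^ i)
             ≡⟨ solve 3 (λ s f y → f :* :- (s :* y) := con (ℚ.- 1ℚ) :* (s :* f :* y)) refl (sinᶜ i) (1/ i !) (x ^^ i) ⟩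
           ℚ.- 1ℚ ℚ.* term sinᵇ x i ∎) ⟩
    ∑ n (λ i → ℚ.- 1ℚ ℚ.* term sinᵇ x i)  ≡⟨ ∑-*ˡ n (ℚ.- 1ℚ) (term sinᵇ x) ⟨
    ℚ.- 1ℚ ℚ.* partial sinᵇ n x           ≡⟨ solve 1 (λ s → con (ℚ.- 1ℚ) :* s := :- s) refl (partial sinᵇ n x) ⟩
    ℚ.- partial sinᵇ n x ∎

  cos-neg : ∀ x n → partial cosᵇ n (ℚ.- x) ≡ partial cosᵇ n x
  cos-neg x n = ∑-cong n λ i → begin
    cosᶜ i ℚ.* 1/ i ! ℚ.* (ℚ.- x) ^^ i
      ≡⟨ solve 3 (λ s f y → s :* f :* y := f :* (s :* y)) refl (cosᶜ i) (1/ i !) ((ℚ.- x) ^^ i) ⟩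
    1/ i ! ℚ.* (cosᶜ i ℚ.* (ℚ.- x) ^^ i)  ≡⟨ cong (1/ i ! ℚ.*_) (cosᶜ-even-power x i) ⟩
    1/ i ! ℚ.* (cosᶜ i ℚ.* x ^^ i)
      ≡⟨ solve 3 (λ s f y → f :* (s :* y) := s :* f :* y) refl (cosᶜ i) (1/ i !) (x ^^ i) ⟩
    term cosᵇ x i ∎

  -- The addition formula for cos at x and -x, with parity; cos (x - x) is 1 because x - x is null.
  pythagoras : ∀ x x≤ → cosₚ x x≤ * cosₚ x x≤ + sinₚ x x≤ * sinₚ x x≤ ≈ ι 1ℚ
  pythagoras x x≤ = null-resp
    (λ n → begin
      C₀ n ℚ.- 1ℚ ℚ.+ ℚ.- (C₀ n ℚ.- (c n ℚ.* c⁻ n ℚ.- s n ℚ.* s⁻ n))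
        ≡⟨ cong₂ (λ u v → C₀ n ℚ.- 1ℚ ℚ.+ ℚ.- (C₀ n ℚ.- (c n ℚ.* u ℚ.- s n ℚ.* v))) (cos-neg (seq x n) n) (sin-neg (seq x n) n) ⟩
      C₀ n ℚ.- 1ℚ ℚ.+ ℚ.- (C₀ n ℚ.- (c n ℚ.* c n ℚ.- s n ℚ.* ℚ.- s n))
        ≡⟨ solve 3 (λ C c s → C :- con 1ℚ :+ :- (C :- (c :* c :- s :* :- s)) := (c :* c :+ s :* s) :- con 1ℚ) refl (C₀ n) (c n) (s n) ⟩
      (c n ℚ.* c n ℚ.+ s n ℚ.* s n) ℚ.- 1ℚ ∎)
    (null-+ (λ k → eval-near-0 cosᵇ-tame (x - x) x-x≤ (x-x-null k)) (null-neg (cos-+ x (- x) {x≤} { -x≤} {x-x≤})))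
    where
    x-x-null : Null (seq (x - x))
    x-x-null = null-zero λ n → ℚProps.+-inverseʳ (seq x n)
    x-x≤ : Small (x - x)
    x-x≤ = x-x-null 1
    -x≤ : Small (- x)
    -x≤ = let N , x≤ₙ = x≤ in N , λ n N≤n → neg-≤ (x≤ₙ n N≤n)
    c s c⁻ s⁻ C₀ : ℕ → ℚ
    c n = partial cosᵇ n (seq x n)
    s n = partial sinᵇ n (seq x n)
    c⁻ n = partial cosᵇ n (ℚ.- seq x n)
    s⁻ n = partial sinᵇ n (ℚ.- seq x n)
    C₀ n = partial cosᵇ n (seq x n ℚ.- seq x n)

  -- The Euler series and the tangent

  module _ (x : ℚₚ) (x≤ : Small x) where
    private
      S C T T′ : ℚₚ
      S = sinₚ x x≤
      C = cosₚ x x≤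
      T = eval eulerSinᵇ eulerSinᵇ-tame x x≤
      T′ = eval eulerCosᵇ eulerCosᵇ-tame x x≤

    -- With T′ + iT standing for -2 / (1 + e^(ix)), this is the real part of (1 + e^(ix)) (T′ + iT)
    -- = -2; `euler-odd` is the imaginary part. The indices again start at 1, since the constant -2
    -- is missing from the empty partial sum.
    euler-even : T′ + (C * T′ - S * T) ≈ ι (ℚ.- fromℕ 2)
    euler-even k = let N , small = products k in suc N , λ
      { (suc n) (s≤s N≤n) → subst (∣_∣≤p^- k) (begin
          (c (suc n) ℚ.* t′ (suc n) ℚ.- ∑ (suc n) (A (seq x (suc n)))) ℚ.+ ℚ.- (s (suc n) ℚ.* t (suc n) ℚ.- ∑ (suc n) (B (seq x (suc n))))
            ≡⟨ solve 5 (λ u v A B t → (u :- A) :+ :- (v :- B) := (t :+ (u :- v)) :- (t :+ (A :- B))) refl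
                 (c (suc n) ℚ.* t′ (suc n)) (s (suc n) ℚ.* t (suc n)) (∑ (suc n) (A (seq x (suc n)))) (∑ (suc n) (B (seq x (suc n)))) (t′ (suc n)) ⟩
          (t′ (suc n) ℚ.+ (c (suc n) ℚ.* t′ (suc n) ℚ.- s (suc n) ℚ.* t (suc n))) ℚ.-
            (t′ (suc n) ℚ.+ (∑ (suc n) (A (seq x (suc n))) ℚ.- ∑ (suc n) (B (seq x (suc n)))))
            ≡⟨ cong (λ u → (t′ (suc n) ℚ.+ (c (suc n) ℚ.* t′ (suc n) ℚ.- s (suc n) ℚ.* t (suc n))) ℚ.- u) (begin
                 t′ (suc n) ℚ.+ (∑ (suc n) (A (seq x (suc n))) ℚ.- ∑ (suc n) (B (seq x (suc n))))
                   ≡⟨ cong (t′ (suc n) ℚ.+_) (∑-- (suc n) (A (seq x (suc n))) (B (seq x (suc n)))) ⟩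
                 t′ (suc n) ℚ.+ ∑ (suc n) (λ m → A (seq x (suc n)) m ℚ.- B (seq x (suc n)) m)
                   ≡⟨ ∑-+ (suc n) (term eulerCosᵇ (seq x (suc n))) (λ m → A (seq x (suc n)) m ℚ.- B (seq x (suc n)) m) ⟩
                 ∑ (suc n) (λ m → term eulerCosᵇ (seq x (suc n)) m ℚ.+ (A (seq x (suc n)) m ℚ.- B (seq x (suc n)) m))
                   ≡⟨ ∑-cong (suc n) (coefficient (seq x (suc n))) ⟩
                 ∑ (suc n) (term (λ m → cosᶜ m ℚ.* ℚ.- const (fromℕ 2) m) (seq x (suc n)))
                   ≡⟨ cong (ℚ.- fromℕ 2 ℚ.+_) (trans (∑-cong n λ m →
                        solve 2 (λ c y → c :* :- con 0ℚ :* y := con 0ℚ) refl (cosᶜ (suc m)) (seq x (suc n) ^^ suc m)) (∑-0 n)) ⟩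
                 ℚ.- fromℕ 2 ℚ.+ 0ℚ ∎) ⟩
          (t′ (suc n) ℚ.+ (c (suc n) ℚ.* t′ (suc n) ℚ.- s (suc n) ℚ.* t (suc n))) ℚ.- ℚ.- fromℕ 2 ∎)
        (small (suc n) (ℕProps.m≤n⇒m≤1+n N≤n)) }
      where
      c s t t′ : ℕ → ℚ
      c = seq C
      s = seq S
      t = seq T
      t′ = seq T′
      A B : ℚ → PowerSeries
      A r = term cosᵇ r ⊛ term eulerCosᵇ r
      B r = term sinᵇ r ⊛ term eulerSinᵇ r
      products : Null (λ n → (c n ℚ.* t′ n ℚ.- ∑ n (A (seq x n))) ℚ.+ ℚ.- (s n ℚ.* t n ℚ.- ∑ n (B (seq x n))))
      products = null-+ (eval-product cosᵇ-tame eulerCosᵇ-tame x x x≤ x≤)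
                        (null-neg (eval-product sinᵇ-tame eulerSinᵇ-tame x x x≤ x≤))
      coefficient : ∀ r m → term eulerCosᵇ r m ℚ.+ (A r m ℚ.- B r m) ≡ term (λ m → cosᶜ m ℚ.* ℚ.- const (fromℕ 2) m) r m
      coefficient r m = begin
        term eulerCosᵇ r m ℚ.+ (A r m ℚ.- B r m)
          ≡⟨ cong₂ (λ u v → term eulerCosᵇ r m ℚ.+ (u ℚ.- v)) (⊛-^ m r cosᵇ eulerCosᵇ) (⊛-^ m r sinᵇ eulerSinᵇ) ⟨
        term eulerCosᵇ r m ℚ.+ (r ^^ m ℚ.* (cosᵇ ⊛ eulerCosᵇ) m ℚ.- r ^^ m ℚ.* (sinᵇ ⊛ eulerSinᵇ) m)
          ≡⟨ solve 5 (λ c e y u v → c :* e :* y :+ (y :* u :- y :* v) := y :* (c :* e :+ (u :- v))) refl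
               (cosᶜ m) (-eulerᶜ m) (r ^^ m) ((cosᵇ ⊛ eulerCosᵇ) m) ((sinᵇ ⊛ eulerSinᵇ) m) ⟩
        r ^^ m ℚ.* (cosᶜ m ℚ.* -eulerᶜ m ℚ.+ ((cosᵇ ⊛ eulerCosᵇ) m ℚ.- (sinᵇ ⊛ eulerSinᵇ) m))
          ≡⟨ cong (λ u → r ^^ m ℚ.* (cosᶜ m ℚ.* -eulerᶜ m ℚ.+ u)) (cosᶜ-⊛ m 0 expSeries -eulerᶜ) ⟩
        r ^^ m ℚ.* (cosᶜ m ℚ.* -eulerᶜ m ℚ.+ cosᶜ m ℚ.* (expSeries ⊛ -eulerᶜ) m)
          ≡⟨ solve 4 (λ c e y u → y :* (c :* e :+ c :* u) := c :* (e :+ u) :* y) refl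
               (cosᶜ m) (-eulerᶜ m) (r ^^ m) ((expSeries ⊛ -eulerᶜ) m) ⟩
        cosᶜ m ℚ.* (-eulerᶜ m ℚ.+ (expSeries ⊛ -eulerᶜ) m) ℚ.* r ^^ m
          ≡⟨ cong (λ u → cosᶜ m ℚ.* u ℚ.* r ^^ m) (-eulerᶜ-generating m) ⟩
        cosᶜ m ℚ.* ℚ.- const (fromℕ 2) m ℚ.* r ^^ m ∎

    euler-odd : T + (S * T′ + C * T) ≈ ι 0ℚ
    euler-odd = null-resp
      (λ n → begin
        (s n ℚ.* t′ n ℚ.- ∑ n (A (seq x n))) ℚ.+ (c n ℚ.* t n ℚ.- ∑ n (B (seq x n)))
          ≡⟨ solve 5 (λ u v A B t → (u :- A) :+ (v :- B) := (t :+ (u :+ v)) :- (t :+ (A :+ B))) refl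
               (s n ℚ.* t′ n) (c n ℚ.* t n) (∑ n (A (seq x n))) (∑ n (B (seq x n))) (t n) ⟩
        (t n ℚ.+ (s n ℚ.* t′ n ℚ.+ c n ℚ.* t n)) ℚ.- (t n ℚ.+ (∑ n (A (seq x n)) ℚ.+ ∑ n (B (seq x n))))
          ≡⟨ cong (λ u → (t n ℚ.+ (s n ℚ.* t′ n ℚ.+ c n ℚ.* t n)) ℚ.- u) (begin
               t n ℚ.+ (∑ n (A (seq x n)) ℚ.+ ∑ n (B (seq x n)))
                 ≡⟨ cong (t n ℚ.+_) (∑-+ n (A (seq x n)) (B (seq x n))) ⟩
               t n ℚ.+ ∑ n (A (seq x n) ⊕ B (seq x n))
                 ≡⟨ ∑-+ n (term eulerSinᵇ (seq x n)) (A (seq x n) ⊕ B (seq x n)) ⟩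
               ∑ n (term eulerSinᵇ (seq x n) ⊕ (A (seq x n) ⊕ B (seq x n)))
                 ≡⟨ ∑-cong n (coefficient (seq x n)) ⟩
               ∑ n (λ _ → 0ℚ)
                 ≡⟨ ∑-0 n ⟩
               0ℚ ∎) ⟩
        (t n ℚ.+ (s n ℚ.* t′ n ℚ.+ c n ℚ.* t n)) ℚ.- 0ℚ ∎)
      (null-+ (eval-product sinᵇ-tame eulerCosᵇ-tame x x x≤ x≤) (eval-product cosᵇ-tame eulerSinᵇ-tame x x x≤ x≤))
      where
      c s t t′ : ℕ → ℚ
      c = seq C
      s = seq S
      t = seq T
      t′ = seq T′
      A B : ℚ → PowerSeries
      A r = term sinᵇ r ⊛ term eulerCosᵇ r
      B r = term cosᵇ r ⊛ term eulerSinᵇ r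
      sinᶜ-const : ∀ m → sinᶜ m ℚ.* ℚ.- const (fromℕ 2) m ≡ 0ℚ
      sinᶜ-const zero    = refl
      sinᶜ-const (suc m) = ℚProps.*-zeroʳ (cosᶜ m)
      coefficient : ∀ r m → term eulerSinᵇ r m ℚ.+ (A r m ℚ.+ B r m) ≡ 0ℚ
      coefficient r m = begin
        term eulerSinᵇ r m ℚ.+ (A r m ℚ.+ B r m)
          ≡⟨ cong₂ (λ u v → term eulerSinᵇ r m ℚ.+ (u ℚ.+ v)) (⊛-^ m r sinᵇ eulerCosᵇ) (⊛-^ m r cosᵇ eulerSinᵇ) ⟨
        term eulerSinᵇ r m ℚ.+ (r ^^ m ℚ.* (sinᵇ ⊛ eulerCosᵇ) m ℚ.+ r ^^ m ℚ.* (cosᵇ ⊛ eulerSinᵇ) m)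
          ≡⟨ solve 5 (λ c e y u v → c :* e :* y :+ (y :* u :+ y :* v) := y :* (c :* e :+ (u :+ v))) refl
               (sinᶜ m) (-eulerᶜ m) (r ^^ m) ((sinᵇ ⊛ eulerCosᵇ) m) ((cosᵇ ⊛ eulerSinᵇ) m) ⟩
        r ^^ m ℚ.* (sinᶜ m ℚ.* -eulerᶜ m ℚ.+ ((sinᵇ ⊛ eulerCosᵇ) m ℚ.+ (cosᵇ ⊛ eulerSinᵇ) m))
          ≡⟨ cong (λ u → r ^^ m ℚ.* (sinᶜ m ℚ.* -eulerᶜ m ℚ.+ u)) (sinᶜ-⊛ m 0 expSeries -eulerᶜ) ⟩
        r ^^ m ℚ.* (sinᶜ m ℚ.* -eulerᶜ m ℚ.+ sinᶜ m ℚ.* (expSeries ⊛ -eulerᶜ) m)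
          ≡⟨ solve 4 (λ c e y u → y :* (c :* e :+ c :* u) := c :* (e :+ u) :* y) refl
               (sinᶜ m) (-eulerᶜ m) (r ^^ m) ((expSeries ⊛ -eulerᶜ) m) ⟩
        sinᶜ m ℚ.* (-eulerᶜ m ℚ.+ (expSeries ⊛ -eulerᶜ) m) ℚ.* r ^^ m
          ≡⟨ cong (λ u → sinᶜ m ℚ.* u ℚ.* r ^^ m) (-eulerᶜ-generating m) ⟩
        sinᶜ m ℚ.* ℚ.- const (fromℕ 2) m ℚ.* r ^^ m
          ≡⟨ trans (cong (ℚ._* r ^^ m) (sinᶜ-const m)) (ℚProps.*-zeroˡ (r ^^ m)) ⟩
        0ℚ ∎

    -- T′ is eliminated: (1 + C) times the odd equation minus S times the even one leaves T ((1 +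
    -- C)² + S²) = 2S, and (1 + C)² + S² = 2(1 + C) by Pythagoras. The factors ½ divide by the
    -- common 2.
    euler-tangent : T * (ι 1ℚ + C) ≈ S
    euler-tangent = null-resp
      (λ n → solve 4 (λ S C T T′ →
          ((con ½ :* (con 1ℚ :+ C)) :* ((T :+ (S :* T′ :+ C :* T)) :- con 0ℚ)
            :+ (:- (con ½ :* S)) :* ((T′ :+ (C :* T′ :- S :* T)) :- con (ℚ.- fromℕ 2)))
            :+ (:- (con ½ :* T)) :* ((C :* C :+ S :* S) :- con 1ℚ)
          := T :* (con 1ℚ :+ C) :- S)
        refl (seq S n) (seq C n) (seq T n) (seq T′ n))
      (null-+ (null-+ (null-* (ι ½ * (ι 1ℚ + C)) euler-odd) (null-* (- (ι ½ * S)) euler-even))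
              (null-* (- (ι ½ * T)) (pythagoras x x≤)))

-- The integrals

module Integration (p : ℕ) (p-prime : Prime p) (p≢2 : p ≢ 2) where
  open Padic p p-prime
  open Analysis p p-prime
  open Arithmetic p p-prime p≢2
  open Trigonometry p p-prime p≢2

  ∥∥-resp : ∀ {k} x y → x ≈ y → ∥ y ∥≤p^- k → ∥ x ∥≤p^- k
  ∥∥-resp {k} x y x≈y y≤ = ev-resp (λ n → solve 2 (λ x y → (x :- y) :+ y := x) refl (seq x n) (seq y n))
    (ev-+ {k = k} (x≈y k) y≤)

  near-2 : ∀ y → ∥ y - ι (fromℕ 2) ∥≤p^- 1 → Invertible y
  near-2 = near-unit (fromℕ 2) ½ refl ½-integral

  near-4 : ∀ y → ∥ y - ι (fromℕ 4) ∥≤p^- 1 → Invertible y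
  near-4 = near-unit (fromℕ 4) (½ ℚ.* ½) refl (*-≤ ½-integral ½-integral)

  const-integral : ∀ n → ∥ ι (fromℕ n) ∥≤p^- 0
  const-integral n = 0 , λ _ _ → fromℕ-≤ n

  module _ (a : ℤₚ) (a≤ : Small (val a)) where

    multiple-small : ∀ (x : ℤₚ) → Small (val a * val x)
    multiple-small x = ev-* a≤ (integral x)

    sin[a*_] : ℤₚ → ℚₚ
    sin[a* x ] = sinₚ (val a * val x) (multiple-small x)

    S C t : ℚₚ
    S = sinₚ (val a) a≤
    C = cosₚ (val a) a≤
    t = eval eulerSinᵇ eulerSinᵇ-tame (val a) a≤

    s c : ℕ → ℚₚ
    s n = sin[a* ℕ→ℤₚ n ]
    c n = cosₚ (val a * val (ℕ→ℤₚ n)) (multiple-small (ℕ→ℤₚ n))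

    C-near-1 : ∥ C - ι 1ℚ ∥≤p^- 1
    C-near-1 = eval-near-0 cosᵇ-tame (val a) a≤ a≤

    step-small : ∀ n → Small (val a * val (ℕ→ℤₚ n) + val a)
    step-small n = ev-+ {k = 1} (multiple-small (ℕ→ℤₚ n)) a≤

    step≡ : ∀ n m → seq (val a * val (ℕ→ℤₚ (suc n))) m ≡ seq (val a * val (ℕ→ℤₚ n) + val a) m
    step≡ n m = trans (cong (seq (val a) m ℚ.*_) (fromℕ-suc n))
      (solve 2 (λ a n → a :* (n :+ con 1ℚ) := a :* n :+ a) refl (seq (val a) m) (fromℕ n))

    s-step : ∀ n → s (suc n) ≈ s n * C + c n * S
    s-step n = null-resp
      (λ m → solve 3 (λ x y z → (x :- y) :+ (y :- z) := x :- z) refl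
        (seq (s (suc n)) m) (seq s′ m) (seq (s n * C + c n * S) m))
      (null-+ (eval-≡ sinᵇ-tame (val a * val (ℕ→ℤₚ (suc n))) (val a * val (ℕ→ℤₚ n) + val a)
                 {multiple-small (ℕ→ℤₚ (suc n))} {step-small n} (step≡ n))
              (sin-+ (val a * val (ℕ→ℤₚ n)) (val a) {multiple-small (ℕ→ℤₚ n)} {a≤} {step-small n}))
      where s′ = sinₚ (val a * val (ℕ→ℤₚ n) + val a) (step-small n)

    c-step : ∀ n → c (suc n) ≈ c n * C - s n * S
    c-step n = null-resp
      (λ m → solve 3 (λ x y z → (x :- y) :+ (y :- z) := x :- z) refl
        (seq (c (suc n)) m) (seq c′ m) (seq (c n * C - s n * S) m))
      (null-+ (eval-≡ cosᵇ-tame (val a * val (ℕ→ℤₚ (suc n))) (val a * val (ℕ→ℤₚ n) + val a)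
                 {multiple-small (ℕ→ℤₚ (suc n))} {step-small n} (step≡ n))
              (cos-+ (val a * val (ℕ→ℤₚ n)) (val a) {multiple-small (ℕ→ℤₚ n)} {a≤} {step-small n}))
      where c′ = cosₚ (val a * val (ℕ→ℤₚ n) + val a) (step-small n)

    power-multiple : ∀ N → ∥ val a * val (ℕ→ℤₚ (p ℕ.^ N)) ∥≤p^- N
    power-multiple N = ev-mono (ℕProps.n≤1+n N) (ev-* a≤ (0 , λ _ _ → fraction (+ 1) 1 p∤1
      (trans (ℚProps.*-identityʳ (fromℕ (p ℕ.^ N))) (sym (ℚProps.*-identityˡ (fromℕ (p ℕ.^ N)))))))

    s-power : ∀ N → ∥ s (p ℕ.^ N) - ι 0ℚ ∥≤p^- N
    s-power N = eval-near-0 sinᵇ-tame (val a * val (ℕ→ℤₚ (p ℕ.^ N))) (multiple-small (ℕ→ℤₚ (p ℕ.^ N))) (power-multiple N)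

    c-power : ∀ N → ∥ c (p ℕ.^ N) - ι 1ℚ ∥≤p^- N
    c-power N = eval-near-0 cosᵇ-tame (val a * val (ℕ→ℤₚ (p ℕ.^ N))) (multiple-small (ℕ→ℤₚ (p ℕ.^ N))) (power-multiple N)

    origin : Null (seq (val a * val (ℕ→ℤₚ 0)))
    origin = null-zero λ n → ℚProps.*-zeroʳ (seq (val a) n)

    -- The integral for a fixed q

    module _ (q : ℚₚ) where

      W : ℕ → ℚₚ
      W = sum (λ x → sin[a* ℕ→ℤₚ x ] * q ^ x)

      -- The norm (1 - q e^(ia)) (1 - q e^(-ia)), which clears the denominator of the geometric sum
      -- of (q e^(ia))ˣ.
      D : ℚₚ
      D = (ι 1ℚ - (q + q) * C) + q * q

      -- From s (x + 1) + s (x − 1) = 2 C s x, written with s (x − 1) = s x C − c x S.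
      geometric-sine : ∀ M → D * W M ≈ (q * S - q ^ M * s M) + (q * q ^ M) * (s M * C - c M * S)
      geometric-sine zero = null-resp
        (λ n → solve 5 (λ q S C s c →
            (con 1ℚ :- q :* C) :* (s :- con 0ℚ) :+ (q :* S) :* (c :- con 1ℚ)
            := ((con 1ℚ :- (q :+ q) :* C) :+ q :* q) :* con 0ℚ
               :- ((q :* S :- con 1ℚ :* s) :+ (q :* con 1ℚ) :* (s :* C :- c :* S)))
          refl (seq q n) (seq S n) (seq C n) (seq (s 0) n) (seq (c 0) n))
        (null-+ (null-* (ι 1ℚ - q * C) (λ k → eval-near-0 sinᵇ-tame (val a * val (ℕ→ℤₚ 0)) (multiple-small (ℕ→ℤₚ 0)) (origin k)))
                (null-* (q * S) (λ k → eval-near-0 cosᵇ-tame (val a * val (ℕ→ℤₚ 0)) (multiple-small (ℕ→ℤₚ 0)) (origin k))))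
      -- Once s′ and c′ are expanded by the addition formulas, s′ C - c′ S becomes s (C² + S²);
      -- Pythagoras reduces it to s.
      geometric-sine (suc M) = null-resp
        (λ n → solve 9 (λ q Q S C s c s′ c′ W →
            ((((con 1ℚ :- (q :+ q) :* C) :+ q :* q) :* W
               :- ((q :* S :- Q :* s) :+ (q :* Q) :* (s :* C :- c :* S)))
             :+ (q :* Q :- q :* q :* Q :* C) :* (s′ :- (s :* C :+ c :* S)))
            :+ ((q :* q :* Q :* S) :* (c′ :- (c :* C :- s :* S))
             :+ (:- (q :* q :* Q :* s)) :* ((C :* C :+ S :* S) :- con 1ℚ))
            := ((con 1ℚ :- (q :+ q) :* C) :+ q :* q) :* (W :+ s :* Q)
               :- ((q :* S :- (q :* Q) :* s′) :+ (q :* (q :* Q)) :* (s′ :* C :- c′ :* S)))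
          refl (seq q n) (seq (q ^ M) n) (seq S n) (seq C n) (seq (s M) n) (seq (c M) n)
               (seq (s (suc M)) n) (seq (c (suc M)) n) (seq (W M) n))
        (null-+ (null-+ (geometric-sine M) (null-* (q * q ^ M - q * q * q ^ M * C) (s-step M)))
                (null-+ (null-* (q * q * q ^ M * S) (c-step M))
                        (null-* (- (q * q * q ^ M * s M)) (pythagoras (val a) a≤))))

      module _ (q≤ : ∥ q - ι (ℚ.- 1ℚ) ∥≤p^- 1) where

        q-integral : ∥ q ∥≤p^- 0
        q-integral = ev-resp (λ n → solve 1 (λ q → (q :- con (ℚ.- 1ℚ)) :+ con (ℚ.- 1ℚ) := q) refl (seq q n))
          (ev-+ {k = 0} (ev-mono z≤n q≤) (0 , λ _ _ → neg-≤ (fromℕ-≤ 1)))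

        C-integral : ∥ C ∥≤p^- 0
        C-integral = eval-integral cosᵇ-tame (val a) a≤

        S-integral : ∥ S ∥≤p^- 0
        S-integral = eval-integral sinᵇ-tame (val a) a≤

        power-integral : ∀ m → ∥ q ^ m ∥≤p^- 0
        power-integral zero    = const-integral 1
        power-integral (suc m) = ev-* {k = 0} q-integral (power-integral m)

        -- Induction in steps of two, by q² Q + 1 = q² (Q + 1) - (q - 1)(q + 1). Precision k is
        -- preserved, so at q = -1 this also gives q^M ≈ -1.
        odd-power : ∀ {k M} → ∥ q - ι (ℚ.- 1ℚ) ∥≤p^- k → Odd M → ∥ q ^ M - ι (ℚ.- 1ℚ) ∥≤p^- k
        odd-power {k} q≤k (m , refl) = go m
          where
          go : ∀ m → ∥ q ^ (1 ℕ.+ m ℕ.* 2) - ι (ℚ.- 1ℚ) ∥≤p^- k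
          go zero    = ev-resp (λ n → solve 1 (λ q → q :- con (ℚ.- 1ℚ) := q :* con 1ℚ :- con (ℚ.- 1ℚ)) refl (seq q n)) q≤k
          go (suc m) = ev-resp
            (λ n → solve 2 (λ q Q → (q :* q) :* (Q :- con (ℚ.- 1ℚ)) :+ (:- (q :- con 1ℚ)) :* (q :- con (ℚ.- 1ℚ))
                                   := q :* (q :* Q) :- con (ℚ.- 1ℚ))
              refl (seq q n) (seq (q ^ (1 ℕ.+ m ℕ.* 2)) n))
            (ev-+ {k = k} (ev-* {k = 0} (ev-* {k = 0} q-integral q-integral) (go m))
              (ev-* {k = 0} (ev-neg (ev-+ {k = 0} q-integral (0 , λ _ _ → neg-≤ (fromℕ-≤ 1)))) q≤k))

        1-power-invertible : ∀ M → Odd M → Invertible (ι 1ℚ - q ^ M)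
        1-power-invertible M M-odd = near-2 (ι 1ℚ - q ^ M)
          (ev-resp (λ n → solve 1 (λ Q → :- (Q :- con (ℚ.- 1ℚ)) := (con 1ℚ :- Q) :- con (fromℕ 2)) refl (seq (q ^ M) n))
            (ev-neg (odd-power {1} {M} q≤ M-odd)))

        1-q-invertible : Invertible (ι 1ℚ - q)
        1-q-invertible = near-2 (ι 1ℚ - q)
          (ev-resp (λ n → solve 1 (λ Q → :- (Q :- con (ℚ.- 1ℚ)) := (con 1ℚ :- Q) :- con (fromℕ 2)) refl (seq q n))
            (ev-neg q≤))

        -- At q = -1 and C = 1 the value is 4; the deviation from it is -2q (C - 1) + (q - 3)(q +
        -- 1).
        D-invertible : Invertible D
        D-invertible = near-4 D (ev-resp
          (λ n → solve 2 (λ q C → (:- (q :+ q)) :* (C :- con 1ℚ) :+ (q :- con (fromℕ 3)) :* (q :- con (ℚ.- 1ℚ))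
                                 := ((con 1ℚ :- (q :+ q) :* C) :+ q :* q) :- con (fromℕ 4)) refl (seq q n) (seq C n))
          (ev-+ {k = 1} (ev-* {k = 0} (ev-neg (ev-+ {k = 0} q-integral q-integral)) C-near-1)
            (ev-* {k = 0} (ev-+ {k = 0} q-integral (ev-neg (const-integral 3))) q≤)))

        D⁻¹ : ℚₚ
        D⁻¹ = proj₁ D-invertible

        M : ℕ → ℕ
        M N = p ℕ.^ N

        M-odd : ∀ N → Odd (M N)
        M-odd = odd-^ (prime-odd p-prime p≢2)

        U : ℕ → ℚₚ
        U N = proj₁ (1-power-invertible (M N) (M-odd N))

        V : ℚₚ
        V = proj₁ 1-q-invertible

        bracket : ℕ → ℚₚ
        bracket N = (ι 1ℚ - q ^ M N) * V

        quotient : ℕ → ℚₚ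
        quotient N = W (M N) * ((ι 1ℚ - q) * U N)

        limit : ℚₚ
        limit = D⁻¹ * (q * (ι 1ℚ - q) * S)

        bracket-spec : ∀ N → IsBracket q (p ℕ.^ N) (bracket N)
        bracket-spec N = V , proj₁ (proj₂ 1-q-invertible) , null-zero λ n → ℚProps.+-inverseʳ (seq (bracket N) n)

        quotient-spec : ∀ N → quotient N ≈ weightedSum q sin[a*_] N ÷ bracket N
        quotient-spec N = (ι 1ℚ - q) * U N ,
          null-resp
            (λ n → solve 4 (λ q Q U V →
                ((con 1ℚ :- q) :* V) :* ((con 1ℚ :- Q) :* U :- con 1ℚ) :+ con 1ℚ :* ((con 1ℚ :- q) :* V :- con 1ℚ)
                := ((con 1ℚ :- Q) :* V) :* ((con 1ℚ :- q) :* U) :- con 1ℚ)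
              refl (seq q n) (seq (q ^ M N) n) (seq (U N) n) (seq V n))
            (null-+ (null-* ((ι 1ℚ - q) * V) (proj₁ (proj₂ (1-power-invertible (M N) (M-odd N)))))
                    (null-* (ι 1ℚ) (proj₁ (proj₂ 1-q-invertible)))) ,
          null-zero λ n → ℚProps.+-inverseʳ (seq (quotient N) n)

        -- In the closed form of D W, with Q = q^M, the part qS - qQcS is qS (1 - Q) - qQS (c - 1).
        -- The factor 1 - Q cancels against `U N` and leaves `limit`; what remains carries a factor
        -- s or c - 1, both of size at most p^(-N).
        quotient-error : ∀ N → quotient N - limit ≈
          (D⁻¹ * (ι 1ℚ - q) * U N * q ^ M N) * ((q * C - ι 1ℚ) * (s (M N) - ι 0ℚ) - q * S * (c (M N) - ι 1ℚ))
        quotient-error N = null-resp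
          (λ n → solve 10 (λ q Q S C s c W D′ U D →
              ((D′ :* (con 1ℚ :- q) :* U) :* (D :* W :- ((q :* S :- Q :* s) :+ (q :* Q) :* (s :* C :- c :* S)))
               :+ (:- (W :* (con 1ℚ :- q) :* U)) :* (D :* D′ :- con 1ℚ))
              :+ (D′ :* q :* (con 1ℚ :- q) :* S) :* ((con 1ℚ :- Q) :* U :- con 1ℚ)
              := (W :* ((con 1ℚ :- q) :* U) :- D′ :* (q :* (con 1ℚ :- q) :* S))
                 :- (D′ :* (con 1ℚ :- q) :* U :* Q) :* ((q :* C :- con 1ℚ) :* (s :- con 0ℚ) :- q :* S :* (c :- con 1ℚ)))
            refl (seq q n) (seq (q ^ M N) n) (seq S n) (seq C n) (seq (s (M N)) n) (seq (c (M N)) n)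
                 (seq (W (M N)) n) (seq D⁻¹ n) (seq (U N) n) (seq D n))
          (null-+ (null-+ (null-* (D⁻¹ * (ι 1ℚ - q) * U N) (geometric-sine (M N)))
                          (null-* (- (W (M N) * (ι 1ℚ - q) * U N)) (proj₁ (proj₂ D-invertible))))
                  (null-* (D⁻¹ * q * (ι 1ℚ - q) * S) (proj₁ (proj₂ (1-power-invertible (M N) (M-odd N))))))

        1-q-integral : ∥ ι 1ℚ - q ∥≤p^- 0
        1-q-integral = ev-+ {k = 0} (const-integral 1) (ev-neg q-integral)

        D⁻¹-integral : ∥ D⁻¹ ∥≤p^- 0
        D⁻¹-integral = proj₂ (proj₂ D-invertible)

        quotient-converges : quotient ⟶ limit
        quotient-converges k = k , λ N k≤N → ∥∥-resp (quotient N - limit)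
          ((D⁻¹ * (ι 1ℚ - q) * U N * q ^ M N) * ((q * C - ι 1ℚ) * (s (M N) - ι 0ℚ) - q * S * (c (M N) - ι 1ℚ)))
          (quotient-error N)
          (ev-* {k = 0} (ev-* {k = 0} {l = 0} (ev-* {k = 0} {l = 0} (ev-* {k = 0} {l = 0} D⁻¹-integral 1-q-integral)
              (proj₂ (proj₂ (1-power-invertible (M N) (M-odd N))))) (power-integral (M N)))
            (ev-+ {k = k}
              (ev-* {k = 0} (ev-+ {k = 0} (ev-* {k = 0} {l = 0} q-integral C-integral) (ev-neg (const-integral 1)))
                (ev-mono k≤N (s-power N)))
              (ev-neg (ev-* {k = 0} (ev-* {k = 0} {l = 0} q-integral S-integral) (ev-mono k≤N (c-power N))))))

        integral-spec : IsIntegral q sin[a*_] limit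
        integral-spec = bracket , quotient , bracket-spec , quotient-spec , quotient-converges

        -- After S is replaced by t (1 + C), this is the identity q (1 - q)(1 + C) + D = (1 + q)(1 -
        -- qC).
        limit-error : limit - (- t) ≈ (D⁻¹ * t * (ι 1ℚ - q * C)) * (q - ι (ℚ.- 1ℚ))
        limit-error = null-resp
          (λ n → solve 5 (λ q S C t D′ →
              (:- (D′ :* q :* (con 1ℚ :- q))) :* (t :* (con 1ℚ :+ C) :- S)
              :+ (:- t) :* (((con 1ℚ :- (q :+ q) :* C) :+ q :* q) :* D′ :- con 1ℚ)
              := (D′ :* (q :* (con 1ℚ :- q) :* S) :- (:- t)) :- (D′ :* t :* (con 1ℚ :- q :* C)) :* (q :- con (ℚ.- 1ℚ)))
            refl (seq q n) (seq S n) (seq C n) (seq t n) (seq D⁻¹ n))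
          (null-+ (null-* (- (D⁻¹ * q * (ι 1ℚ - q))) (euler-tangent (val a) a≤))
                  (null-* (- t) (proj₁ (proj₂ D-invertible))))

        limit-close : ∀ {k} → ∥ q - ι (ℚ.- 1ℚ) ∥≤p^- k → ∥ limit - (- t) ∥≤p^- k
        limit-close {k} q≤k = ∥∥-resp (limit - (- t)) ((D⁻¹ * t * (ι 1ℚ - q * C)) * (q - ι (ℚ.- 1ℚ))) limit-error
          (ev-* {k = 0} (ev-* {k = 0} {l = 0} (ev-* {k = 0} {l = 0} D⁻¹-integral (eval-integral eulerSinᵇ-tame (val a) a≤))
              (ev-+ {k = 0} (const-integral 1) (ev-neg (ev-* {k = 0} {l = 0} q-integral C-integral))))
            q≤k)

    limit-of-integrals : IsLimitOfIntegrals sin[a*_] (- t)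
    -- The radius k + 1 guarantees both |q + 1| ≤ p⁻¹, on which the inverses depend, and |q + 1| ≤
    -- p⁻ᵏ for the final estimate.
    limit-of-integrals k = suc k , λ q q≤ _ →
      let q≤1 = ev-mono (s≤s z≤n) q≤
      in limit q q≤1 , integral-spec q q≤1 , limit-close q q≤1 (ev-mono (ℕProps.n≤1+n k) q≤)

    -- At q = −1 the bracket [p^N]_q is 1, so the quotients are the alternating sums.
    alternating-converges : weightedSum (ι (ℚ.- 1ℚ)) sin[a*_] ⟶ - t
    alternating-converges k =
      let N₀ , close = quotient-converges q q≤ k
      in N₀ , λ N N₀≤N → ev-resp
           (λ n → solve 4 (λ W Y L T → ((W :- Y) :+ (Y :- L)) :+ (L :- T) := W :- T) refl
             (seq (weightedSum q sin[a*_] N) n) (seq (quotient q q≤ N) n) (seq (limit q q≤) n) (seq (- t) n))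
           (ev-+ {k = k} (ev-+ {k = k} (quotient≈sum N k) (close N N₀≤N)) (limit-close q q≤ (q≈-1 k)))
      where
      q : ℚₚ
      q = ι (ℚ.- 1ℚ)
      q≈-1 : q ≈ ι (ℚ.- 1ℚ)
      q≈-1 = null-zero λ _ → refl
      q≤ : ∥ q - ι (ℚ.- 1ℚ) ∥≤p^- 1
      q≤ = q≈-1 1
      quotient≈sum : ∀ N → weightedSum q sin[a*_] N ≈ quotient q q≤ N
      -- Here 1 - q = 2, and 1 - q^M ≈ 2 because M is odd, so the factor (1 - q) U of the quotient
      -- is 1.
      quotient≈sum N = null-resp
        (λ n → solve 3 (λ W Q U →
            (:- W) :* ((con 1ℚ :- Q) :* U :- con 1ℚ) :+ (:- (W :* U)) :* (Q :- con (ℚ.- 1ℚ))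
            := W :- W :* ((con 1ℚ :- con (ℚ.- 1ℚ)) :* U))
          refl (seq (weightedSum q sin[a*_] N) n) (seq (q ^ M q q≤ N) n) (seq (U q q≤ N) n))
        (null-+ (null-* (- weightedSum q sin[a*_] N) (proj₁ (proj₂ (1-power-invertible q q≤ (M q q≤ N) (M-odd q q≤ N)))))
                (null-* (- (weightedSum q sin[a*_] N * U q q≤ N)) (λ k → odd-power q q≤ {k} {M q q≤ N} (q≈-1 k) (M-odd q q≤ N))))

    -- The tangent of the half angle

    half-small : Small (ι ½ * val a)
    half-small = ev-* {k = 0} (0 , λ _ _ → ½-integral) a≤

    -- Doubling the angle h = a/2 gives S = 2 sin h cos h and 1 + C = 2 cos² h, so t (1 + C) = S
    -- becomes t cos² h = sin h cos h. Multiplying by the square of 1 / cos h, which exists as cos h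
    -- ≡ 1 modulo p, isolates t.
    tangent : IsTan (ι ½ * val a) t
    tangent = sinʰ , cosʰ , sin-hasSum h half-small , cos-hasSum h half-small , cos⁻¹ , proj₁ (proj₂ invertible) ,
      null-resp
        (λ n → solve 6 (λ S C t s c i →
            ((con ½ :* i :* i) :* (t :* (con 1ℚ :+ C) :- S)
              :+ (:- (con ½ :* i :* i :* t)) :* (C :- (c :* c :- s :* s)))
            :+ (((con ½ :* i :* i) :* (S :- (s :* c :+ c :* s))
              :+ (con ½ :* i :* i :* t) :* ((c :* c :+ s :* s) :- con 1ℚ))
              :+ (s :* i :- t :* (c :* i :+ con 1ℚ)) :* (c :* i :- con 1ℚ))
            := t :- s :* i)
          refl (seq S n) (seq C n) (seq t n) (seq sinʰ n) (seq cosʰ n) (seq cos⁻¹ n))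
        (null-+ (null-+ (null-* (ι ½ * cos⁻¹ * cos⁻¹) (euler-tangent (val a) a≤))
                        (null-* (- (ι ½ * cos⁻¹ * cos⁻¹ * t)) cos-double))
          (null-+ (null-+ (null-* (ι ½ * cos⁻¹ * cos⁻¹) sin-double)
                          (null-* (ι ½ * cos⁻¹ * cos⁻¹ * t) (pythagoras h half-small)))
                  (null-* (sinʰ * cos⁻¹ - t * (cosʰ * cos⁻¹ + ι 1ℚ)) (proj₁ (proj₂ invertible)))))
      where
      h sinʰ cosʰ : ℚₚ
      h = ι ½ * val a
      sinʰ = sinₚ h half-small
      cosʰ = cosₚ h half-small
      invertible : Invertible cosʰ
      invertible = near-unit 1ℚ 1ℚ refl (fromℕ-≤ 1) cosʰ (eval-near-0 cosᵇ-tame h half-small half-small)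
      cos⁻¹ : ℚₚ
      cos⁻¹ = proj₁ invertible
      h+h : ∀ n → seq (val a) n ≡ seq (h + h) n
      h+h n = solve 1 (λ a → a := con ½ :* a :+ con ½ :* a) refl (seq (val a) n)
      h+h≤ : Small (h + h)
      h+h≤ = ev-+ {k = 1} half-small half-small
      sin-double : S ≈ sinʰ * cosʰ + cosʰ * sinʰ
      sin-double = null-resp
        (λ n → solve 3 (λ x y z → (x :- y) :+ (y :- z) := x :- z) refl
          (seq S n) (seq (sinₚ (h + h) h+h≤) n) (seq (sinʰ * cosʰ + cosʰ * sinʰ) n))
        (null-+ (eval-≡ sinᵇ-tame (val a) (h + h) {a≤} {h+h≤} h+h) (sin-+ h h {half-small} {half-small} {h+h≤}))
      cos-double : C ≈ cosʰ * cosʰ - sinʰ * sinʰ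
      cos-double = null-resp
        (λ n → solve 3 (λ x y z → (x :- y) :+ (y :- z) := x :- z) refl
          (seq C n) (seq (cosₚ (h + h) h+h≤) n) (seq (cosʰ * cosʰ - sinʰ * sinʰ) n))
        (null-+ (eval-≡ cosᵇ-tame (val a) (h + h) {a≤} {h+h≤} h+h) (cos-+ h h {half-small} {half-small} {h+h≤}))

theorem13 : (p : ℕ) (p-prime : Prime p) → p ≢ 2 →
    let open Padic p p-prime in
    (a : ℤₚ) → Summable (sinTerms (val a)) →
    Σ[ sin[a*_] ∈ (ℤₚ → ℚₚ) ] ((x : ℤₚ) → IsSin (val a * val x) (sin[a*_] x)) ×
    (Σ[ t ∈ ℚₚ ]
    IsTan (ι ½ * val a) t ×
    IsFermionicIntegral sin[a*_] (- t) ×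
    HasSum (eulerTerms (val a)) t)
theorem13 p p-prime p≢2 a summable =
  I.sin[a*_] a a≤ , (λ x → sin-hasSum (val a * val x) (I.multiple-small a a≤ x)) ,
  I.t a a≤ , I.tangent a a≤ , (I.limit-of-integrals a a≤ , I.alternating-converges a a≤) ,
  euler-hasSum (val a) a≤
  where
  open Padic p p-prime
  open Arithmetic p p-prime p≢2
  module I = Integration p p-prime p≢2
  a≤ = summable⇒small a summable
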